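{- Let $\mathbb{F}$ be any field, $k\le n$ positive integers, and $\le$ the neglex term order on $\mathbb{F}[x_1,\dots,x_n]$. The polynomials $h_k(x_1), h_k(x_1,x_2),\dots,h_k(x_1,\dots,x_n)$ together with the Demazure characters $\kappa_{\gamma(S)^*}(x_1,\dots,x_n)$ for all $S\subseteq[n-1]$ with $|S|=n-k+1$ form a Gröbner basis of the ideal $$J_{n,k}=\langle h_k(x_1),\dots,h_k(x_1,\dots,x_n),e_n(x_1,\dots,x_n),\dots,e_{n-k+1}(x_1,\dots,x_n)\rangle$$ with respect to $\le$. When $k<n$, this Gröbner basis is minimal.
   Context: $h_d$ is the complete homogeneous and $e_d$ the elementary symmetric polynomial. neglex is lexicographic order with $x_n>x_{n-1}>\cdots>x_1$. For $S=\{s_1<\cdots<s_m\}\subseteq[n]$, $\gamma(S)=(\gamma_1,\dots,\gamma_n)$ is the weak composition with $\gamma_{s_j}=s_j-j+1$ and $\gamma_i=0$ for $i\notin S$; $\gamma(S)^*=(\gamma_n,\dots,\gamma_1)$. Demazure characters: for a weak composition $\gamma$ of length $n$, $\kappa_\gamma=x_1^{\gamma_1}\cdots x_n^{\gamma_n}$ if $\gamma_1\ge\cdots\ge\gamma_n$, and if $\gamma_i<\gamma_{i+1}$ then $\kappa_\gamma=\pi_i(\kappa_{s_i\gamma})$, where $s_i\gamma$ swaps the $i$-th and $(i+1)$-st entries and $\pi_i(f)=(x_if-x_{i+1}s_i(f))/(x_i-x_{i+1})$ is the isobaric Demazure operator. A Gröbner basis $G\subseteq I$ satisfies $\mathrm{in}_<(I)=\langle\mathrm{in}_<(g):g\in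 G\rangle$; it is minimal if all leading coefficients are $1$ and no leading monomial of an element divides the leading monomial of another. -}

module Defs where

open import Level using (Level; _⊔_) renaming (suc to lsuc)
open import Algebra.Bundles using (CommutativeRing)
open import Data.Nat as ℕ using (ℕ; zero; suc; _≤_; _<_; _∸_; _+_; _≡ᵇ_)
open import Data.Bool using (Bool; true; false; if_then_else_; _∧_)
open import Data.Fin as Fin using (Fin; toℕ)
open import Data.Fin.Subset using (Subset; Side; inside; outside; _∈_; ∣_∣)
open import Data.Vec as Vec using (Vec; []; _∷_; lookup; _[_]≔_; reverse)
open import Data.Vec.Properties using (≡-dec)
open import Data.List as List using (List; []; _∷_; map; concatMap; foldr; upTo)
open import Data.List.Relation.Unary.All using (All)
open import Data.Product using (Σ; _×_; _,_; ∃)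
open import Data.Sum using (_⊎_)
open import Relation.Nullary using (¬_; does)
open import Relation.Binary.PropositionalEquality using (_≡_)
open import Function.Bundles using (_⇔_)

record Field (c ℓ : Level) : Set (lsuc (c ⊔ ℓ)) where
  field
    commutativeRing : CommutativeRing c ℓ
  open CommutativeRing commutativeRing public
  field
    1≉0     : ¬ (1# ≈ 0#)
    inverse : ∀ x → ¬ (x ≈ 0#) → Σ Carrier λ y → (x * y) ≈ 1#

-- Combinatorial helpers on exponent vectors (monomials).
-- A monomial x_1^{a_1} ⋯ x_n^{a_n} is the vector (a_1 , … , a_n) : Vec ℕ n;
-- position i : Fin n (toℕ i = 0 … n-1) is the exponent of x_{toℕ i + 1}.

Mono : ℕ → Set
Mono n = Vec ℕ n

deg : ∀ {n} → Mono n → ℕ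
deg []       = 0
deg (a ∷ as) = a + deg as

splits : ∀ {n} → Mono n → List (Mono n × Mono n)
splits []       = ([] , []) ∷ []
splits (x ∷ m) =
  concatMap (λ i → map (λ { (a , b) → (i ∷ a , (x ∸ i) ∷ b) }) (splits m))
            (upTo (suc x))

onlyFirst : ∀ {n} → ℕ → Mono n → Bool
onlyFirst j       []       = true
onlyFirst zero    (a ∷ as) = (a ≡ᵇ 0) ∧ onlyFirst zero as
onlyFirst (suc j) (a ∷ as) = onlyFirst j as

squarefree : ∀ {n} → Mono n → Bool
squarefree []            = true
squarefree (0 ∷ as)      = squarefree as
squarefree (1 ∷ as)      = squarefree as
squarefree (suc (suc _) ∷ as) = false

_<neglex_ : ∀ {n} → Mono n → Mono n → Set
_<neglex_ {n} m m' =
  Σ (Fin n) λ i → (lookup m i < lookup m' i)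
                × (∀ j → i Fin.< j → lookup m j ≡ lookup m' j)

_∣ₘ_ : ∀ {n} → Mono n → Mono n → Set
_∣ₘ_ {n} m m' = ∀ (i : Fin n) → lookup m i ≤ lookup m' i

-- the weak composition γ(S) for S ⊆ [n]:
-- γ_{s_j} = s_j - j + 1 and γ_i = 0 for i ∉ S.
-- gammaAux p c S : p = number of positions already passed,
--                  c = number of elements of S already passed.
gammaAux : ∀ {m} → ℕ → ℕ → Subset m → Vec ℕ m
gammaAux p c []            = []
gammaAux p c (inside ∷ S)  = (suc p ∸ c) ∷ gammaAux (suc p) (suc c) S
gammaAux p c (outside ∷ S) = 0 ∷ gammaAux (suc p) c S

γ : ∀ {n} → Subset n → Mono n
γ S = gammaAux 0 0 S

γ* : ∀ {n} → Subset n → Mono n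
γ* S = reverse (γ S)

swapV : ∀ {n} → Fin n → Fin n → Mono n → Mono n
swapV i i' m = (m [ i ]≔ lookup m i') [ i' ]≔ lookup m i

-- Polynomials over F in n variables, represented by their coefficient
-- functions Mono n → F.  (Genuine polynomials are the finitely supported
-- ones, see FinSupp; all ideal coefficients are required to be such.)

module PolyDefs {c ℓ : Level} (F : Field c ℓ) (n : ℕ) where
  open Field F using (Carrier; _≈_; 0#; 1#)
    renaming (_+_ to _+F_; _*_ to _*F_; _-_ to _-F_)

  Poly : Set c
  Poly = Mono n → Carrier

  FinSupp : Poly → Set ℓ
  FinSupp f = Σ ℕ λ D → ∀ m → D < deg m → f m ≈ 0#

  _≋_ : Poly → Poly → Set ℓ
  f ≋ g = ∀ m → f m ≈ g m

  0p : Poly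
  0p _ = 0#

  _+p_ : Poly → Poly → Poly
  (f +p g) m = f m +F g m

  _-p_ : Poly → Poly → Poly
  (f -p g) m = f m -F g m

  _*p_ : Poly → Poly → Poly
  (f *p g) m = foldr _+F_ 0# (map (λ { (a , b) → f a *F g b }) (splits m))

  sumP : List Poly → Poly
  sumP = foldr _+p_ 0p

  monomial : Mono n → Poly
  monomial a m = if does (≡-dec ℕ._≟_ a m) then 1# else 0#

  var : Fin n → Poly
  var i = monomial (Vec.tabulate λ j → if does (i Fin.≟ j) then 1 else 0)

  swapP : Fin n → Fin n → Poly → Poly
  swapP i i' f m = f (swapV i i' m)

  h : ℕ → ℕ → Poly
  h k j m = if (deg m ≡ᵇ k) ∧ onlyFirst j m then 1# else 0#

  e : ℕ → Poly
  e d m = if (deg m ≡ᵇ d) ∧ squarefree m then 1# else 0#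

  InIdeal : ∀ {p} → (Poly → Set p) → Poly → Set (c ⊔ ℓ ⊔ p)
  InIdeal P f =
    Σ (List (Poly × Poly)) λ L →
        All (λ { (a , g) → FinSupp a × P g }) L
      × (f ≋ sumP (map (λ { (a , g) → a *p g }) L))

  IsLM : Poly → Mono n → Set ℓ
  IsLM f m = ¬ (f m ≈ 0#) × (∀ m' → m <neglex m' → f m' ≈ 0#)

  InitSet : ∀ {p} → (Poly → Set p) → Poly → Set (c ⊔ ℓ ⊔ p)
  InitSet P q = Σ Poly λ f → Σ (Mono n) λ m → P f × IsLM f m × (q ≋ monomial m)

  IsGroebnerBasis : ∀ {p q} → (Poly → Set p) → (Poly → Set q) → Set (c ⊔ ℓ ⊔ p ⊔ q)
  IsGroebnerBasis G I =
      (∀ g → G g → I g)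
    × (∀ f → InIdeal (InitSet I) f ⇔ InIdeal (InitSet G) f)

  IsMinimal : ∀ {p} → (Poly → Set p) → Set (c ⊔ ℓ ⊔ p)
  IsMinimal G =
      (∀ g m → G g → IsLM g m → g m ≈ 1#)
    × (∀ g g' m m' → G g → G g' → ¬ (g ≋ g') → IsLM g m → IsLM g' m' → ¬ (m ∣ₘ m'))

  -- Demazure characters: IsKappa γ f means f = κ_γ.  Relational form of the
  -- recursive definition; π_i(g) = (x_i g - x_{i+1} s_i g)/(x_i - x_{i+1})
  -- is expressed by multiplying out the (exact) division.
  data IsKappa : Mono n → Poly → Set (c ⊔ ℓ) where
    dominant : ∀ {a f} →
      (∀ (i j : Fin n) → i Fin.≤ j → lookup a j ≤ lookup a i) →
      f ≋ monomial a → IsKappa a f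
    demazure : ∀ {a f g} (i i' : Fin n) → toℕ i' ≡ suc (toℕ i) →
      lookup a i < lookup a i' →
      IsKappa (swapV i i' a) g →
      ((var i -p var i') *p f) ≋ ((var i *p g) -p (var i' *p swapP i i' g)) →
      IsKappa a f

  Jgens : ℕ → Poly → Set ℓ
  Jgens k f =
      (Σ ℕ λ j → 1 ≤ j × j ≤ n × f ≋ h k j)
    ⊎ (Σ ℕ λ d → (n ∸ k + 1) ≤ d × d ≤ n × f ≋ e d)

  J : ℕ → Poly → Set (c ⊔ ℓ)
  J k = InIdeal (Jgens k)

  Gset : ℕ → Poly → Set (c ⊔ ℓ)
  Gset k f =
      (Σ ℕ λ j → 1 ≤ j × j ≤ n × f ≋ h k j)
    ⊎ (Σ (Subset n) λ S → (∀ i → i ∈ S → suc (toℕ i) < n)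
                         × ∣ S ∣ ≡ n ∸ k + 1
                         × IsKappa (γ* S) f)

open PolyDefs public

-- Demazure characters.  Every composition met here is a partition whose parts are interspersed with zeros.
-- For parts λ_1, …, λ_m at positions q_1 < … < q_m its character is the flagged Schur determinant
-- det (h_(λ_i - i + j)(x_1, …, x_(q_i))): π_q moves a part from q to q + 1 because it maps h_d(x_1, …, x_q) to
-- h_d(x_1, …, x_(q+1)) and is linear over the other rows, and since x_q - x_(q+1) is not a zero divisor the
-- recursion determines the character.  Expanding along the last row gives the leading monomial.  For γ(S)* the
-- entries are h_(k - q_i + j), and Σ_l (-1)^l e_l(x_1, …, x_n) h_(d-l)(x_1, …, x_q) = 0 for d > n - q writes the
-- last column as a combination of the others modulo e_(n-k+1), …, e_n, so the determinant lies in J.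
--
-- Gröbner basis.  A monomial divisible by no leading monomial of G divides a shuffle x^a of (k-1, …, 1, 0) with
-- n - k letters k - 1.  For each such a there is a linear functional that kills J, takes the value 1 at x^a and
-- vanishes at all smaller monomials; hence no element of J has a leading monomial dividing x^a.  If the letters
-- k - 1 come last, the functional is f ↦ [x^(a+δ)] f · Π_{i<j} (x_j - x_i) with δ = (0, 1, …, n - 1).  Since J is
-- stable under the π_j, composing with π_j moves a letter k - 1 one step to the left.

module Submission where

open import Defs
open import Data.Nat using (ℕ; _≤_; _<_)
open import Data.Product using (_×_)
open import Level using (Level; _⊔_)
open import Algebra.Bundles using (CommutativeRing; RawRing)
open import Algebra.Solver.Ring.AlmostCommutativeRing using (fromCommutativeRing; _-Raw-AlmostCommutative⟶_)
open import Data.Nat as ℕ using (zero; suc; z≤n; s≤s)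
import Data.Nat.Properties as ℕ
open import Data.Maybe using (Maybe; just; nothing)
open import Data.Product using (Σ; _,_; proj₁; proj₂; ∃)
open import Data.Sum using (_⊎_; inj₁; inj₂)
open import Data.Empty using (⊥; ⊥-elim)
open import Data.Bool using (Bool; true; false; if_then_else_; _∧_)
open import Relation.Nullary using (¬_; yes; no; does; Dec)
open import Relation.Binary.PropositionalEquality as ≡ using (_≡_; _≢_; cong; cong₂; subst; subst₂)
open import Data.Vec as Vec using (Vec; []; _∷_; lookup)
open import Data.Vec.Properties using (≡-dec)
open import Data.List as List using (List; []; _∷_; _++_; length)
import Data.List.Properties as List
open import Data.Fin as Fin using (Fin; zero; suc; toℕ)
open import Relation.Nullary.Decidable using (dec-true; dec-false)
open import Induction.WellFounded using (Acc; acc; WellFounded)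
open import Data.Nat.Induction using (<-wellFounded)
open import Relation.Binary.Definitions using (tri<; tri≈; tri>)
open import Data.List.Relation.Unary.All as All using (All; []; _∷_)
import Data.List.Relation.Unary.All.Properties as All
import Data.Bool.Properties as Bool
open import Data.List.Relation.Unary.Linked as Linked using (Linked; []; [-]; _∷_)
open import Data.List.Relation.Binary.Pointwise as Pointwise using (Pointwise; []; _∷_)
import Data.Fin.Properties as Fin
open import Data.Fin.Subset using (Subset; inside; outside; ∣_∣; _∈_)
import Data.Vec.Properties as Vec
open import Data.Vec.Base using (here; there)
open import Data.Fin.Subset.Properties using (∣p∣≤n)
open import Function.Bundles using (mk⇔)

-- The field offers no zero test, so remainders cannot be computed; leading monomials of J are
-- bounded by functionals instead.
--
-- With variables counted from 0, the coefficient at x^(a+δ) only sees polynomials modulo the powers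
-- x_j^(a_j+j+1). Suppose h_s(x_0, ..., x_(j-1)) is already annihilated for all s > i. Then
-- multiplying h_i(x_0, ..., x_j) by Π_{l<j} (x_j - x_l) gives x_j^(i+j), which is 0 modulo these
-- powers as soon as i > a_j. This induction on j passes from j to j + 1 only if a_j ≤ a_(j+1) + 1,
-- a condition that most shuffles violate; it holds when the letters k - 1 come last. The letter 0
-- at position k - 1 accounts for the e_d: it annihilates every h_s(x_0, ..., x_(k-1)) with s > 0,
-- hence every e_d of these k variables with d > 0.
--
-- Composition with π_j keeps the vanishing on J but may destroy the vanishing at a smaller x^b with
-- b_j ≥ k, because π_j can send it above the new top. Such an x^b is first rewritten by h_k(x_0,
-- ..., x_j), which forces a well-founded induction on b.

-- Commutative rings and formal power series

module RingTools {c ℓ : Level} (R : CommutativeRing c ℓ) where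
  open CommutativeRing R
  open import Algebra.Properties.Ring ring using (-‿distribˡ-*; -‿distribʳ-*; -0#≈0#)
  open import Algebra.Properties.AbelianGroup +-abelianGroup using (⁻¹-∙-comm; ⁻¹-involutive)
  open import Algebra.Properties.Semiring.Mult semiring using (×-homo-+; ×1-homo-*; ×-homo-1) renaming (_×_ to _·_)
  open import Relation.Binary.Reasoning.Setoid setoid
  import Algebra.Solver.CommutativeMonoid +-commutativeMonoid as CM

  difference : ℕ × ℕ → Carrier
  difference (a , b) = a · 1# - b · 1#

  rearrange : ∀ a b c d → (a + b) + (c + d) ≈ (a + c) + (b + d)
  rearrange = CM.solve 4 (λ a b c d → (a CM.⊕ b) CM.⊕ (c CM.⊕ d) CM.⊜ (a CM.⊕ c) CM.⊕ (b CM.⊕ d)) refl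

  difference-+ : ∀ a b c d → difference (a ℕ.+ c , b ℕ.+ d) ≈ difference (a , b) + difference (c , d)
  difference-+ a b c d = begin
    (a ℕ.+ c) · 1# - (b ℕ.+ d) · 1#
      ≈⟨ +-cong (×-homo-+ 1# a c) (-‿cong (×-homo-+ 1# b d)) ⟩
    (a · 1# + c · 1#) - (b · 1# + d · 1#)
      ≈⟨ +-congˡ (⁻¹-∙-comm _ _) ⟨
    (a · 1# + c · 1#) + (- (b · 1#) - (d · 1#))
      ≈⟨ rearrange _ _ _ _ ⟩
    difference (a , b) + difference (c , d) ∎

  difference-* : ∀ a b c d →
    difference (a ℕ.* c ℕ.+ b ℕ.* d , a ℕ.* d ℕ.+ b ℕ.* c) ≈ difference (a , b) * difference (c , d)
  difference-* a b c d = begin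
    difference (a ℕ.* c ℕ.+ b ℕ.* d , a ℕ.* d ℕ.+ b ℕ.* c)
      ≈⟨ +-cong (homo a c b d) (-‿cong (homo a d b c)) ⟩
    (A * C + B * D) - (A * D + B * C)
      ≈⟨ +-congˡ (⁻¹-∙-comm _ _) ⟨
    (A * C + B * D) + (- (A * D) - (B * C))
      ≈⟨ +-congˡ (+-comm _ _) ⟩
    (A * C + B * D) + (- (B * C) - (A * D))
      ≈⟨ rearrange _ _ _ _ ⟩
    (A * C - B * C) + (B * D - A * D)
      ≈⟨ +-cong (+-congˡ (-‿distribˡ-* _ _)) (trans (+-comm _ _) (+-cong (-‿distribʳ-* _ _) negneg)) ⟩
    (A * C + (- B) * C) + (A * (- D) + (- B) * (- D))
      ≈⟨ +-cong (distribʳ _ _ _) (distribʳ _ _ _) ⟨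
    (A - B) * C + (A - B) * (- D)
      ≈⟨ distribˡ _ _ _ ⟨
    (A - B) * (C - D) ∎
    where
    A = a · 1#
    B = b · 1#
    C = c · 1#
    D = d · 1#
    homo : ∀ a c b d → (a ℕ.* c ℕ.+ b ℕ.* d) · 1# ≈ (a · 1#) * (c · 1#) + (b · 1#) * (d · 1#)
    homo a c b d = trans (×-homo-+ 1# (a ℕ.* c) (b ℕ.* d)) (+-cong (×1-homo-* a c) (×1-homo-* b d))
    negneg : B * D ≈ (- B) * (- D)
    negneg = trans (sym (⁻¹-involutive _)) (trans (-‿cong (-‿distribˡ-* _ _)) (-‿distribʳ-* _ _))

  -- The ring has no decidable equality, so the solver takes formal differences of natural numbers
  -- as coefficients; `difference-≟` compares them by cross-addition. The coefficient 1 evaluates to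
  -- `difference (1 , 0)` and not to `1#` on the nose, which is why that expression appears in later
  -- identities.
  integers : RawRing _ _
  integers = record
    { Carrier = ℕ × ℕ
    ; _≈_ = _≡_
    ; _+_ = λ { (a , b) (c , d) → a ℕ.+ c , b ℕ.+ d }
    ; _*_ = λ { (a , b) (c , d) → a ℕ.* c ℕ.+ b ℕ.* d , a ℕ.* d ℕ.+ b ℕ.* c }
    ; -_ = λ { (a , b) → b , a }
    ; 0# = 0 , 0
    ; 1# = 1 , 0
    }

  difference-morphism : integers -Raw-AlmostCommutative⟶ fromCommutativeRing R
  difference-morphism = record
    { ⟦_⟧ = difference
    ; +-homo = λ { (a , b) (c , d) → difference-+ a b c d }
    ; *-homo = λ { (a , b) (c , d) → difference-* a b c d }
    ; -‿homo = λ { (a , b) → trans (+-comm _ _) (trans (+-congˡ (sym (⁻¹-involutive _))) (⁻¹-∙-comm _ _)) }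
    ; 0-homo = -‿inverseʳ 0#
    ; 1-homo = trans (+-congˡ -0#≈0#) (trans (+-identityʳ _) (×-homo-1 1#))
    }

  difference-≟ : ∀ x y → Maybe (difference x ≈ difference y)
  difference-≟ (a , b) (c , d) with a ℕ.+ d ℕ.≟ c ℕ.+ b
  ... | no _ = nothing
  ... | yes p = just (begin
    A - B ≈⟨ +-identityʳ _ ⟨
    (A - B) + 0# ≈⟨ +-congˡ (-‿inverseʳ D) ⟨
    (A - B) + (D - D) ≈⟨ rearrange _ _ _ _ ⟩
    (A + D) + (- B - D) ≈⟨ +-congʳ (×-homo-+ 1# a d) ⟨
    (a ℕ.+ d) · 1# + (- B - D) ≡⟨ cong (λ z → z · 1# + (- B - D)) p ⟩
    (c ℕ.+ b) · 1# + (- B - D) ≈⟨ +-congʳ (×-homo-+ 1# c b) ⟩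
    (C + B) + (- B - D) ≈⟨ +-congˡ (+-comm _ _) ⟩
    (C + B) + (- D - B) ≈⟨ rearrange _ _ _ _ ⟩
    (C - D) + (B - B) ≈⟨ +-congˡ (-‿inverseʳ B) ⟩
    (C - D) + 0# ≈⟨ +-identityʳ _ ⟩
    C - D ∎)
    where
    A = a · 1#
    B = b · 1#
    C = c · 1#
    D = d · 1#

  open import Algebra.Solver.Ring integers (fromCommutativeRing R) difference-morphism difference-≟
    using (solve; _:=_; _:+_; _:*_; _:-_; :-_; con) public

  neg-zero : ∀ {a} → a ≈ 0# → - a ≈ 0#
  neg-zero p = trans (-‿cong p) -0#≈0#

  +-zero : ∀ {a b} → a ≈ 0# → b ≈ 0# → a + b ≈ 0#
  +-zero p q = trans (+-cong p q) (+-identityˡ 0#)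

  *-zeroL : ∀ {a} b → a ≈ 0# → a * b ≈ 0#
  *-zeroL b p = trans (*-congʳ p) (zeroˡ b)

  *-zeroR : ∀ a {b} → b ≈ 0# → a * b ≈ 0#
  *-zeroR a p = trans (*-congˡ p) (zeroʳ a)

  sub-zero : ∀ {a b} → a - b ≈ 0# → a ≈ b
  sub-zero {a} {b} p = trans (solve 2 (λ a b → a := (a :- b) :+ b) refl a b) (trans (+-congʳ p) (+-identityˡ b))

  zero-sub : ∀ {a b} → a ≈ b → a - b ≈ 0#
  zero-sub p = trans (+-congʳ p) (-‿inverseʳ _)

  gap-one : ∀ x y a b → a ≈ b → (x - y) * a ≈ x * a + (- y) * b
  gap-one x y a b p = trans (solve 3 (λ x y a → (x :- y) :* a := x :* a :+ (:- y) :* a) refl x y a) (+-congˡ (*-congˡ p))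

  -- In a Demazure step `a` is h_d of an alphabet ending in x, `a + y * b` is h_d with y adjoined,
  -- and `a'` is `a` with x and y exchanged. The hypothesis is the symmetry of the larger polynomial
  -- in x and y.
  gap-step : ∀ x y a b a' → a + y * b ≈ a' + x * b → (x - y) * (a + y * b) ≈ x * a + (- y) * a'
  gap-step x y a b a' p = trans
    (solve 4 (λ x y a b → (x :- y) :* (a :+ y :* b) := x :* a :+ (:- y) :* ((a :+ y :* b) :- x :* b)) refl x y a b)
    (+-congˡ (*-congˡ (trans (+-congʳ p) (solve 2 (λ a b → (a :+ b) :- b := a) refl a' (x * b)))))

module PowerSeries {c ℓ : Level} (R : CommutativeRing c ℓ) where
  open CommutativeRing R
  open RingTools R
  open import Relation.Binary.Reasoning.Setoid setoid

  Series : Set c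
  Series = ℕ → Carrier

  _≗_ : Series → Series → Set ℓ
  f ≗ g = ∀ x → f x ≈ g x

  -- Shifting the first factor avoids subtraction of indices; `conv-last` supplies the expansion
  -- from the other end.
  conv : Series → Series → Series
  conv f g zero = f 0 * g 0
  conv f g (suc x) = f 0 * g (suc x) + conv (λ i → f (suc i)) g x

  conv-cong : ∀ {f f' g g'} → f ≗ f' → g ≗ g' → conv f g ≗ conv f' g'
  conv-cong p q zero = *-cong (p 0) (q 0)
  conv-cong p q (suc x) = +-cong (*-cong (p 0) (q (suc x))) (conv-cong (λ i → p (suc i)) q x)

  conv-distribʳ : ∀ h f g → conv (λ i → f i + g i) h ≗ (λ x → conv f h x + conv g h x)
  conv-distribʳ h f g zero = distribʳ _ _ _
  conv-distribʳ h f g (suc x) = trans (+-cong (distribʳ _ _ _) (conv-distribʳ h _ _ x)) (rearrange _ _ _ _)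

  conv-scale : ∀ a f g → conv (λ i → a * f i) g ≗ (λ x → a * conv f g x)
  conv-scale a f g zero = *-assoc _ _ _
  conv-scale a f g (suc x) = trans (+-cong (*-assoc _ _ _) (conv-scale a _ g x)) (sym (distribˡ _ _ _))

  conv-zero : ∀ f g x → (∀ i → f i ≈ 0#) → conv f g x ≈ 0#
  conv-zero f g zero p = *-zeroL _ (p 0)
  conv-zero f g (suc x) p = +-zero (*-zeroL _ (p 0)) (conv-zero _ g x (λ i → p (suc i)))

  conv-last : ∀ f g x → conv f g (suc x) ≈ conv f (λ i → g (suc i)) x + f (suc x) * g 0
  conv-last f g zero = refl
  conv-last f g (suc x) = trans (+-congˡ (conv-last _ g x)) (sym (+-assoc _ _ _))

  conv-comm : ∀ f g → conv f g ≗ conv g f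
  conv-comm f g zero = *-comm _ _
  conv-comm f g (suc x) = begin
    f 0 * g (suc x) + conv (λ i → f (suc i)) g x ≈⟨ +-cong (*-comm _ _) (conv-comm _ g x) ⟩
    g (suc x) * f 0 + conv g (λ i → f (suc i)) x ≈⟨ +-comm _ _ ⟩
    conv g (λ i → f (suc i)) x + g (suc x) * f 0 ≈⟨ conv-last g f x ⟨
    conv g f (suc x) ∎

  conv-assoc : ∀ f g h → conv (conv f g) h ≗ conv f (conv g h)
  conv-assoc f g h zero = *-assoc _ _ _
  conv-assoc f g h (suc x) = begin
    (f 0 * g 0) * h (suc x) + conv (λ i → f 0 * g (suc i) + conv f⁺ g i) h x
      ≈⟨ +-congˡ (trans (conv-distribʳ h _ _ x) (+-cong (conv-scale (f 0) _ h x) (conv-assoc f⁺ g h x))) ⟩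
    (f 0 * g 0) * h (suc x) + (f 0 * conv (λ i → g (suc i)) h x + conv f⁺ (conv g h) x)
      ≈⟨ solve 5 (λ a b c d e → (a :* b) :* c :+ (a :* d :+ e) := a :* (b :* c :+ d) :+ e) refl _ _ _ _ _ ⟩
    f 0 * (g 0 * h (suc x) + conv (λ i → g (suc i)) h x) + conv f⁺ (conv g h) x ∎
    where
    f⁺ : Series
    f⁺ i = f (suc i)

  unit : Series
  unit zero = 1#
  unit (suc _) = 0#

  conv-unitˡ : ∀ f → conv unit f ≗ f
  conv-unitˡ f zero = *-identityˡ _
  conv-unitˡ f (suc x) = trans (+-cong (*-identityˡ _) (conv-zero _ f x (λ _ → refl))) (+-identityʳ _)

-- The ring of polynomials

infixl 6 _⊕_
_⊕_ : ∀ {n} → Mono n → Mono n → Mono n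
_⊕_ = Vec.zipWith ℕ._+_

module PolynomialRing {c ℓ : Level} (F : Field c ℓ) where
  open Field F
  open RingTools commutativeRing public

  infix 4 _≈ₚ_
  _≈ₚ_ : ∀ {n} → Poly F n → Poly F n → Set ℓ
  f ≈ₚ g = ∀ m → f m ≈ g m

  slice : ∀ {n} → Poly F (suc n) → ℕ → Poly F n
  slice f i m = f (i ∷ m)

  one : ∀ n → Poly F n
  one zero [] = 1#
  one (suc n) (zero ∷ m) = one n m
  one (suc n) (suc _ ∷ m) = 0#

  -- A polynomial in n + 1 variables is treated as a power series in the first variable.
  mul : ∀ n → Poly F n → Poly F n → Poly F n
  polyRing : ℕ → CommutativeRing c ℓ
  mul-cong : ∀ n {f f' g g'} → f ≈ₚ f' → g ≈ₚ g' → mul n f g ≈ₚ mul n f' g'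
  mul-comm : ∀ n f g → mul n f g ≈ₚ mul n g f
  mul-assoc : ∀ n f g h → mul n (mul n f g) h ≈ₚ mul n f (mul n g h)
  mul-oneˡ : ∀ n f → mul n (one n) f ≈ₚ f
  mul-distribʳ : ∀ n h f g → mul n (λ m → f m + g m) h ≈ₚ (λ m → mul n f h m + mul n g h m)

  polyRing n = record
    { Carrier = Poly F n
    ; _≈_ = _≈ₚ_
    ; _+_ = λ f g m → f m + g m
    ; _*_ = mul n
    ; -_ = λ f m → - f m
    ; 0# = λ _ → 0#
    ; 1# = one n
    ; isCommutativeRing = record
      { isRing = record
        { +-isAbelianGroup = record
          { isGroup = record
            { isMonoid = record
              { isSemigroup = record
                { isMagma = record
                  { isEquivalence = record
                    { refl = λ _ → refl
                    ; sym = λ p m → sym (p m)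
                    ; trans = λ p q m → trans (p m) (q m) }
                  ; ∙-cong = λ p q m → +-cong (p m) (q m) }
                ; assoc = λ f g h m → +-assoc _ _ _ }
              ; identity = (λ f m → +-identityˡ _) , (λ f m → +-identityʳ _) }
            ; inverse = (λ f m → -‿inverseˡ _) , (λ f m → -‿inverseʳ _)
            ; ⁻¹-cong = λ p m → -‿cong (p m) }
          ; comm = λ f g m → +-comm _ _ }
        ; *-cong = mul-cong n
        ; *-assoc = mul-assoc n
        ; *-identity = mul-oneˡ n , (λ f m → trans (mul-comm n f (one n) m) (mul-oneˡ n f m))
        ; distrib = (λ h f g m → trans (mul-comm n h _ m) (trans (mul-distribʳ n h f g m)
                                   (+-cong (mul-comm n f h m) (mul-comm n g h m))))
                  , mul-distribʳ n }
      ; *-comm = mul-comm n } }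

  mul zero f g [] = f [] * g []
  mul (suc n) f g (x ∷ m) = PowerSeries.conv (polyRing n) (slice f) (slice g) x m

  mul-cong zero p q [] = *-cong (p []) (q [])
  mul-cong (suc n) p q (x ∷ m) =
    PowerSeries.conv-cong (polyRing n) (λ i m → p (i ∷ m)) (λ i m → q (i ∷ m)) x m

  mul-comm zero f g [] = *-comm _ _
  mul-comm (suc n) f g (x ∷ m) = PowerSeries.conv-comm (polyRing n) (slice f) (slice g) x m

  mul-assoc zero f g h [] = *-assoc _ _ _
  mul-assoc (suc n) f g h (x ∷ m) = PowerSeries.conv-assoc (polyRing n) (slice f) (slice g) (slice h) x m

  mul-oneˡ zero f [] = *-identityˡ _
  mul-oneˡ (suc n) f (x ∷ m) =
    trans (PowerSeries.conv-cong (polyRing n) {g = slice f} slice-one (λ i m → refl) x m)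
          (PowerSeries.conv-unitˡ (polyRing n) (slice f) x m)
    where
    slice-one : ∀ i → slice (one (suc n)) i ≈ₚ PowerSeries.unit (polyRing n) i
    slice-one zero m = refl
    slice-one (suc i) m = refl

  mul-distribʳ zero h f g [] = distribʳ _ _ _
  mul-distribʳ (suc n) h f g (x ∷ m) =
    PowerSeries.conv-distribʳ (polyRing n) (slice h) (slice f) (slice g) x m

  module _ {n : ℕ} where
    open PowerSeries (polyRing n) using (conv)

    conv-vanish : ∀ (F G : ℕ → Poly F n) x m →
      (∀ i j → i ℕ.+ j ≡ x → mul n (F i) (G j) m ≈ 0#) → conv F G x m ≈ 0#
    conv-vanish F G zero m p = p 0 0 ≡.refl
    conv-vanish F G (suc x) m p =
      +-zero (p 0 (suc x) ≡.refl) (conv-vanish _ G x m (λ i j q → p (suc i) j (cong suc q)))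

    conv-single : ∀ (F G : ℕ → Poly F n) i₀ j₀ m →
      (∀ i j → i ℕ.+ j ≡ i₀ ℕ.+ j₀ → i ≢ i₀ → mul n (F i) (G j) m ≈ 0#) →
      conv F G (i₀ ℕ.+ j₀) m ≈ mul n (F i₀) (G j₀) m
    conv-single F G zero zero m p = refl
    conv-single F G zero (suc j) m p =
      trans (+-congˡ (conv-vanish _ G j m (λ i j q → p (suc i) j (cong suc q) (λ ())))) (+-identityʳ _)
    conv-single F G (suc i) j m p =
      trans (+-cong (p 0 (suc (i ℕ.+ j)) ≡.refl (λ ()))
                    (conv-single (λ i → F (suc i)) G i j m
                      (λ i' j' q r → p (suc i') j' (cong suc q) (λ s → r (ℕ.suc-injective s)))))
            (+-identityˡ _)

  mul-vanish : ∀ n f g m → (∀ u v → u ⊕ v ≡ m → f u * g v ≈ 0#) → mul n f g m ≈ 0#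
  mul-vanish zero f g [] p = p [] [] ≡.refl
  mul-vanish (suc n) f g (x ∷ m) p = conv-vanish (slice f) (slice g) x m λ i j q →
    mul-vanish n (slice f i) (slice g j) m (λ u v r → p (i ∷ u) (j ∷ v) (cong₂ _∷_ q r))

  mul-single : ∀ n f g a b → (∀ u v → u ⊕ v ≡ a ⊕ b → u ≢ a → f u * g v ≈ 0#) →
    mul n f g (a ⊕ b) ≈ f a * g b
  mul-single zero f g [] [] p = refl
  mul-single (suc n) f g (x ∷ a) (y ∷ b) p = trans
    (conv-single (slice f) (slice g) x y (a ⊕ b) λ i j q r →
      mul-vanish n (slice f i) (slice g j) (a ⊕ b) λ u v s →
        p (i ∷ u) (j ∷ v) (cong₂ _∷_ q s) (λ e → r (cong Vec.head e)))
    (mul-single n (slice f x) (slice g y) a b λ u v s t →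
      p (x ∷ u) (y ∷ v) (cong (x ℕ.+ y ∷_) s) (λ e → t (cong Vec.tail e)))

  module _ {a : Level} {A : Set a} where
    sumOf : (A → Carrier) → List A → Carrier
    sumOf φ xs = List.foldr _+_ 0# (List.map φ xs)

    sumOf-++ : ∀ φ xs ys → sumOf φ (xs ++ ys) ≈ sumOf φ xs + sumOf φ ys
    sumOf-++ φ [] ys = sym (+-identityˡ _)
    sumOf-++ φ (x ∷ xs) ys = trans (+-congˡ (sumOf-++ φ xs ys)) (sym (+-assoc _ _ _))

    sumOf-cong : ∀ {φ ψ} xs → (∀ x → φ x ≈ ψ x) → sumOf φ xs ≈ sumOf ψ xs
    sumOf-cong [] p = refl
    sumOf-cong (x ∷ xs) p = +-cong (p x) (sumOf-cong xs p)

  sumOf-concatMap : ∀ {a b} {A : Set a} {B : Set b} (φ : B → Carrier) (h : A → List B) xs →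
    sumOf φ (List.concatMap h xs) ≈ sumOf (λ x → sumOf φ (h x)) xs
  sumOf-concatMap φ h [] = refl
  sumOf-concatMap φ h (x ∷ xs) = trans (sumOf-++ φ (h x) _) (+-congˡ (sumOf-concatMap φ h xs))

  sumOf-map : ∀ {a b} {A : Set a} {B : Set b} (φ : B → Carrier) (h : A → B) xs →
    sumOf φ (List.map h xs) ≈ sumOf (λ x → φ (h x)) xs
  sumOf-map φ h [] = refl
  sumOf-map φ h (x ∷ xs) = +-congˡ (sumOf-map φ h xs)

  -- The enumeration `ψ` is arbitrary because `upTo` is `applyUpTo` of the identity and each entry
  -- removed composes it with `suc`.
  sumOf-conv : ∀ {n} (F G : ℕ → Poly F n) m (φ : ℕ → Carrier) ψ x →
    (∀ i j → i ℕ.+ j ≡ x → φ (ψ i) ≈ mul n (F i) (G j) m) →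
    sumOf φ (List.applyUpTo ψ (suc x)) ≈ PowerSeries.conv (polyRing n) F G x m
  sumOf-conv F G m φ ψ zero p = trans (+-identityʳ _) (p 0 0 ≡.refl)
  sumOf-conv F G m φ ψ (suc x) p =
    +-cong (p 0 (suc x) ≡.refl)
           (sumOf-conv (λ i → F (suc i)) G m φ (λ i → ψ (suc i)) x (λ i j q → p (suc i) j (cong suc q)))

  *p≈mul : ∀ n f g → _*p_ F n f g ≈ₚ mul n f g
  *p≈mul zero f g [] = +-identityʳ _
  *p≈mul (suc n) f g (x ∷ m) = trans
    (sumOf-concatMap term step (List.upTo (suc x)))
    (sumOf-conv (slice f) (slice g) m _ (λ i → i) x λ i j q →
      trans (sumOf-map term (extend i) (splits m))
        (trans (sumOf-cong {ψ = λ { (u , v) → f (i ∷ u) * g (j ∷ v) }} (splits m)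
                 (λ { (u , v) → *-congˡ (reflexive (cong (λ z → g (z ∷ v)) (difference-≡ i j q))) }))
               (*p≈mul n (slice f i) (slice g j) m)))
    where
    term : Mono (suc n) × Mono (suc n) → Carrier
    term (u , v) = f u * g v
    extend : ℕ → Mono n × Mono n → Mono (suc n) × Mono (suc n)
    extend i (u , v) = i ∷ u , (x ℕ.∸ i) ∷ v
    step : ℕ → List (Mono (suc n) × Mono (suc n))
    step i = List.map (extend i) (splits m)
    difference-≡ : ∀ i j → i ℕ.+ j ≡ x → x ℕ.∸ i ≡ j
    difference-≡ i j ≡.refl = ℕ.m+n∸m≡n i j

  monomial-≡ : ∀ {n} {a b : Mono n} → a ≡ b → monomial F n a b ≈ 1#
  monomial-≡ {a = a} {b} p rewrite dec-true (≡-dec ℕ._≟_ a b) p = refl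

  monomial-≢ : ∀ {n} {a b : Mono n} → a ≢ b → monomial F n a b ≈ 0#
  monomial-≢ {a = a} {b} p rewrite dec-false (≡-dec ℕ._≟_ a b) p = refl

  monomial-⊕ : ∀ {n} (a b : Mono n) → mul n (monomial F n a) (monomial F n b) ≈ₚ monomial F n (a ⊕ b)
  monomial-⊕ {n} a b m with ≡-dec ℕ._≟_ (a ⊕ b) m
  ... | yes ≡.refl = trans (mul-single n _ _ a b (λ u v _ r → *-zeroL _ (monomial-≢ (λ e → r (≡.sym e)))))
                      (trans (*-cong (monomial-≡ {a = a} ≡.refl) (monomial-≡ {a = b} ≡.refl)) (*-identityˡ _))
  ... | no r = mul-vanish n _ _ m λ u v e → zero-factor u v e
    where
    zero-factor : ∀ u v → u ⊕ v ≡ m → monomial F n a u * monomial F n b v ≈ 0#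
    zero-factor u v e with ≡-dec ℕ._≟_ a u | ≡-dec ℕ._≟_ b v
    ... | no _ | _ = zeroˡ _
    ... | yes _ | no _ = zeroʳ _
    ... | yes ≡.refl | yes ≡.refl = ⊥-elim (r e)

  -- Multiplication by x_j, read off on coefficients. For j ≥ n it is 0, so that variables can be
  -- indexed by natural numbers.
  shift : ∀ n → ℕ → Poly F n → Poly F n
  shift zero j f m = 0#
  shift (suc n) zero f (zero ∷ m) = 0#
  shift (suc n) zero f (suc x ∷ m) = f (x ∷ m)
  shift (suc n) (suc j) f (x ∷ m) = shift n j (slice f x) m

  variable′ : ∀ n → ℕ → Poly F n
  variable′ n j = shift n j (one n)

  shift-cong : ∀ n j {f g} → f ≈ₚ g → shift n j f ≈ₚ shift n j g
  shift-cong zero j p m = refl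
  shift-cong (suc n) zero p (zero ∷ m) = refl
  shift-cong (suc n) zero p (suc x ∷ m) = p (x ∷ m)
  shift-cong (suc n) (suc j) p (x ∷ m) = shift-cong n j (λ m → p (x ∷ m)) m

  shift-+ : ∀ n j f g → shift n j (λ m → f m + g m) ≈ₚ (λ m → shift n j f m + shift n j g m)
  shift-+ zero j f g m = sym (+-identityʳ _)
  shift-+ (suc n) zero f g (zero ∷ m) = sym (+-identityʳ _)
  shift-+ (suc n) zero f g (suc x ∷ m) = refl
  shift-+ (suc n) (suc j) f g (x ∷ m) = shift-+ n j (slice f x) (slice g x) m

  mul-shift : ∀ n j f g → mul n (shift n j f) g ≈ₚ shift n j (mul n f g)
  mul-shift zero j f g [] = zeroˡ _
  mul-shift (suc n) zero f g (zero ∷ m) = CommutativeRing.zeroˡ (polyRing n) (slice g 0) m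
  mul-shift (suc n) zero f g (suc x ∷ m) =
    trans (+-congʳ (CommutativeRing.zeroˡ (polyRing n) (slice g (suc x)) m)) (+-identityˡ _)
  mul-shift (suc n) (suc j) f g (x ∷ m) = conv-shift (slice f) (slice g) x m
    where
    open PowerSeries (polyRing n) using (conv)
    conv-shift : ∀ (f g : ℕ → Poly F n) x → conv (λ i → shift n j (f i)) g x ≈ₚ shift n j (conv f g x)
    conv-shift f g zero m = mul-shift n j (f 0) (g 0) m
    conv-shift f g (suc x) m =
      trans (+-cong (mul-shift n j (f 0) (g (suc x)) m) (conv-shift (λ i → f (suc i)) g x m))
            (sym (shift-+ n j (mul n (f 0) (g (suc x))) (conv (λ i → f (suc i)) g x) m))

  mul-variable : ∀ n j f → mul n (variable′ n j) f ≈ₚ shift n j f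
  mul-variable n j f m = trans (mul-shift n j (one n) f m) (shift-cong n j (mul-oneˡ n f) m)

  mul-scale : ∀ n r f g → mul n (λ m → r * f m) g ≈ₚ (λ m → r * mul n f g m)
  mul-scale zero r f g [] = *-assoc _ _ _
  mul-scale (suc n) r f g (x ∷ m) = go (slice f) (slice g) x
    where
    open PowerSeries (polyRing n) using (conv)
    go : ∀ f g x → conv (λ i m → r * f i m) g x m ≈ r * conv f g x m
    go f g zero = mul-scale n r (f 0) (g 0) m
    go f g (suc x) = trans (+-cong (mul-scale n r (f 0) (g (suc x)) m) (go (λ i → f (suc i)) g x)) (sym (distribˡ r _ _))

-- Symmetric functions

-- The instances are J, the zero ideal, where membership of a difference is an equation, and colon
-- ideals of monomial ideals; congruences stated for an arbitrary ideal serve several of them.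
record IsIdeal {c ℓ p : Level} (R : CommutativeRing c ℓ) (I : CommutativeRing.Carrier R → Set p) : Set (c ⊔ ℓ ⊔ p) where
  open CommutativeRing R
  field
    I-cong : ∀ {a b} → a ≈ b → I a → I b
    I-zero : I 0#
    I-+ : ∀ {a b} → I a → I b → I (a + b)
    I-* : ∀ a {b} → I b → I (a * b)

  open RingTools R
  open PowerSeries R using (conv; conv-last)

  I-*ʳ : ∀ {a} b → I a → I (a * b)
  I-*ʳ b p = I-cong (*-comm _ _) (I-* b p)

  I-neg : ∀ {a} → I a → I (- a)
  I-neg {a} p = I-cong (solve 1 (λ a → (:- con (1 , 0)) :* a := :- a) refl a) (I-* (- difference (1 , 0)) p)

  I-sub : ∀ {a b} → I a → I b → I (a - b)
  I-sub p q = I-+ p (I-neg q)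

  I-≈0 : ∀ {a} → a ≈ 0# → I a
  I-≈0 p = I-cong (sym p) I-zero

  I-trans : ∀ {a b d} → I (a - b) → I (b - d) → I (a - d)
  I-trans {a} {b} {d} p q = I-cong (solve 3 (λ a b d → (a :- b) :+ (b :- d) := a :- d) refl a b d) (I-+ p q)

  I-from : ∀ {a b} → I (a - b) → I b → I a
  I-from {a} {b} p q = I-cong (solve 2 (λ a b → (a :- b) :+ b := a) refl a b) (I-+ p q)

  I-conv : ∀ f g x → (∀ i → I (g i)) → I (conv f g x)
  I-conv f g zero p = I-* _ (p 0)
  I-conv f g (suc x) p = I-+ (I-* _ (p (suc x))) (I-conv _ g x p)

  -- Truncating a Cauchy product to the low coefficients of f only discards terms whose f-coefficient lies in I.
  I-conv-truncate : ∀ f n → (∀ l → n < l → I (f l)) → ∀ s g →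
    I (conv f g (s ℕ.+ n) - conv f (λ i → g (s ℕ.+ i)) n)
  I-conv-truncate f n p zero g = I-≈0 (-‿inverseʳ _)
  I-conv-truncate f n p (suc s) g = I-trans
    (I-cong (trans (solve 2 (λ a b → b := (a :+ b) :- a) refl _ _) (+-congʳ (sym (conv-last f g (s ℕ.+ n)))))
            (I-*ʳ (g 0) (p (suc (s ℕ.+ n)) (s≤s (ℕ.m≤n+m n s)))))
    (I-conv-truncate f n p s (λ i → g (suc i)))

module ColonIdeal {c ℓ p : Level} (R : CommutativeRing c ℓ) {V : CommutativeRing.Carrier R → Set p} (isIdeal : IsIdeal R V) where
  open CommutativeRing R
  open RingTools R
  open IsIdeal isIdeal

  colon : ∀ d → IsIdeal R (λ g → V (g * d))
  colon d = record
    { I-cong = λ p → I-cong (*-congʳ p)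
    ; I-zero = I-≈0 (zeroˡ d)
    ; I-+ = λ p q → I-cong (sym (distribʳ d _ _)) (I-+ p q)
    ; I-* = λ a p → I-cong (sym (*-assoc a _ d)) (I-* a p) }

  colon-enlarge : ∀ g d f → V (g * d) → V (g * (d * f))
  colon-enlarge g d f p = I-cong (*-assoc g d f) (I-*ʳ f p)

  -- A statement about `f * g` with multiplier `d` becomes one about `g` with multiplier `d * f`. In
  -- this way the Vandermonde factors are accumulated one at a time.
  colon-transfer : ∀ f g d → V ((f * g) * d) → V (g * (d * f))
  colon-transfer f g d = I-cong (solve 3 (λ f g d → (f :* g) :* d := g :* (d :* f)) refl f g d)

module SymmetricFunctions {c ℓ : Level} (R : CommutativeRing c ℓ) (x : ℕ → CommutativeRing.Carrier R) where
  open CommutativeRing R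
  open RingTools R
  open PowerSeries R
  open import Relation.Binary.Reasoning.Setoid setoid

  pow : Carrier → ℕ → Carrier
  pow a zero = 1#
  pow a (suc d) = a * pow a d

  -- H d j and E d j are h_d and e_d of x 0, …, x (j - 1); N d j is (-1)^d E d j.
  H : ℕ → ℕ → Carrier
  H zero j = 1#
  H (suc d) zero = 0#
  H (suc d) (suc j) = H (suc d) j + x j * H d (suc j)

  E : ℕ → ℕ → Carrier
  E zero j = 1#
  E (suc d) zero = 0#
  E (suc d) (suc j) = E (suc d) j + x j * E d j

  N : ℕ → ℕ → Carrier
  N zero j = 1#
  N (suc d) zero = 0#
  N (suc d) (suc j) = N (suc d) j - x j * N d j

  sign : ℕ → Carrier → Carrier
  sign zero a = a
  sign (suc d) a = - sign d a

  sign-0 : ∀ d → sign d 0# ≈ 0#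
  sign-0 zero = refl
  sign-0 (suc d) = neg-zero (sign-0 d)

  sign-+ : ∀ d a b → sign d (a + b) ≈ sign d a + sign d b
  sign-+ zero a b = refl
  sign-+ (suc d) a b = trans (-‿cong (sign-+ d a b)) (solve 2 (λ a b → :- (a :+ b) := (:- a) :+ (:- b)) refl _ _)

  sign-* : ∀ d a b → sign d (a * b) ≈ a * sign d b
  sign-* zero a b = refl
  sign-* (suc d) a b = trans (-‿cong (sign-* d a b)) (solve 2 (λ a b → :- (a :* b) := a :* (:- b)) refl _ _)

  N-sign : ∀ d j → N d j ≈ sign d (E d j)
  N-sign zero j = refl
  N-sign (suc d) zero = sym (neg-zero (sign-0 d))
  N-sign (suc d) (suc j) = begin
    N (suc d) j - x j * N d j ≈⟨ +-cong (N-sign (suc d) j) (-‿cong (trans (*-congˡ (N-sign d j)) (sym (sign-* d _ _)))) ⟩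
    sign (suc d) (E (suc d) j) + sign (suc d) (x j * E d j) ≈⟨ sign-+ (suc d) _ _ ⟨
    sign (suc d) (E (suc d) j + x j * E d j) ∎

  N-vanish : ∀ j d → j < d → N d j ≈ 0#
  N-vanish zero (suc d) p = refl
  N-vanish (suc j) (suc d) (s≤s p) =
    +-zero (N-vanish j (suc d) (ℕ.m≤n⇒m≤1+n p)) (neg-zero (*-zeroR _ (N-vanish j d p)))

  -- h_d of the alphabet {x 0, …, x (p - 1)} minus {x 0, …, x (n - 1)}.
  S : ℕ → ℕ → ℕ → Carrier
  S p n = conv (λ l → N l n) (λ i → H i p)

  S-sucʳ : ∀ p n d → S p (suc n) (suc d) ≈ S p n (suc d) - x n * S p n d
  S-sucʳ p n d = begin
    1# * H (suc d) p + conv (λ l → N (suc l) n - x n * N l n) (λ i → H i p) d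
      ≈⟨ +-congˡ (trans (conv-cong {g = λ i → H i p} (λ l → +-congˡ (-‿distribˡ-* _ _)) (λ _ → refl) d)
           (trans (conv-distribʳ _ _ _ d) (+-congˡ (conv-scale (- x n) _ _ d)))) ⟩
    1# * H (suc d) p + (conv (λ l → N (suc l) n) (λ i → H i p) d + (- x n) * S p n d)
      ≈⟨ solve 4 (λ a b x s → a :+ (b :+ (:- x) :* s) := (a :+ b) :- x :* s) refl _ _ _ _ ⟩
    S p n (suc d) - x n * S p n d ∎
    where open import Algebra.Properties.Ring ring using (-‿distribˡ-*)

  S-sucˡ : ∀ p n d → S (suc p) n (suc d) ≈ S p n (suc d) + x p * S (suc p) n d
  S-sucˡ p n d = begin
    conv Nn (λ i → H i (suc p)) (suc d)
      ≈⟨ trans (conv-last Nn _ d) (+-congʳ (conv-comm Nn _ d)) ⟩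
    conv (λ i → H (suc i) p + x p * H i (suc p)) Nn d + Nn (suc d) * 1#
      ≈⟨ +-congʳ (trans (conv-distribʳ Nn _ _ d) (+-cong (conv-comm _ Nn d)
           (trans (conv-scale (x p) _ Nn d) (*-congˡ (conv-comm _ Nn d))))) ⟩
    (conv Nn (λ i → H (suc i) p) d + x p * S (suc p) n d) + Nn (suc d) * 1#
      ≈⟨ solve 3 (λ a b c → (a :+ b) :+ c := (a :+ c) :+ b) refl _ _ _ ⟩
    (conv Nn (λ i → H (suc i) p) d + Nn (suc d) * 1#) + x p * S (suc p) n d
      ≈⟨ +-congʳ (conv-last Nn (λ i → H i p) d) ⟨
    S p n (suc d) + x p * S (suc p) n d ∎
    where
    Nn : Series
    Nn l = N l n

  S-diagonal : ∀ n d → S n n (suc d) ≈ 0#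
  S-diagonal zero d = +-zero (zeroʳ _) (conv-zero _ _ d (λ _ → refl))
  S-diagonal (suc n) d = begin
    S (suc n) (suc n) (suc d) ≈⟨ S-sucʳ (suc n) n d ⟩
    S (suc n) n (suc d) - x n * S (suc n) n d ≈⟨ +-congʳ (S-sucˡ n n d) ⟩
    (S n n (suc d) + x n * S (suc n) n d) - x n * S (suc n) n d
      ≈⟨ solve 2 (λ a b → (a :+ b) :- b := a) refl _ _ ⟩
    S n n (suc d) ≈⟨ S-diagonal n d ⟩
    0# ∎

  -- The alphabet difference consists of r removed letters, so its h_d is e_d of these letters up to
  -- sign, which is 0 for d > r.
  S-vanish : ∀ r p d → r < d → S p (r ℕ.+ p) d ≈ 0#
  S-vanish zero p (suc d) q = S-diagonal p d
  S-vanish (suc r) p (suc d) (s≤s q) = trans (S-sucʳ p (r ℕ.+ p) d)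
    (+-zero (S-vanish r p (suc d) (ℕ.m≤n⇒m≤1+n q)) (neg-zero (*-zeroR _ (S-vanish r p d q))))

  -- The alphabet difference is the single letter x_n.
  S-power : ∀ n d → S (suc n) n d ≈ pow (x n) d
  S-power n zero = *-identityˡ _
  S-power n (suc d) = trans (S-sucˡ n n d)
    (trans (+-cong (S-diagonal n d) (*-congˡ (S-power n d))) (+-identityˡ _))

  -- The product of the x j - x i over i < j.
  factor : ℕ → Carrier
  factor j = conv (λ l → N l j) (pow (x j)) j

  module _ {p : Level} {I : Carrier → Set p} (isIdeal : IsIdeal R I) where
    open IsIdeal isIdeal

    -- Each use of the recursion h_(s+1)(x_0, ..., x_j) = h_(s+1)(x_0, ..., x_(j-1)) + x_j h_s(x_0,
    -- ..., x_j) loses its first term modulo `I` and leaves one more power of x_j.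
    H-above : ∀ i j → (∀ s → i < s → I (H s j)) → ∀ t → I (H (i ℕ.+ t) (suc j) - pow (x j) t * H i (suc j))
    H-above i j p zero rewrite ℕ.+-identityʳ i = I-≈0 (zero-sub (sym (*-identityˡ _)))
    H-above i j p (suc t) rewrite ℕ.+-suc i t = I-cong
      (solve 5 (λ a b h y w → a :+ y :* (h :- w :* b) := (a :+ y :* h) :- (y :* w) :* b) refl
        (H (suc (i ℕ.+ t)) j) (H i (suc j)) (H (i ℕ.+ t) (suc j)) (x j) (pow (x j) t))
      (I-+ (p (suc (i ℕ.+ t)) (s≤s (ℕ.m≤m+n i t))) (I-* (x j) (H-above i j p t)))

    -- By `H-above` the terms x_j^t h_i of the product may be replaced by h_(i+t)(x_0, ..., x_j).
    -- The resulting sum is the term of degree i + j for the alphabet {x_0, ..., x_j} minus {x_0,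
    -- ..., x_(j-1)}, and there `S-power` applies.
    factor-H : ∀ i j → (∀ s → i < s → I (H s j)) → I (factor j * H i (suc j) - pow (x j) (i ℕ.+ j))
    factor-H i j p = I-trans (I-neg′ step₁) (I-cong (+-congˡ (-‿cong (S-power j (i ℕ.+ j)))) step₂)
      where
      Nj : Series
      Nj l = N l j
      shifted : Series
      shifted t = H (i ℕ.+ t) (suc j)
      I-neg′ : ∀ {a b} → I (a - b) → I (b - a)
      I-neg′ {a} {b} q = I-cong (solve 2 (λ a b → :- (a :- b) := b :- a) refl a b) (I-neg q)
      step₁ : I (conv Nj shifted j - factor j * H i (suc j))
      step₁ = I-cong
        (begin
          conv Nj (λ t → shifted t - pow (x j) t * H i (suc j)) j
            ≈⟨ conv-comm Nj _ j ⟩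
          conv (λ t → shifted t - pow (x j) t * H i (suc j)) Nj j
            ≈⟨ conv-cong {g = Nj} (λ t → +-congˡ (solve 2 (λ a b → :- (a :* b) := (:- b) :* a) refl _ _)) (λ _ → refl) j ⟩
          conv (λ t → shifted t + (- H i (suc j)) * pow (x j) t) Nj j
            ≈⟨ trans (conv-distribʳ Nj _ _ j) (+-congˡ (conv-scale _ _ Nj j)) ⟩
          conv shifted Nj j + (- H i (suc j)) * conv (pow (x j)) Nj j
            ≈⟨ +-cong (conv-comm _ Nj j) (*-congˡ (conv-comm _ Nj j)) ⟩
          conv Nj shifted j + (- H i (suc j)) * factor j
            ≈⟨ +-congˡ (solve 2 (λ a b → (:- b) :* a := :- (a :* b)) refl _ _) ⟩
          conv Nj shifted j - factor j * H i (suc j) ∎)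
        (I-conv Nj _ j (H-above i j p))
      step₂ : I (conv Nj shifted j - S (suc j) j (i ℕ.+ j))
      step₂ = I-neg′ (I-conv-truncate Nj j (λ l q → I-≈0 (N-vanish j l q)) i (λ s → H s (suc j)))

    -- From the relation Σ (-1)^l e_l h_(d-l) = 0.
    N-from-H : ∀ j → (∀ s → 0 < s → I (H s j)) → ∀ d → I (N (suc d) j)
    N-from-H j p d = I-cong (*-identityʳ _) (I-from
      (I-cong (trans (trans (sym (S-diagonal j d)) (conv-last _ _ d))
                (solve 2 (λ a b → a :+ b := b :- (:- a)) refl _ _)) I-zero)
      (I-neg (I-conv (λ l → N l j) (λ i → H (suc i) j) d (λ i → p (suc i) (s≤s z≤n)))))

    E-from-N : ∀ d j → I (N d j) → I (E d j)
    E-from-N d j q = unsign d (I-cong (N-sign d j) q)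
      where
      unsign : ∀ d {a} → I (sign d a) → I a
      unsign zero p = p
      unsign (suc d) p = unsign d (I-cong (solve 1 (λ a → :- (:- a) := a) refl _) (I-neg p))

    N-from-E : ∀ d j → I (E d j) → I (N d j)
    N-from-E d j q = I-cong (sym (N-sign d j)) (signed d q)
      where
      signed : ∀ d {a} → I a → I (sign d a)
      signed zero p = p
      signed (suc d) p = I-neg (signed d p)

    -- Modulo `I` the first k variables contribute only e_0 = 1, so e_d of all r + k variables
    -- reduces to e_d of the other r, which is 0 for d > r.
    E-more-variables : ∀ k → (∀ d → 0 < d → I (E d k)) → ∀ r d → r < d → I (E d (r ℕ.+ k))
    E-more-variables k p zero d q = p d q
    E-more-variables k p (suc r) (suc d) (s≤s q) =
      I-+ (E-more-variables k p r (suc d) (ℕ.m≤n⇒m≤1+n q)) (I-* _ (E-more-variables k p r d q))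

-- The term order and arithmetic of exponent vectors

infix 4 _≺_
-- neglex by recursion from the last variable, the most significant one.
_≺_ : ∀ {n} → Mono n → Mono n → Set
[] ≺ [] = ⊥
(x ∷ a) ≺ (y ∷ b) = a ≺ b ⊎ (a ≡ b × x < y)

≺-irrefl : ∀ {n} (a : Mono n) → ¬ (a ≺ a)
≺-irrefl (x ∷ a) (inj₁ p) = ≺-irrefl a p
≺-irrefl (x ∷ a) (inj₂ (_ , p)) = ℕ.<-irrefl ≡.refl p

≺-trans : ∀ {n} {a b d : Mono n} → a ≺ b → b ≺ d → a ≺ d
≺-trans {a = []} {[]} {[]} () _
≺-trans {a = _ ∷ _} {_ ∷ _} {_ ∷ _} (inj₁ p) (inj₁ q) = inj₁ (≺-trans p q)
≺-trans {a = _ ∷ _} {_ ∷ _} {_ ∷ _} (inj₁ p) (inj₂ (≡.refl , _)) = inj₁ p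
≺-trans {a = _ ∷ _} {_ ∷ _} {_ ∷ _} (inj₂ (≡.refl , _)) (inj₁ q) = inj₁ q
≺-trans {a = _ ∷ _} {_ ∷ _} {_ ∷ _} (inj₂ (≡.refl , p)) (inj₂ (≡.refl , q)) = inj₂ (≡.refl , ℕ.<-trans p q)

≺-compare : ∀ {n} (a b : Mono n) → a ≺ b ⊎ a ≡ b ⊎ b ≺ a
≺-compare [] [] = inj₂ (inj₁ ≡.refl)
≺-compare (x ∷ a) (y ∷ b) with ≺-compare a b
... | inj₁ p = inj₁ (inj₁ p)
... | inj₂ (inj₂ p) = inj₂ (inj₂ (inj₁ p))
... | inj₂ (inj₁ ≡.refl) with ℕ.<-cmp x y
...   | tri< p _ _ = inj₁ (inj₂ (≡.refl , p))
...   | tri≈ _ ≡.refl _ = inj₂ (inj₁ ≡.refl)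
...   | tri> _ _ p = inj₂ (inj₂ (inj₂ (≡.refl , p)))

≺-wellFounded : ∀ {n} → WellFounded (_≺_ {n})
≺-wellFounded [] = acc λ { {[]} () }
≺-wellFounded {suc n} (x ∷ a) = outer a (≺-wellFounded a) x
  where
  inner : ∀ (a : Mono n) → (∀ {b} → b ≺ a → ∀ y → Acc _≺_ (y ∷ b)) → ∀ x → Acc _<_ x → Acc _≺_ (x ∷ a)
  inner a p x (acc q) = acc λ
    { {y ∷ b} (inj₁ r) → p r y
    ; {y ∷ b} (inj₂ (≡.refl , r)) → inner a p y (q r) }
  outer : ∀ (a : Mono n) → Acc _≺_ a → ∀ x → Acc _≺_ (x ∷ a)
  outer a (acc p) x = inner a (λ r → outer _ (p r)) x (<-wellFounded x)

lookup-extensional : ∀ {n} (a b : Mono n) → (∀ i → lookup a i ≡ lookup b i) → a ≡ b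
lookup-extensional [] [] p = ≡.refl
lookup-extensional (x ∷ a) (y ∷ b) p = cong₂ _∷_ (p zero) (lookup-extensional a b (λ i → p (suc i)))

neglex⇒≺ : ∀ {n} {a b : Mono n} → a <neglex b → a ≺ b
neglex⇒≺ {a = x ∷ a} {y ∷ b} (zero , p , q) =
  inj₂ (lookup-extensional a b (λ i → q (suc i) (s≤s z≤n)) , p)
neglex⇒≺ {a = x ∷ a} {y ∷ b} (suc i , p , q) =
  inj₁ (neglex⇒≺ (i , p , λ j r → q (suc j) (s≤s r)))

≺⇒neglex : ∀ {n} {a b : Mono n} → a ≺ b → a <neglex b
≺⇒neglex {a = []} {[]} ()
≺⇒neglex {a = x ∷ a} {y ∷ b} (inj₂ (≡.refl , p)) = zero , p , λ { (suc j) _ → ≡.refl }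
≺⇒neglex {a = x ∷ a} {y ∷ b} (inj₁ p) with ≺⇒neglex p
... | i , q , r = suc i , q , λ { (suc j) (s≤s s) → r j s }

⊕-comm : ∀ {n} (a b : Mono n) → a ⊕ b ≡ b ⊕ a
⊕-comm [] [] = ≡.refl
⊕-comm (x ∷ a) (y ∷ b) = cong₂ _∷_ (ℕ.+-comm x y) (⊕-comm a b)

⊕-monoˡ-≺ : ∀ {n} {a b : Mono n} d → a ≺ b → a ⊕ d ≺ b ⊕ d
⊕-monoˡ-≺ {a = []} {[]} [] ()
⊕-monoˡ-≺ {a = _ ∷ _} {_ ∷ _} (z ∷ d) (inj₁ p) = inj₁ (⊕-monoˡ-≺ d p)
⊕-monoˡ-≺ {a = _ ∷ _} {_ ∷ _} (z ∷ d) (inj₂ (≡.refl , p)) = inj₂ (≡.refl , ℕ.+-monoˡ-< z p)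

⊕-monoʳ-≺ : ∀ {n} {a b : Mono n} d → a ≺ b → d ⊕ a ≺ d ⊕ b
⊕-monoʳ-≺ {a = a} {b} d p = subst₂ _≺_ (⊕-comm a d) (⊕-comm b d) (⊕-monoˡ-≺ d p)

-- Together with `⊕-split-≡`: in a product, a term at or above the sum of the two tops, other than
-- the pair of tops itself, has a factor above its own top. This is all that multiplicativity of
-- leading terms requires.
⊕-split-≺ : ∀ {n} (a b u v : Mono n) → a ⊕ b ≺ u ⊕ v → a ≺ u ⊎ b ≺ v
⊕-split-≺ a b u v p with ≺-compare a u | ≺-compare b v
... | inj₁ q | _ = inj₁ q
... | _ | inj₁ q = inj₂ q
... | inj₂ (inj₁ ≡.refl) | inj₂ (inj₁ ≡.refl) = ⊥-elim (≺-irrefl _ p)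
... | inj₂ (inj₁ ≡.refl) | inj₂ (inj₂ r) = ⊥-elim (≺-irrefl _ (≺-trans p (⊕-monoʳ-≺ a r)))
... | inj₂ (inj₂ q) | inj₂ (inj₁ ≡.refl) = ⊥-elim (≺-irrefl _ (≺-trans p (⊕-monoˡ-≺ b q)))
... | inj₂ (inj₂ q) | inj₂ (inj₂ r) =
  ⊥-elim (≺-irrefl _ (≺-trans p (≺-trans (⊕-monoˡ-≺ v q) (⊕-monoʳ-≺ a r))))

⊕-split-≡ : ∀ {n} (a b u v : Mono n) → u ⊕ v ≡ a ⊕ b → u ≢ a → a ≺ u ⊎ b ≺ v
⊕-split-≡ a b u v p q with ≺-compare a u | ≺-compare b v
... | inj₁ r | _ = inj₁ r
... | _ | inj₁ r = inj₂ r
... | inj₂ (inj₁ ≡.refl) | _ = ⊥-elim (q ≡.refl)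
... | inj₂ (inj₂ r) | inj₂ (inj₁ ≡.refl) = ⊥-elim (≺-irrefl _ (subst (_≺ a ⊕ b) p (⊕-monoˡ-≺ b r)))
... | inj₂ (inj₂ r) | inj₂ (inj₂ s) =
  ⊥-elim (≺-irrefl _ (subst (_≺ a ⊕ b) p (≺-trans (⊕-monoˡ-≺ v r) (⊕-monoʳ-≺ a s))))

single : ∀ n → ℕ → ℕ → Mono n
single zero j d = []
single (suc n) zero d = d ∷ Vec.replicate n 0
single (suc n) (suc j) d = 0 ∷ single n j d

⊕-identityʳ : ∀ {n} (a : Mono n) → a ⊕ Vec.replicate n 0 ≡ a
⊕-identityʳ [] = ≡.refl
⊕-identityʳ (x ∷ a) = cong₂ _∷_ (ℕ.+-identityʳ x) (⊕-identityʳ a)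

⊕-identityˡ : ∀ {n} (a : Mono n) → Vec.replicate n 0 ⊕ a ≡ a
⊕-identityˡ [] = ≡.refl
⊕-identityˡ (x ∷ a) = cong (x ∷_) (⊕-identityˡ a)

⊕-assoc : ∀ {n} (a b d : Mono n) → (a ⊕ b) ⊕ d ≡ a ⊕ (b ⊕ d)
⊕-assoc [] [] [] = ≡.refl
⊕-assoc (x ∷ a) (y ∷ b) (z ∷ d) = cong₂ _∷_ (ℕ.+-assoc x y z) (⊕-assoc a b d)

single-suc : ∀ n j d → single n j 1 ⊕ single n j d ≡ single n j (suc d)
single-suc zero j d = ≡.refl
single-suc (suc n) zero d = cong (suc d ∷_) (⊕-identityʳ (Vec.replicate n 0))
single-suc (suc n) (suc j) d = cong (0 ∷_) (single-suc n j d)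

single-0 : ∀ n j → single n j 0 ≡ Vec.replicate n 0
single-0 zero j = ≡.refl
single-0 (suc n) zero = ≡.refl
single-0 (suc n) (suc j) = cong (0 ∷_) (single-0 n j)

deg-⊕ : ∀ {n} (a b : Mono n) → deg (a ⊕ b) ≡ deg a ℕ.+ deg b
deg-⊕ [] [] = ≡.refl
deg-⊕ (x ∷ a) (y ∷ b) = ≡.trans (cong (x ℕ.+ y ℕ.+_) (deg-⊕ a b)) (interchange x y (deg a) (deg b))
  where
  open import Algebra.Properties.CommutativeSemigroup ℕ.+-commutativeSemigroup using (interchange)

-- Leading terms and finitely supported polynomials

module Polynomials {c ℓ : Level} (F : Field c ℓ) (n : ℕ) where
  open Field F
  open PolynomialRing F

  TopLe : Poly F n → Mono n → Set ℓ
  TopLe f a = ∀ b → a ≺ b → f b ≈ 0#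

  mul-TopLe : ∀ {f g a b} → TopLe f a → TopLe g b → TopLe (mul n f g) (a ⊕ b)
  mul-TopLe {f} {g} {a} {b} p q d r = mul-vanish n f g d λ u v s → split u v (⊕-split-≺ a b u v (subst (a ⊕ b ≺_) (≡.sym s) r))
    where
    split : ∀ u v → a ≺ u ⊎ b ≺ v → f u * g v ≈ 0#
    split u v (inj₁ r) = *-zeroL _ (p u r)
    split u v (inj₂ r) = *-zeroR _ (q v r)

  mul-top : ∀ {f g a b} → TopLe f a → TopLe g b → mul n f g (a ⊕ b) ≈ f a * g b
  mul-top {f} {g} {a} {b} p q = mul-single n f g a b λ u v s r → split u v (⊕-split-≡ a b u v s r)
    where
    split : ∀ u v → a ≺ u ⊎ b ≺ v → f u * g v ≈ 0#
    split u v (inj₁ r) = *-zeroL _ (p u r)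
    split u v (inj₂ r) = *-zeroR _ (q v r)

  monomial-TopLe : ∀ a → TopLe (monomial F n a) a
  monomial-TopLe a b p = monomial-≢ {a = a} {b} λ { ≡.refl → ≺-irrefl a p }

  one≈monomial : one n ≈ₚ monomial F n (Vec.replicate n 0)
  one≈monomial m with ≡-dec ℕ._≟_ (Vec.replicate n 0) m
  ... | yes ≡.refl = one-zero n
    where
    one-zero : ∀ n → one n (Vec.replicate n 0) ≈ 1#
    one-zero zero = refl
    one-zero (suc n) = one-zero n
  ... | no p = one-nonzero n m p
    where
    one-nonzero : ∀ n m → Vec.replicate n 0 ≢ m → one n m ≈ 0#
    one-nonzero zero [] p = ⊥-elim (p ≡.refl)
    one-nonzero (suc n) (zero ∷ m) p = one-nonzero n m (λ q → p (cong (0 ∷_) q))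
    one-nonzero (suc n) (suc _ ∷ m) p = refl

  finSupp-cong : ∀ {f g} → f ≈ₚ g → FinSupp F n f → FinSupp F n g
  finSupp-cong p (D , q) = D , λ m r → trans (sym (p m)) (q m r)

  finSupp-monomial : ∀ a → FinSupp F n (monomial F n a)
  finSupp-monomial a = deg a , λ m p → monomial-≢ {a = a} {m} λ { ≡.refl → ℕ.<-irrefl ≡.refl p }

  finSupp-+ : ∀ {f g} → FinSupp F n f → FinSupp F n g → FinSupp F n (λ m → f m + g m)
  finSupp-+ (D , p) (D' , q) = D ℕ.+ D' , λ m r →
    +-zero (p m (ℕ.≤-<-trans (ℕ.m≤m+n D D') r)) (q m (ℕ.≤-<-trans (ℕ.m≤n+m D' D) r))

  finSupp-mul : ∀ {f g} → FinSupp F n f → FinSupp F n g → FinSupp F n (mul n f g)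
  finSupp-mul {f} {g} (D , p) (D' , q) = D ℕ.+ D' , λ m r → mul-vanish n f g m λ u v s →
    split u v (subst (D ℕ.+ D' <_) (≡.trans (cong deg (≡.sym s)) (deg-⊕ u v)) r)
    where
    split : ∀ u v → D ℕ.+ D' < deg u ℕ.+ deg v → f u * g v ≈ 0#
    split u v r with D ℕ.<? deg u
    ... | yes s = *-zeroL _ (p u s)
    ... | no s with D' ℕ.<? deg v
    ...   | yes t = *-zeroR _ (q v t)
    ...   | no t = ⊥-elim (ℕ.<⇒≱ r (ℕ.+-mono-≤ (ℕ.≮⇒≥ s) (ℕ.≮⇒≥ t)))

  -- Multipliers in `InIdeal` must have finite support, so J is an ideal of this subring; it need
  -- not be closed under multiplication by the power series in `polyRing`.
  Finite : Set (c ⊔ ℓ)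
  Finite = Σ (Poly F n) (FinSupp F n)

  private module P = CommutativeRing (polyRing n)

  finiteRing : CommutativeRing (c ⊔ ℓ) ℓ
  finiteRing = record
    { Carrier = Finite
    ; _≈_ = λ f g → proj₁ f ≈ₚ proj₁ g
    ; _+_ = λ { (f , p) (g , q) → (λ m → f m + g m) , finSupp-+ p q }
    ; _*_ = λ { (f , p) (g , q) → mul n f g , finSupp-mul p q }
    ; -_ = λ { (f , D , p) → (λ m → - f m) , D , λ m q → neg-zero (p m q) }
    ; 0# = (λ _ → 0#) , 0 , λ _ _ → refl
    ; 1# = one n , finSupp-cong (λ m → sym (one≈monomial m)) (finSupp-monomial (Vec.replicate n 0))
    ; isCommutativeRing = record
      { isRing = record
        { +-isAbelianGroup = record
          { isGroup = record
            { isMonoid = record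
              { isSemigroup = record
                { isMagma = record
                  { isEquivalence = record { refl = P.refl ; sym = P.sym ; trans = P.trans }
                  ; ∙-cong = P.+-cong }
                ; assoc = λ f g h → P.+-assoc (proj₁ f) (proj₁ g) (proj₁ h) }
              ; identity = (λ f → P.+-identityˡ (proj₁ f)) , (λ f → P.+-identityʳ (proj₁ f)) }
            ; inverse = (λ f → P.-‿inverseˡ (proj₁ f)) , (λ f → P.-‿inverseʳ (proj₁ f))
            ; ⁻¹-cong = P.-‿cong }
          ; comm = λ f g → P.+-comm (proj₁ f) (proj₁ g) }
        ; *-cong = P.*-cong
        ; *-assoc = λ f g h → P.*-assoc (proj₁ f) (proj₁ g) (proj₁ h)
        ; *-identity = (λ f → P.*-identityˡ (proj₁ f)) , (λ f → P.*-identityʳ (proj₁ f))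
        ; distrib = (λ f g h → P.distribˡ (proj₁ f) (proj₁ g) (proj₁ h))
                  , (λ f g h → P.distribʳ (proj₁ f) (proj₁ g) (proj₁ h)) }
      ; *-comm = λ f g → P.*-comm (proj₁ f) (proj₁ g) } }

-- Exterior algebra and flagged Schur determinants

size : ∀ {m} → Vec Bool m → ℕ
size [] = 0
size (false ∷ b) = size b
size (true ∷ b) = suc (size b)

full : ∀ m → Vec Bool m
full m = Vec.replicate m true

size-≤ : ∀ {m} (b : Vec Bool m) → size b ≤ m
size-≤ [] = z≤n
size-≤ (false ∷ b) = ℕ.m≤n⇒m≤1+n (size-≤ b)
size-≤ (true ∷ b) = s≤s (size-≤ b)

module Exterior {c ℓ : Level} (R : CommutativeRing c ℓ) where
  open CommutativeRing R
  open RingTools R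
  open PowerSeries R using (Series; conv)
  open import Relation.Binary.Reasoning.Setoid setoid

  -- Coordinates of an element of the exterior algebra on e_0, …, e_(m-1);
  -- the head of the index vector belongs to e_(m-1).
  Ext : ℕ → Set c
  Ext m = Vec Bool m → Carrier

  unit : ∀ m → Ext m
  unit zero [] = 1#
  unit (suc m) (false ∷ b) = unit m b
  unit (suc m) (true ∷ b) = 0#

  wedge : ∀ m → Series → Ext m → Ext m
  wedge zero ρ ω [] = 0#
  wedge (suc m) ρ ω (false ∷ b) = wedge m ρ (λ b → ω (false ∷ b)) b
  -- The sign is the cost of moving `ρ` past the basis vector e_m.
  wedge (suc m) ρ ω (true ∷ b) = ρ m * ω (false ∷ b) - wedge m ρ (λ b → ω (true ∷ b)) b

  -- Interior product with the covector whose value at e_(m-1-l) is s l.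
  contract : ∀ m → Series → Ext m → Ext m
  contract zero s ω [] = 0#
  contract (suc m) s ω (false ∷ b) = contract m (λ l → s (suc l)) (λ b → ω (false ∷ b)) b + s 0 * ω (true ∷ b)
  contract (suc m) s ω (true ∷ b) = - contract m (λ l → s (suc l)) (λ b → ω (true ∷ b)) b

  pairing : ℕ → Series → Series → Carrier
  pairing zero s ρ = 0#
  pairing (suc m) s ρ = s 0 * ρ m + pairing m (λ l → s (suc l)) ρ

  pairing-conv : ∀ m s ρ → pairing (suc m) s ρ ≈ conv s ρ m
  pairing-conv zero s ρ = +-identityʳ _
  pairing-conv (suc m) s ρ = +-congˡ (pairing-conv m _ ρ)

  wedge-cong : ∀ m ρ {ω ω'} → (∀ b → ω b ≈ ω' b) → ∀ b → wedge m ρ ω b ≈ wedge m ρ ω' b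
  wedge-cong zero ρ p [] = refl
  wedge-cong (suc m) ρ p (false ∷ b) = wedge-cong m ρ (λ b → p (false ∷ b)) b
  wedge-cong (suc m) ρ p (true ∷ b) =
    +-cong (*-congˡ (p (false ∷ b))) (-‿cong (wedge-cong m ρ (λ b → p (true ∷ b)) b))

  wedge-linear : ∀ m ρ a d ω ω' b →
    wedge m ρ (λ b → a * ω b + d * ω' b) b ≈ a * wedge m ρ ω b + d * wedge m ρ ω' b
  wedge-linear zero ρ a d ω ω' [] = sym (+-zero (zeroʳ a) (zeroʳ d))
  wedge-linear (suc m) ρ a d ω ω' (false ∷ b) = wedge-linear m ρ a d _ _ b
  wedge-linear (suc m) ρ a d ω ω' (true ∷ b) = trans
    (+-congˡ (-‿cong (wedge-linear m ρ a d _ _ b)))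
    (solve 7 (λ a d r u v s t → r :* (a :* u :+ d :* v) :- (a :* s :+ d :* t)
                             := a :* (r :* u :- s) :+ d :* (r :* v :- t)) refl a d (ρ m) _ _ _ _)

  wedge-scale : ∀ m ρ a ω b → wedge m ρ (λ b → a * ω b) b ≈ a * wedge m ρ ω b
  wedge-scale zero ρ a ω [] = sym (zeroʳ a)
  wedge-scale (suc m) ρ a ω (false ∷ b) = wedge-scale m ρ a _ b
  wedge-scale (suc m) ρ a ω (true ∷ b) = trans
    (+-congˡ (-‿cong (wedge-scale m ρ a _ b)))
    (solve 4 (λ a r u s → r :* (a :* u) :- a :* s := a :* (r :* u :- s)) refl a (ρ m) _ _)

  -- The weights stay on both sides because the effect of π_i on a row is only available after
  -- multiplication by x_i - x_(i+1).
  wedge-linearˡ : ∀ m {ρ ρ₁ ρ₂} {a a₁ a₂} → (∀ j → a * ρ j ≈ a₁ * ρ₁ j + a₂ * ρ₂ j) →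
    ∀ ω b → a * wedge m ρ ω b ≈ a₁ * wedge m ρ₁ ω b + a₂ * wedge m ρ₂ ω b
  wedge-linearˡ zero p ω [] = trans (zeroʳ _) (sym (+-zero (zeroʳ _) (zeroʳ _)))
  wedge-linearˡ (suc m) p ω (false ∷ b) = wedge-linearˡ m p _ b
  wedge-linearˡ (suc m) {ρ} {ρ₁} {ρ₂} {a} {a₁} {a₂} p ω (true ∷ b) = begin
    a * (ρ m * u - w)
      ≈⟨ solve 4 (λ a r u w → a :* (r :* u :- w) := (a :* r) :* u :- a :* w) refl a (ρ m) u w ⟩
    (a * ρ m) * u - a * w
      ≈⟨ +-cong (*-congʳ (p m)) (-‿cong (wedge-linearˡ m p _ b)) ⟩
    (a₁ * ρ₁ m + a₂ * ρ₂ m) * u - (a₁ * w₁ + a₂ * w₂)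
      ≈⟨ solve 7 (λ a r d s u v w → (a :* r :+ d :* s) :* u :- (a :* v :+ d :* w)
           := a :* (r :* u :- v) :+ d :* (s :* u :- w)) refl a₁ (ρ₁ m) a₂ (ρ₂ m) u w₁ w₂ ⟩
    a₁ * (ρ₁ m * u - w₁) + a₂ * (ρ₂ m * u - w₂) ∎
    where
    u = ω (false ∷ b)
    w = wedge m ρ (λ b → ω (true ∷ b)) b
    w₁ = wedge m ρ₁ (λ b → ω (true ∷ b)) b
    w₂ = wedge m ρ₂ (λ b → ω (true ∷ b)) b

  contract-vanish : ∀ m s ω → (∀ b → ω b ≈ 0#) → ∀ b → contract m s ω b ≈ 0#
  contract-vanish zero s ω p [] = refl
  contract-vanish (suc m) s ω p (false ∷ b) =
    +-zero (contract-vanish m _ _ (λ b → p (false ∷ b)) b) (*-zeroR _ (p (true ∷ b)))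
  contract-vanish (suc m) s ω p (true ∷ b) = neg-zero (contract-vanish m _ _ (λ b → p (true ∷ b)) b)

  contract-linear : ∀ m s r ω ω' b →
    contract m s (λ b → r * ω b - ω' b) b ≈ r * contract m s ω b - contract m s ω' b
  contract-linear zero s r ω ω' [] = sym (trans (+-congʳ (zeroʳ r)) (-‿inverseʳ 0#))
  contract-linear (suc m) s r ω ω' (false ∷ b) = trans
    (+-congʳ (contract-linear m _ r _ _ b))
    (solve 6 (λ r u v s w z → (r :* u :- v) :+ s :* (r :* w :- z) := r :* (u :+ s :* w) :- (v :+ s :* z))
      refl r _ _ (s 0) _ _)
  contract-linear (suc m) s r ω ω' (true ∷ b) = trans
    (-‿cong (contract-linear m _ r _ _ b))
    (solve 3 (λ r u v → :- (r :* u :- v) := r :* (:- u) :- (:- v)) refl r _ _)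

  -- The interior product is an antiderivation. Both the membership of determinants in ideals and
  -- their triangular evaluation are derived from this rule.
  contract-wedge : ∀ m s ρ ω b →
    contract m s (wedge m ρ ω) b ≈ pairing m s ρ * ω b - wedge m ρ (contract m s ω) b
  contract-wedge zero s ρ ω [] = sym (trans (+-congʳ (zeroˡ _)) (-‿inverseʳ 0#))
  contract-wedge (suc m) s ρ ω (false ∷ b) = begin
    contract m s⁺ (wedge m ρ ω₀) b + s 0 * (ρ m * ω₀ b - wedge m ρ ω₁ b)
      ≈⟨ +-congʳ (contract-wedge m s⁺ ρ ω₀ b) ⟩
    (P * ω₀ b - wedge m ρ (contract m s⁺ ω₀) b) + s 0 * (ρ m * ω₀ b - wedge m ρ ω₁ b)
      ≈⟨ solve 6 (λ p u w s r v → (p :* u :- w) :+ s :* (r :* u :- v) := (s :* r :+ p) :* u :- (con (1 , 0) :* w :+ s :* v))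
           refl P (ω₀ b) _ (s 0) (ρ m) _ ⟩
    (s 0 * ρ m + P) * ω₀ b - (difference (1 , 0) * wedge m ρ (contract m s⁺ ω₀) b + s 0 * wedge m ρ ω₁ b)
      ≈⟨ +-congˡ (-‿cong (wedge-linear m ρ (difference (1 , 0)) (s 0) _ _ b)) ⟨
    (s 0 * ρ m + P) * ω₀ b - wedge m ρ (λ b → difference (1 , 0) * contract m s⁺ ω₀ b + s 0 * ω₁ b) b
      ≈⟨ +-congˡ (-‿cong (wedge-cong m ρ (λ b → solve 2 (λ u v → con (1 , 0) :* u :+ v := u :+ v) refl _ _) b)) ⟩
    (s 0 * ρ m + P) * ω₀ b - wedge m ρ (λ b → contract m s⁺ ω₀ b + s 0 * ω₁ b) b ∎
    where
    s⁺ : Series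
    s⁺ l = s (suc l)
    ω₀ ω₁ : Ext m
    ω₀ b = ω (false ∷ b)
    ω₁ b = ω (true ∷ b)
    P = pairing m s⁺ ρ
  contract-wedge (suc m) s ρ ω (true ∷ b) = begin
    - contract m s⁺ (λ b → ρ m * ω₀ b - wedge m ρ ω₁ b) b
      ≈⟨ -‿cong (trans (contract-linear m s⁺ (ρ m) ω₀ _ b) (+-congˡ (-‿cong (contract-wedge m s⁺ ρ ω₁ b)))) ⟩
    - (ρ m * contract m s⁺ ω₀ b - (P * ω₁ b - wedge m ρ (contract m s⁺ ω₁) b))
      ≈⟨ solve 6 (λ r u p v w s → :- (r :* u :- (p :* v :- w)) := (s :* r :+ p) :* v :- (r :* (u :+ s :* v) :- (:- con (1 , 0)) :* w))
           refl (ρ m) _ P (ω₁ b) _ (s 0) ⟩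
    (s 0 * ρ m + P) * ω₁ b - (ρ m * (contract m s⁺ ω₀ b + s 0 * ω₁ b)
                               - (- difference (1 , 0)) * wedge m ρ (contract m s⁺ ω₁) b)
      ≈⟨ +-congˡ (-‿cong (+-congˡ (-‿cong (trans (sym (wedge-scale m ρ _ _ b)) (wedge-cong m ρ
           (λ b → solve 1 (λ u → (:- con (1 , 0)) :* u := :- u) refl _) b))))) ⟩
    (s 0 * ρ m + P) * ω₁ b - (ρ m * (contract m s⁺ ω₀ b + s 0 * ω₁ b)
                               - wedge m ρ (λ b → - contract m s⁺ ω₁ b) b) ∎
    where
    s⁺ : Series
    s⁺ l = s (suc l)
    ω₀ ω₁ : Ext m
    ω₀ b = ω (false ∷ b)
    ω₁ b = ω (true ∷ b)
    P = pairing m s⁺ ρ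

  contract-unit : ∀ m s b → contract m s (unit m) b ≈ 0#
  contract-unit zero s [] = refl
  contract-unit (suc m) s (false ∷ b) = +-zero (contract-unit m _ b) (zeroʳ _)
  contract-unit (suc m) s (true ∷ b) = neg-zero (contract-vanish m _ (λ _ → 0#) (λ _ → refl) b)

  wedges : ∀ m → List Series → Ext m
  wedges m [] = unit m
  wedges m (ρ ∷ ρs) = wedge m ρ (wedges m ρs)

  -- The rows are listed from the last one.
  det : ∀ m → List Series → Carrier
  det m ρs = wedges m ρs (full m)

  -- The offset `o` counts the basis vectors already stripped from the index in a recursion on `m`.
  Graded : ∀ {m} → ℕ → ℕ → Ext m → Set ℓ
  Graded o d ω = ∀ b → o ℕ.+ size b ≢ d → ω b ≈ 0#

  unit-graded : ∀ m → Graded 0 0 (unit m)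
  unit-graded zero [] p = ⊥-elim (p ≡.refl)
  unit-graded (suc m) (false ∷ b) p = unit-graded m b p
  unit-graded (suc m) (true ∷ b) p = refl

  wedge-graded : ∀ m ρ o d ω → Graded o d ω → Graded o (suc d) (wedge m ρ ω)
  wedge-graded zero ρ o d ω g [] p = refl
  wedge-graded (suc m) ρ o d ω g (false ∷ b) p = wedge-graded m ρ o d _ (λ b → g (false ∷ b)) b p
  wedge-graded (suc m) ρ o d ω g (true ∷ b) p = trans (+-cong
    (*-zeroR _ (g (false ∷ b) (λ q → p (≡.trans (ℕ.+-suc o (size b)) (cong suc q)))))
    (-‿cong (wedge-graded m ρ (suc o) d _ (λ b q → g (true ∷ b) (λ r → q (≡.trans (≡.sym (ℕ.+-suc o (size b))) r)))
      b (λ r → p (≡.trans (ℕ.+-suc o (size b)) r))))) (-‿inverseʳ 0#)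

  wedges-graded : ∀ m ρs → Graded 0 (length ρs) (wedges m ρs)
  wedges-graded m [] = unit-graded m
  wedges-graded m (ρ ∷ ρs) = wedge-graded m ρ 0 _ _ (wedges-graded m ρs)

  wedges-restrict : ∀ m ρs b → wedges (suc m) ρs (false ∷ b) ≈ wedges m ρs b
  wedges-restrict m [] b = refl
  wedges-restrict m (ρ ∷ ρs) b = wedge-cong m ρ (wedges-restrict m ρs) b

  det-expand : ∀ m ρ ρs → det (suc m) (ρ ∷ ρs) ≈ ρ m * det m ρs - wedge m ρ (λ b → wedges (suc m) ρs (true ∷ b)) (full m)
  det-expand m ρ ρs = +-congʳ (*-congˡ (wedges-restrict m ρs (full m)))

  -- Cramer's rule for a covector with leading coefficient 1.
  det-contract : ∀ m s ρs → length ρs ≡ suc m → s 0 ≈ 1# →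
    contract (suc m) s (wedges (suc m) ρs) (false ∷ full m) ≈ det (suc m) ρs
  det-contract m s ρs p q = trans
    (+-cong (contract-vanish m _ _ (λ b → trans (wedges-restrict m ρs b)
              (wedges-graded m ρs b (λ r → ℕ.<-irrefl (≡.trans r p) (s≤s (size-≤ b))))) (full m))
            (trans (*-congʳ q) (*-identityˡ _)))
    (+-identityˡ _)

  module _ {p : Level} {I : Carrier → Set p} (isIdeal : IsIdeal R I) where
    open IsIdeal isIdeal

    wedge-ideal : ∀ m ρ ω → (∀ b → I (ω b)) → ∀ b → I (wedge m ρ ω b)
    wedge-ideal zero ρ ω q [] = I-zero
    wedge-ideal (suc m) ρ ω q (false ∷ b) = wedge-ideal m ρ _ (λ b → q (false ∷ b)) b
    wedge-ideal (suc m) ρ ω q (true ∷ b) = I-sub (I-* _ (q (false ∷ b))) (wedge-ideal m ρ _ (λ b → q (true ∷ b)) b)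

    contract-ideal : ∀ m s ρs → All (λ ρ → I (pairing m s ρ)) ρs → ∀ b → I (contract m s (wedges m ρs) b)
    contract-ideal m s [] [] b = I-≈0 (contract-unit m s b)
    contract-ideal m s (ρ ∷ ρs) (q ∷ qs) b = I-cong (sym (contract-wedge m s ρ (wedges m ρs) b))
      (I-sub (I-*ʳ _ q) (wedge-ideal m ρ _ (contract-ideal m s ρs qs) b))

    -- The covector `s` encodes a column operation that brings the last column into `I`. Instead of
    -- performing it, the wedge of the rows is contracted with `s`: the antiderivation rule puts
    -- every coordinate into `I`, and by Cramer's rule one of them is the determinant.
    det-ideal : ∀ m s ρs → length ρs ≡ suc m → s 0 ≈ 1# →
      All (λ ρ → I (pairing (suc m) s ρ)) ρs → I (det (suc m) ρs)
    det-ideal m s ρs l q qs = I-cong (det-contract m s ρs l q) (contract-ideal (suc m) s ρs qs (false ∷ full m))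

  zeroIdeal : IsIdeal R (λ a → a ≈ 0#)
  zeroIdeal = record
    { I-cong = λ p q → trans (sym p) q ; I-zero = refl ; I-+ = +-zero ; I-* = *-zeroR }

  -- The column operation encoded by `s` clears the last column in every row except `ρ`.
  det-triangular : ∀ m s ρ ρs → length ρs ≡ m → s 0 ≈ 1# →
    All (λ ρ → pairing (suc m) s ρ ≈ 0#) ρs → det (suc m) (ρ ∷ ρs) ≈ pairing (suc m) s ρ * det m ρs
  det-triangular m s ρ ρs l q qs = begin
    det (suc m) (ρ ∷ ρs) ≈⟨ det-contract m s (ρ ∷ ρs) (cong suc l) q ⟨
    contract (suc m) s (wedges (suc m) (ρ ∷ ρs)) (false ∷ full m)
      ≈⟨ contract-wedge (suc m) s ρ (wedges (suc m) ρs) (false ∷ full m) ⟩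
    pairing (suc m) s ρ * wedges (suc m) ρs (false ∷ full m) - wedge (suc m) ρ (contract (suc m) s (wedges (suc m) ρs)) (false ∷ full m)
      ≈⟨ +-cong (*-congˡ (wedges-restrict m ρs (full m)))
           (neg-zero (wedge-ideal zeroIdeal (suc m) ρ _ (contract-ideal zeroIdeal (suc m) s ρs qs) (false ∷ full m))) ⟩
    pairing (suc m) s ρ * det m ρs + 0# ≈⟨ +-identityʳ _ ⟩
    pairing (suc m) s ρ * det m ρs ∎

  wedges-linear : ∀ m ρs₁ {ρ ρ' ρ''} {a a' a''} ρs₂ → (∀ j → a * ρ j ≈ a' * ρ' j + a'' * ρ'' j) → ∀ b →
    a * wedges m (ρs₁ ++ ρ ∷ ρs₂) b ≈ a' * wedges m (ρs₁ ++ ρ' ∷ ρs₂) b + a'' * wedges m (ρs₁ ++ ρ'' ∷ ρs₂) b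
  wedges-linear m [] ρs₂ p b = wedge-linearˡ m p _ b
  wedges-linear m (ρ₀ ∷ ρs₁) {a = a} {a'} {a''} ρs₂ p b = trans (sym (wedge-scale m ρ₀ a _ b))
    (trans (wedge-cong m ρ₀ (wedges-linear m ρs₁ ρs₂ p) b) (wedge-linear m ρ₀ a' a'' _ _ b))

  module _ (θ : Carrier → Carrier) (θ-0 : θ 0# ≈ 0#) (θ-1 : θ 1# ≈ 1#)
           (θ-* : ∀ a b → θ (a * b) ≈ θ a * θ b) (θ-sub : ∀ a b → θ (a - b) ≈ θ a - θ b) where

    unit-map : ∀ m b → unit m b ≈ θ (unit m b)
    unit-map zero [] = sym θ-1
    unit-map (suc m) (false ∷ b) = unit-map m b
    unit-map (suc m) (true ∷ b) = sym θ-0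

    wedge-map : ∀ m ρ ρ' ω ω' → (∀ j → ρ' j ≈ θ (ρ j)) → (∀ b → ω' b ≈ θ (ω b)) → ∀ b →
      wedge m ρ' ω' b ≈ θ (wedge m ρ ω b)
    wedge-map zero ρ ρ' ω ω' p q [] = sym θ-0
    wedge-map (suc m) ρ ρ' ω ω' p q (false ∷ b) = wedge-map m ρ ρ' _ _ p (λ b → q (false ∷ b)) b
    wedge-map (suc m) ρ ρ' ω ω' p q (true ∷ b) = trans
      (+-cong (trans (*-cong (p m) (q (false ∷ b))) (sym (θ-* _ _)))
              (-‿cong (wedge-map m ρ ρ' _ _ p (λ b → q (true ∷ b)) b))) (sym (θ-sub _ _))

    wedges-map : ∀ m {ρs ρs'} → Pointwise (λ ρ' ρ → ∀ j → ρ' j ≈ θ (ρ j)) ρs' ρs → ∀ b →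
      wedges m ρs' b ≈ θ (wedges m ρs b)
    wedges-map m [] b = unit-map m b
    wedges-map m (p ∷ ps) b = wedge-map m _ _ _ _ p (wedges-map m ps) b

  -- Three predicates are kept apart because in the estimate of leading monomials the entries of the
  -- new row have bounded degree in its last variable, whereas the minors of the other rows do not
  -- contain that variable.
  wedge-closed : ∀ {p q r} {P : Carrier → Set p} {B : Carrier → Set q} {Q : Carrier → Set r} →
    Q 0# → (∀ {a b} → Q a → Q b → Q (a - b)) → (∀ {a b} → P a → B b → Q (a * b)) →
    ∀ m ρ ω → (∀ j → j < m → P (ρ j)) → (∀ b → B (ω b)) → ∀ b → Q (wedge m ρ ω b)
  wedge-closed Q-0 Q-sub Q-* zero ρ ω p q [] = Q-0
  wedge-closed {P = P} {B} {Q} Q-0 Q-sub Q-* (suc m) ρ ω p q (false ∷ b) = wedge-closed {P = P} {B} {Q} Q-0 Q-sub Q-* m ρ _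
    (λ j r → p j (ℕ.m≤n⇒m≤1+n r)) (λ b → q (false ∷ b)) b
  wedge-closed {P = P} {B} {Q} Q-0 Q-sub Q-* (suc m) ρ ω p q (true ∷ b) = Q-sub (Q-* (p m ℕ.≤-refl) (q (false ∷ b)))
    (wedge-closed {P = P} {B} {Q} Q-0 Q-sub Q-* m ρ _ (λ j r → p j (ℕ.m≤n⇒m≤1+n r)) (λ b → q (true ∷ b)) b)

module FlaggedSchur {c ℓ : Level} (R : CommutativeRing c ℓ) (x : ℕ → CommutativeRing.Carrier R) where
  open CommutativeRing R hiding (zero)
  open RingTools R
  open PowerSeries R
  open SymmetricFunctions R x
  open Exterior R hiding (unit)

  -- row λ t p j is h_(λ-t+j)(x 0, …, x (p - 1)), which is 0 when λ + j < t.
  row : ℕ → ℕ → ℕ → Series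
  row λ′ zero p j = H (λ′ ℕ.+ j) p
  row (suc λ′) (suc t) p j = row λ′ t p j
  row zero (suc t) p zero = 0#
  row zero (suc t) p (suc j) = row zero t p j

  -- A list of pairs (q , λ): the parts λ of a partition with their positions q, the last part coming first.
  rows : List (ℕ × ℕ) → List Series
  rows [] = []
  rows ((q , λ′) ∷ rs) = row λ′ (length rs) (suc q) ∷ rows rs

  rows-length : ∀ rs → length (rows rs) ≡ length rs
  rows-length [] = ≡.refl
  rows-length (r ∷ rs) = cong suc (rows-length rs)

  -- A row depends on the number of parts after it in the list, so the rows of a prefix need the
  -- count `t` of the parts split off.
  rows⁺ : List (ℕ × ℕ) → ℕ → List Series
  rows⁺ [] t = []
  rows⁺ ((q , λ′) ∷ rs) t = row λ′ (length rs ℕ.+ t) (suc q) ∷ rows⁺ rs t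

  rows-++ : ∀ rs rs' → rows (rs ++ rs') ≡ rows⁺ rs (length rs') ++ rows rs'
  rows-++ [] rs' = ≡.refl
  rows-++ ((q , λ′) ∷ rs) rs' =
    cong₂ _∷_ (cong (λ z → row λ′ z (suc q)) (List.length-++ rs)) (rows-++ rs rs')

  schur : List (ℕ × ℕ) → Carrier
  schur rs = det (length rs) (rows rs)

  module _ {p : Level} {I : Carrier → Set p} (isIdeal : IsIdeal R I) where
    open IsIdeal isIdeal

    -- With d = λ - t + m the pairing is the sum of the `N l n` times h_(d-l), cut off at l ≤ m. If
    -- λ ≥ t, the terms cut off have `N l n` in `I`; if λ < t, then d < m and the additional entries
    -- are the zeros at the start of the row.
    row-pairing : ∀ n p λ′ t m d → t ≤ m → d ℕ.+ t ≡ λ′ ℕ.+ m → (∀ l → m < l → I (N l n)) →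
      I (S p n d - conv (λ l → N l n) (row λ′ t p) m)
    row-pairing n p λ′ zero m d q r h with ≡.trans (≡.sym (ℕ.+-identityʳ d)) r
    ... | ≡.refl = I-conv-truncate _ m h λ′ (λ i → H i p)
    row-pairing n p (suc λ′) (suc t) m d q r h =
      row-pairing n p λ′ t m d (ℕ.≤-trans (ℕ.n≤1+n t) q) (ℕ.suc-injective (≡.trans (≡.sym (ℕ.+-suc d t)) r)) h
    row-pairing n p zero (suc t) m d q r h with r
    ... | ≡.refl = I-≈0 (zero-sub (sym (exact d (suc t))))
      where
      exact : ∀ d t → conv (λ l → N l n) (row zero t p) (d ℕ.+ t) ≈ S p n d
      exact d zero rewrite ℕ.+-identityʳ d = refl
      exact d (suc t) rewrite ℕ.+-suc d t =
        trans (conv-last _ _ (d ℕ.+ t)) (trans (+-cong (exact d t) (zeroʳ _)) (+-identityʳ _))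

  data Initial : List (ℕ × ℕ) → Set where
    [] : Initial []
    _∷_ : ∀ {rs} λ′ → Initial rs → Initial ((length rs , λ′) ∷ rs)

  -- Pairing with (-1)^l e_l(x_0, ..., x_(m-1)) turns the row at position p into h_d of {x_0, ...,
  -- x_p} minus {x_0, ..., x_(m-1)}. For p = m this is a power of x_m; for p < m the degree exceeds
  -- the number m - p - 1 of removed letters, so it is 0.
  schur-initial : ∀ λ′ {rs} → Initial rs → schur ((length rs , λ′) ∷ rs) ≈ pow (x (length rs)) λ′ * schur rs
  schur-initial λ′ {rs} i = trans
    (det-triangular m (λ l → N l m) _ (rows rs) (rows-length rs) refl (orthogonal i (ℕ.≤-refl)))
    (*-congʳ (trans (pairing-conv m _ _) (trans (sym (sub-zero (row-pairing zeroIdeal m (suc m) λ′ m m λ′ ℕ.≤-refl ≡.refl (N-vanish m))))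
      (S-power m λ′))))
    where
    m = length rs
    orthogonal : ∀ {rs'} → Initial rs' → length rs' ≤ m →
      All (λ ρ → pairing (suc m) (λ l → N l m) ρ ≈ 0#) (rows rs')
    orthogonal [] le = []
    orthogonal (_∷_ {rs'} μ i) le = trans (pairing-conv m _ _)
        (trans (sym (sub-zero (row-pairing zeroIdeal m (suc t) μ t m (μ ℕ.+ (m ℕ.∸ t)) (ℕ.<⇒≤ le) eq (N-vanish m))))
          (subst (λ z → S (suc t) z (μ ℕ.+ (m ℕ.∸ t)) ≈ 0#) (ℕ.m∸n+n≡m le) (S-vanish (m ℕ.∸ suc t) (suc t) _ lt)))
      ∷ orthogonal i (ℕ.<⇒≤ le)
      where
      t = length rs'
      eq : μ ℕ.+ (m ℕ.∸ t) ℕ.+ t ≡ μ ℕ.+ m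
      eq = ≡.trans (ℕ.+-assoc μ _ t) (cong (μ ℕ.+_) (ℕ.m∸n+n≡m (ℕ.<⇒≤ le)))
      lt : m ℕ.∸ suc t < μ ℕ.+ (m ℕ.∸ t)
      lt = ℕ.<-≤-trans (ℕ.∸-monoʳ-< {m} ℕ.≤-refl le) (ℕ.m≤n+m _ μ)

  -- With t = `length rs` the equation says λ - t = k - q: the row at position q consists of the
  -- h_(k-q+j)(x_0, ..., x_q), whatever its index.
  data Fitting (k n : ℕ) : List (ℕ × ℕ) → Set where
    [] : Fitting k n []
    add : ∀ {q λ′ rs} → λ′ ℕ.+ q ≡ k ℕ.+ length rs → q < n → Fitting k n rs → Fitting k n ((q , λ′) ∷ rs)

  -- In the last column, m = n - k, the row at position q has degree n - q, one more than the number
  -- of variables outside x_0, ..., x_q. Hence the full alternating sum vanishes for every row, and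
  -- only terms with l > m, which lie in `I`, separate it from the pairing.
  schur-fitting : ∀ {p} {I : Carrier → Set p} → IsIdeal R I → ∀ k n m {rs} → k ℕ.+ m ≡ n →
    (∀ l → m < l → I (N l n)) → Fitting k n rs → length rs ≡ suc m → I (schur rs)
  schur-fitting {I = I} isIdeal k n m {rs} ≡.refl h f l rewrite l =
    det-ideal isIdeal m (λ l → N l n) (rows rs) (≡.trans (rows-length rs) l) refl
      (orthogonal f (ℕ.≤-reflexive l))
    where
    open IsIdeal isIdeal
    orthogonal : ∀ {rs'} → Fitting k n rs' → length rs' ≤ suc m →
      All (λ ρ → I (pairing (suc m) (λ l → N l n) ρ)) (rows rs')
    orthogonal [] le = []
    orthogonal (add {q} {μ} {rs'} e lt f) (s≤s le) = I-cong
        (trans (solve 2 (λ a b → a :- (a :- b) := b) refl _ _) (sym (pairing-conv m _ _)))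
        (I-sub
          (I-≈0 (subst (λ z → S (suc q) z (n ℕ.∸ q) ≈ 0#) (ℕ.m∸n+n≡m lt) (S-vanish (n ℕ.∸ suc q) (suc q) _ (ℕ.∸-monoʳ-< {n} ℕ.≤-refl lt))))
          (row-pairing isIdeal n (suc q) μ t m (n ℕ.∸ q) le eq h))
      ∷ orthogonal f (ℕ.m≤n⇒m≤1+n le)
      where
      t = length rs'
      open ≡.≡-Reasoning
      eq : n ℕ.∸ q ℕ.+ t ≡ μ ℕ.+ m
      eq = ℕ.+-cancelʳ-≡ q _ _ (begin
        n ℕ.∸ q ℕ.+ t ℕ.+ q ≡⟨ ≡.trans (ℕ.+-assoc (n ℕ.∸ q) t q) (≡.trans (cong (n ℕ.∸ q ℕ.+_) (ℕ.+-comm t q)) (≡.sym (ℕ.+-assoc (n ℕ.∸ q) q t))) ⟩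
        n ℕ.∸ q ℕ.+ q ℕ.+ t ≡⟨ cong (ℕ._+ t) (ℕ.m∸n+n≡m (ℕ.<⇒≤ lt)) ⟩
        k ℕ.+ m ℕ.+ t ≡⟨ ≡.trans (ℕ.+-assoc k m t) (≡.trans (cong (k ℕ.+_) (ℕ.+-comm m t)) (≡.sym (ℕ.+-assoc k t m))) ⟩
        k ℕ.+ t ℕ.+ m ≡⟨ cong (ℕ._+ m) e ⟨
        μ ℕ.+ q ℕ.+ m ≡⟨ ≡.trans (ℕ.+-assoc μ q m) (≡.trans (cong (μ ℕ.+_) (ℕ.+-comm q m)) (≡.sym (ℕ.+-assoc μ m q))) ⟩
        μ ℕ.+ m ℕ.+ q ∎)

-- The generators and the ideals in terms of coefficients

module Generators {c ℓ : Level} (F : Field c ℓ) where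
  open Field F hiding (zero)
  open PolynomialRing F

  indicator : Bool → Carrier
  indicator b = if b then 1# else 0#

  -- The offset o accounts for the variables already stripped off in a recursion on the number of variables.
  h-coeff e-coeff : ℕ → ℕ → ℕ → ∀ {n} → Poly F n
  h-coeff o d j m = indicator ((o ℕ.+ deg m ℕ.≡ᵇ d) ∧ onlyFirst j m)
  e-coeff o d j m = indicator ((o ℕ.+ deg m ℕ.≡ᵇ d) ∧ (squarefree m ∧ onlyFirst j m))

  indicator-≡ : ∀ {b b'} → b ≡ b' → indicator b ≈ indicator b'
  indicator-≡ p = reflexive (cong indicator p)

  indicator-∧-false : ∀ b {b'} → b' ≡ false → indicator (b ∧ b') ≈ 0#
  indicator-∧-false b ≡.refl = indicator-≡ (Bool.∧-zeroʳ b)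

  shift-zero : ∀ n j m → shift n j (λ _ → 0#) m ≈ 0#
  shift-zero zero j m = refl
  shift-zero (suc n) zero (zero ∷ m) = refl
  shift-zero (suc n) zero (suc _ ∷ m) = refl
  shift-zero (suc n) (suc j) (x ∷ m) = shift-zero n j m

  h-recursion : ∀ n j o d m → j < n →
    h-coeff o (suc d) (suc j) m ≈ h-coeff o (suc d) j m + shift n j (h-coeff o d (suc j)) m
  h-recursion (suc n) zero o d (zero ∷ m) p = sym (+-identityʳ _)
  h-recursion (suc n) zero o d (suc x ∷ m) p =
    trans (indicator-≡ (cong (λ z → (z ℕ.≡ᵇ suc d) ∧ onlyFirst 0 m) (ℕ.+-suc o (x ℕ.+ deg m))))
      (sym (trans (+-congʳ (indicator-∧-false _ ≡.refl)) (+-identityˡ _)))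
  h-recursion (suc n) (suc j) o d (x ∷ m) (s≤s p) =
    trans (assoc (suc d) (suc j) m) (trans (h-recursion n j (o ℕ.+ x) d m p)
      (sym (+-cong (assoc (suc d) j m) (shift-cong n j (assoc d (suc j)) m))))
    where
    assoc : ∀ d j (m : Mono n) → h-coeff o d (suc j) (x ∷ m) ≈ h-coeff (o ℕ.+ x) d j m
    assoc d j m = indicator-≡ (cong (λ z → (z ℕ.≡ᵇ d) ∧ onlyFirst j m) (≡.sym (ℕ.+-assoc o x (deg m))))

  e-recursion : ∀ n j o d m → j < n →
    e-coeff o (suc d) (suc j) m ≈ e-coeff o (suc d) j m + shift n j (e-coeff o d j) m
  e-recursion (suc n) zero o d (zero ∷ m) p = sym (+-identityʳ _)
  e-recursion (suc n) zero o d (suc zero ∷ m) p =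
    trans (indicator-≡ (cong (λ z → (z ℕ.≡ᵇ suc d) ∧ (squarefree m ∧ onlyFirst 0 m)) (ℕ.+-suc o (deg m))))
      (sym (trans (+-congʳ (indicator-∧-false (o ℕ.+ suc (deg m) ℕ.≡ᵇ suc d) (Bool.∧-zeroʳ (squarefree m)))) (+-identityˡ _)))
  e-recursion (suc n) zero o d (suc (suc x) ∷ m) p =
    trans (indicator-∧-false (o ℕ.+ deg (suc (suc x) ∷ m) ℕ.≡ᵇ suc d) ≡.refl)
      (sym (+-zero (indicator-∧-false (o ℕ.+ deg (suc (suc x) ∷ m) ℕ.≡ᵇ suc d) ≡.refl)
                   (indicator-∧-false (o ℕ.+ deg (suc x ∷ m) ℕ.≡ᵇ d) (Bool.∧-zeroʳ (squarefree (suc x ∷ m))))))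
  e-recursion (suc n) (suc j) o d (zero ∷ m) (s≤s p) = e-recursion n j o d m p
  e-recursion (suc n) (suc j) o d (suc zero ∷ m) (s≤s p) =
    trans (assoc (suc d) (suc j) m) (trans (e-recursion n j (suc o) d m p)
      (sym (+-cong (assoc (suc d) j m) (shift-cong n j (assoc d j) m))))
    where
    assoc : ∀ d j (m : Mono n) → e-coeff o d (suc j) (1 ∷ m) ≈ e-coeff (suc o) d j m
    assoc d j m = indicator-≡ (cong (λ z → (z ℕ.≡ᵇ d) ∧ (squarefree m ∧ onlyFirst j m)) (ℕ.+-suc o (deg m)))
  e-recursion (suc n) (suc j) o d (suc (suc x) ∷ m) (s≤s p) =
    trans (absent (suc d) (suc j) m) (sym (+-zero (absent (suc d) j m)
      (trans (shift-cong n j (absent d j) m) (shift-zero n j m))))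
    where
    absent : ∀ d j (m : Mono n) → e-coeff o d (suc j) (suc (suc x) ∷ m) ≈ 0#
    absent d j m = indicator-∧-false (o ℕ.+ deg (suc (suc x) ∷ m) ℕ.≡ᵇ d) ≡.refl

  onlyFirst-0 : ∀ {n} (m : Mono n) → onlyFirst 0 m ≡ true → deg m ≡ 0
  onlyFirst-0 [] p = ≡.refl
  onlyFirst-0 (zero ∷ m) p = onlyFirst-0 m p

  onlyFirst-all : ∀ {n} (m : Mono n) → onlyFirst n m ≡ true
  onlyFirst-all [] = ≡.refl
  onlyFirst-all (x ∷ m) = onlyFirst-all m

  h-none : ∀ {n} d (m : Mono n) → h-coeff 0 (suc d) 0 m ≈ 0#
  h-none d m with onlyFirst 0 m in eq
  ... | false = indicator-≡ (Bool.∧-zeroʳ _)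
  ... | true rewrite onlyFirst-0 m eq = refl

  e-none : ∀ {n} d (m : Mono n) → e-coeff 0 (suc d) 0 m ≈ 0#
  e-none d m with onlyFirst 0 m in eq
  ... | false = indicator-∧-false (deg m ℕ.≡ᵇ suc d) (Bool.∧-zeroʳ _)
  ... | true rewrite onlyFirst-0 m eq = refl

  h-zero : ∀ {n} j (m : Mono n) → h-coeff 0 0 j m ≈ one n m
  h-zero j [] = refl
  h-zero zero (zero ∷ m) = h-zero zero m
  h-zero (suc j) (zero ∷ m) = h-zero j m
  h-zero j (suc x ∷ m) = refl

  e-zero : ∀ {n} j (m : Mono n) → e-coeff 0 0 j m ≈ one n m
  e-zero j [] = refl
  e-zero zero (zero ∷ m) = e-zero zero m
  e-zero (suc j) (zero ∷ m) = e-zero j m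
  e-zero j (suc x ∷ m) = refl

  shift-finSupp : ∀ n j {f} → FinSupp F n f → FinSupp F n (shift n j f)
  shift-finSupp n j {f} (D , p) = suc D , vanish n j f 0 D p
    where
    vanish : ∀ n j f o D → (∀ m → D < o ℕ.+ deg m → f m ≈ 0#) → ∀ m → suc D < o ℕ.+ deg m → shift n j f m ≈ 0#
    vanish zero j f o D p m q = refl
    vanish (suc n) zero f o D p (zero ∷ m) q = refl
    vanish (suc n) zero f o D p (suc x ∷ m) q =
      p (x ∷ m) (ℕ.≤-pred (subst (suc (suc D) ≤_) (ℕ.+-suc o (x ℕ.+ deg m)) q))
    vanish (suc n) (suc j) f o D p (x ∷ m) q =
      vanish n j (slice f x) (o ℕ.+ x) D
        (λ m r → p (x ∷ m) (subst (D <_) (ℕ.+-assoc o x (deg m)) r)) m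
        (subst (suc D <_) (≡.sym (ℕ.+-assoc o x (deg m))) q)

  monomial≈variable′ : ∀ n j → j < n → monomial F n (single n j 1) ≈ₚ variable′ n j
  monomial≈variable′ n j p m = go n j p m
    where
    slice-≡ : ∀ {n} x (a m : Mono n) → monomial F (suc n) (x ∷ a) (x ∷ m) ≈ monomial F n a m
    slice-≡ x a m = decide (≡-dec ℕ._≟_ a m)
      where
      decide : Dec (a ≡ m) → _ ≈ _
      decide (yes p) = trans (monomial-≡ (cong (x ∷_) p)) (sym (monomial-≡ p))
      decide (no p) = trans (monomial-≢ {a = x ∷ a} {x ∷ m} (λ q → p (cong Vec.tail q))) (sym (monomial-≢ p))
    slice-≢ : ∀ {n} x y (a m : Mono n) → x ≢ y → monomial F (suc n) (x ∷ a) (y ∷ m) ≈ 0#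
    slice-≢ x y a m p = monomial-≢ {a = x ∷ a} {y ∷ m} (λ q → p (cong Vec.head q))
    go : ∀ n j → j < n → monomial F n (single n j 1) ≈ₚ variable′ n j
    go (suc n) zero p (zero ∷ m) = slice-≢ 1 0 (Vec.replicate n 0) m λ ()
    go (suc n) zero p (suc zero ∷ m) =
      trans (slice-≡ 1 (Vec.replicate n 0) m) (sym (Polynomials.one≈monomial F n m))
    go (suc n) zero p (suc (suc x) ∷ m) = slice-≢ 1 (suc (suc x)) (Vec.replicate n 0) m λ ()
    go (suc n) (suc j) (s≤s p) (zero ∷ m) = trans (slice-≡ 0 (single n j 1) m) (go n j p m)
    go (suc n) (suc j) (s≤s p) (suc x ∷ m) =
      trans (slice-≢ 0 (suc x) (single n j 1) m λ ()) (sym (shift-zero n j m))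

  var≈variable′ : ∀ n i → var F n i ≈ₚ variable′ n (toℕ i)
  var≈variable′ n i m = trans (reflexive (cong (λ a → monomial F n a m) (unitVector n i)))
    (monomial≈variable′ n (toℕ i) (Fin.toℕ<n i) m)
    where
    constant : ∀ n → Vec.tabulate {n = n} (λ _ → 0) ≡ Vec.replicate n 0
    constant zero = ≡.refl
    constant (suc n) = cong (0 ∷_) (constant n)
    unitVector : ∀ n i → Vec.tabulate (λ j → if does (i Fin.≟ j) then 1 else 0) ≡ single n (toℕ i) 1
    unitVector (suc n) zero = cong (1 ∷_) (constant n)
    unitVector (suc n) (suc i) = cong (0 ∷_) (unitVector n i)

module Ideals {c ℓ : Level} (F : Field c ℓ) (n : ℕ) where
  open Field F hiding (zero)
  open PolynomialRing F public
  open Polynomials F n public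
  open Generators F public
  private module P = CommutativeRing (polyRing n)

  x : ℕ → Finite
  x j = variable′ n j , shift-finSupp n j (proj₂ (CommutativeRing.1# finiteRing))

  open SymmetricFunctions finiteRing x public

  h≈H : ∀ d j → j ≤ n → h F n d j ≈ₚ proj₁ (H d j)
  h≈H zero j p m = h-zero j m
  h≈H (suc d) zero p m = h-none d m
  h≈H (suc d) (suc j) p m = trans (h-recursion n j 0 d m p)
    (+-cong (h≈H (suc d) j (ℕ.<⇒≤ p) m)
      (trans (shift-cong n j (h≈H d (suc j) p) m) (sym (mul-variable n j (proj₁ (H d (suc j))) m))))

  e≈E : ∀ d → e F n d ≈ₚ proj₁ (E d n)
  e≈E d m = trans (indicator-≡ (cong ((deg m ℕ.≡ᵇ d) ∧_)
      (≡.trans (≡.sym (Bool.∧-identityʳ (squarefree m))) (cong (squarefree m ∧_) (≡.sym (onlyFirst-all m))))))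
    (e-coeff≈E d n ℕ.≤-refl m)
    where
    e-coeff≈E : ∀ d j → j ≤ n → e-coeff 0 d j ≈ₚ proj₁ (E d j)
    e-coeff≈E zero j p m = e-zero j m
    e-coeff≈E (suc d) zero p m = e-none d m
    e-coeff≈E (suc d) (suc j) p m = trans (e-recursion n j 0 d m p)
      (+-cong (e-coeff≈E (suc d) j (ℕ.<⇒≤ p) m)
        (trans (shift-cong n j (e-coeff≈E d j (ℕ.<⇒≤ p)) m) (sym (mul-variable n j (proj₁ (E d j)) m))))

  module _ {p : Level} (P : Poly F n → Set p) where
    private
      term : Poly F n × Poly F n → Poly F n
      term (a , g) = _*p_ F n a g

      sum-++ : ∀ xs ys → sumP F n (List.map term (xs ++ ys)) ≈ₚ
                         (λ m → sumP F n (List.map term xs) m + sumP F n (List.map term ys) m)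
      sum-++ [] ys m = sym (+-identityˡ _)
      sum-++ (x ∷ xs) ys m = trans (+-congˡ (sum-++ xs ys m)) (sym (+-assoc _ _ _))

      sum-scale : ∀ a xs → mul n a (sumP F n (List.map term xs)) ≈ₚ
                           sumP F n (List.map term (List.map (λ { (b , g) → mul n a b , g }) xs))
      sum-scale a [] m = P.zeroʳ a m
      sum-scale a ((b , g) ∷ xs) m = trans (P.distribˡ a (term (b , g)) _ m)
        (+-cong (trans (P.*-congˡ {a} (*p≈mul n b g) m)
                  (trans (sym (P.*-assoc a b g m)) (sym (*p≈mul n (mul n a b) g m))))
                (sum-scale a xs m))

    inIdeal-cong : ∀ {f g} → f ≈ₚ g → InIdeal F n P f → InIdeal F n P g
    inIdeal-cong p (L , q , r) = L , q , λ m → trans (sym (p m)) (r m)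

    inIdeal-+ : ∀ {f g} → InIdeal F n P f → InIdeal F n P g → InIdeal F n P (λ m → f m + g m)
    inIdeal-+ (L , q , r) (L' , q' , r') =
      L ++ L' , All.++⁺ q q' , λ m → trans (+-cong (r m) (r' m)) (sym (sum-++ L L' m))

    inIdeal-* : ∀ {a f} → FinSupp F n a → InIdeal F n P f → InIdeal F n P (mul n a f)
    inIdeal-* {a} s (L , q , r) =
      _ , All.map⁺ (All.map (λ { (t , u) → finSupp-mul s t , u }) q) ,
      λ m → trans (P.*-congˡ {a} r m) (sum-scale a L m)

    inIdeal-generator : ∀ {f} → P f → InIdeal F n P f
    inIdeal-generator {f} p = (one n , f) ∷ [] , (proj₂ (CommutativeRing.1# finiteRing) , p) ∷ [] ,
      λ m → sym (trans (+-identityʳ _) (trans (*p≈mul n (one n) f m) (mul-oneˡ n f m)))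

    inIdeal-isIdeal : IsIdeal finiteRing (λ f → InIdeal F n P (proj₁ f))
    inIdeal-isIdeal = record
      { I-cong = inIdeal-cong
      ; I-zero = [] , [] , λ m → refl
      ; I-+ = inIdeal-+
      ; I-* = λ a → inIdeal-* (proj₂ a) }

    -- Finite support of J, its stability under π_j and the vanishing of the base functional are all
    -- proved by this induction over a membership certificate.
    inIdeal-elim : ∀ {q} (Q : Poly F n → Set q) → (∀ {f g} → f ≈ₚ g → Q f → Q g) → Q (λ _ → 0#) →
      (∀ {f g} → Q f → Q g → Q (λ m → f m + g m)) →
      (∀ a g → FinSupp F n a → P g → Q (mul n a g)) → ∀ {f} → InIdeal F n P f → Q f
    inIdeal-elim Q Q-cong Q-zero Q-+ Q-gen (L , q , r) = Q-cong (λ m → sym (r m)) (go L q)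
      where
      go : ∀ L → All (λ { (a , g) → FinSupp F n a × P g }) L → Q (sumP F n (List.map term L))
      go [] [] = Q-zero
      go ((a , g) ∷ L) ((s , p) ∷ q) = Q-+ (Q-cong (λ m → sym (*p≈mul n a g m)) (Q-gen a g s p)) (go L q)

  module _ (k : ℕ) where
    J-isIdeal : IsIdeal finiteRing (λ f → J F n k (proj₁ f))
    J-isIdeal = inIdeal-isIdeal (Jgens F n k)

    open IsIdeal J-isIdeal

    H∈J : ∀ j → j < n → J F n k (proj₁ (H k (suc j)))
    H∈J j p = inIdeal-generator (Jgens F n k)
      (inj₁ (suc j , s≤s z≤n , p , λ m → sym (h≈H k (suc j) p m)))

    N∈J : ∀ d → n ℕ.∸ k ℕ.+ 1 ≤ d → J F n k (proj₁ (N d n))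
    N∈J d p with d ℕ.≤? n
    ... | yes q = N-from-E J-isIdeal d n
                    (inIdeal-generator (Jgens F n k) (inj₂ (d , p , q , λ m → sym (e≈E d m))))
    ... | no q = I-≈0 {N d n} (N-vanish n d (ℕ.≰⇒> q))

-- Exchange of two adjacent variables

-- `swapV` on adjacent positions in recursive form; when j + 1 is out of range it is the identity.
swapAt : ∀ {n} → ℕ → Mono n → Mono n
swapAt j [] = []
swapAt zero (p ∷ []) = p ∷ []
swapAt zero (p ∷ q ∷ m) = q ∷ p ∷ m
swapAt (suc j) (p ∷ m) = p ∷ swapAt j m

swapV≡swapAt : ∀ {n} (i i' : Fin n) → toℕ i' ≡ suc (toℕ i) → ∀ m → swapV i i' m ≡ swapAt (toℕ i) m
swapV≡swapAt zero (suc zero) p (x ∷ y ∷ m) = ≡.refl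
swapV≡swapAt (suc i) (suc i') p (x ∷ m) = cong (x ∷_) (swapV≡swapAt i i' (ℕ.suc-injective p) m)

deg-swapAt : ∀ {n} j (m : Mono n) → deg (swapAt j m) ≡ deg m
deg-swapAt j [] = ≡.refl
deg-swapAt zero (p ∷ []) = ≡.refl
deg-swapAt zero (p ∷ q ∷ m) =
  ≡.trans (≡.sym (ℕ.+-assoc q p (deg m))) (≡.trans (cong (ℕ._+ deg m) (ℕ.+-comm q p)) (ℕ.+-assoc p q (deg m)))
deg-swapAt (suc j) (p ∷ m) = cong (p ℕ.+_) (deg-swapAt j m)

onlyFirst-swapAt : ∀ {n} i j (m : Mono n) → j ≢ suc i → onlyFirst j (swapAt i m) ≡ onlyFirst j m
onlyFirst-swapAt i j [] p = ≡.refl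
onlyFirst-swapAt zero j (x ∷ []) p = ≡.refl
onlyFirst-swapAt zero zero (x ∷ y ∷ m) p =
  ≡.trans (≡.sym (Bool.∧-assoc (y ℕ.≡ᵇ 0) (x ℕ.≡ᵇ 0) _))
    (≡.trans (cong (_∧ onlyFirst 0 m) (Bool.∧-comm (y ℕ.≡ᵇ 0) (x ℕ.≡ᵇ 0))) (Bool.∧-assoc (x ℕ.≡ᵇ 0) (y ℕ.≡ᵇ 0) _))
onlyFirst-swapAt zero (suc zero) (x ∷ y ∷ m) p = ⊥-elim (p ≡.refl)
onlyFirst-swapAt zero (suc (suc j)) (x ∷ y ∷ m) p = ≡.refl
onlyFirst-swapAt (suc i) zero (x ∷ m) p = cong ((x ℕ.≡ᵇ 0) ∧_) (onlyFirst-swapAt i zero m (λ ()))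
onlyFirst-swapAt (suc i) (suc j) (x ∷ m) p = onlyFirst-swapAt i j m (λ q → p (cong suc q))

squarefree-swapAt : ∀ {n} i (m : Mono n) → squarefree (swapAt i m) ≡ squarefree m
squarefree-swapAt i [] = ≡.refl
squarefree-swapAt zero (x ∷ []) = ≡.refl
squarefree-swapAt zero (zero ∷ zero ∷ m) = ≡.refl
squarefree-swapAt zero (zero ∷ suc zero ∷ m) = ≡.refl
squarefree-swapAt zero (zero ∷ suc (suc y) ∷ m) = ≡.refl
squarefree-swapAt zero (suc zero ∷ zero ∷ m) = ≡.refl
squarefree-swapAt zero (suc zero ∷ suc zero ∷ m) = ≡.refl
squarefree-swapAt zero (suc zero ∷ suc (suc y) ∷ m) = ≡.refl
squarefree-swapAt zero (suc (suc x) ∷ zero ∷ m) = ≡.refl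
squarefree-swapAt zero (suc (suc x) ∷ suc zero ∷ m) = ≡.refl
squarefree-swapAt zero (suc (suc x) ∷ suc (suc y) ∷ m) = ≡.refl
squarefree-swapAt (suc i) (zero ∷ m) = squarefree-swapAt i m
squarefree-swapAt (suc i) (suc zero ∷ m) = squarefree-swapAt i m
squarefree-swapAt (suc i) (suc (suc x) ∷ m) = ≡.refl

module DoubleSeries {c ℓ : Level} (R : CommutativeRing c ℓ) where
  open CommutativeRing R hiding (zero)
  open RingTools R
  open PowerSeries R

  conv² : (ℕ → Series) → (ℕ → Series) → ℕ → ℕ → Carrier
  conv² f g zero q = conv (f 0) (g 0) q
  conv² f g (suc p) q = conv (f 0) (g (suc p)) q + conv² (λ i → f (suc i)) g p q

  conv²-column : ∀ f g p q → conv² f g p (suc q) ≈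
    conv (λ i → f i 0) (λ i → g i (suc q)) p + conv² (λ i j → f i (suc j)) g p q
  conv²-column f g zero q = refl
  conv²-column f g (suc p) q = trans (+-congˡ (conv²-column (λ i → f (suc i)) g p q)) (rearrange _ _ _ _)

  -- Two nested Cauchy sums are interchanged. Since `mul` treats the variables in a fixed order,
  -- this is what makes the swap of the first two multiplicative.
  conv²-transpose : ∀ f g p q → conv² f g p q ≈ conv² (λ i j → f j i) (λ i j → g j i) q p
  conv²-transpose f g zero zero = refl
  conv²-transpose f g (suc p) zero = +-congˡ (conv²-transpose (λ i → f (suc i)) g p zero)
  conv²-transpose f g p (suc q) = trans (conv²-column f g p q)
    (+-congˡ (conv²-transpose (λ i j → f i (suc j)) g p q))

module Symmetry {c ℓ : Level} (F : Field c ℓ) where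
  open Field F hiding (zero)
  open PolynomialRing F
  open Generators F

  swap : ∀ {n} → ℕ → Poly F n → Poly F n
  swap j f m = f (swapAt j m)

  mul-conv² : ∀ {n} f g p q (m : Mono n) →
    mul (suc (suc n)) f g (p ∷ q ∷ m) ≈ DoubleSeries.conv² (polyRing n) (λ i → slice (slice f i)) (λ i → slice (slice g i)) p q m
  mul-conv² {n} f g p q m = go (slice f) (slice g) p
    where
    go : ∀ f g p → PowerSeries.conv (polyRing (suc n)) f g p (q ∷ m) ≈
         DoubleSeries.conv² (polyRing n) (λ i → slice (f i)) (λ i → slice (g i)) p q m
    go f g zero = refl
    go f g (suc p) = +-congˡ (go (λ i → f (suc i)) g p)

  mul-swap : ∀ n j f g → mul n (swap j f) (swap j g) ≈ₚ swap j (mul n f g)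
  mul-swap zero j f g [] = refl
  mul-swap (suc zero) zero f g (p ∷ []) =
    mul-cong 1 {swap 0 f} {f} {swap 0 g} {g} (λ { (_ ∷ []) → refl }) (λ { (_ ∷ []) → refl }) (p ∷ [])
  mul-swap (suc (suc n)) zero f g (p ∷ q ∷ m) = trans (mul-conv² (swap 0 f) (swap 0 g) p q m)
    (trans (DoubleSeries.conv²-transpose (polyRing n) _ _ p q m) (sym (mul-conv² f g q p m)))
  mul-swap (suc n) (suc j) f g (x ∷ m) = go (slice f) (slice g) x
    where
    open PowerSeries (polyRing n) using (conv)
    go : ∀ f g x → conv (λ i → swap j (f i)) (λ i → swap j (g i)) x m ≈ conv f g x (swapAt j m)
    go f g zero = mul-swap n j (f 0) (g 0) m
    go f g (suc x) = +-cong (mul-swap n j (f 0) (g (suc x)) m) (go (λ i → f (suc i)) g x)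

  one-swap : ∀ n j → swap j (one n) ≈ₚ one n
  one-swap n j m = trans (sym (h-zero n (swapAt j m))) (trans (indicator-≡ (cong₂ (λ a b → (a ℕ.≡ᵇ 0) ∧ b)
    (deg-swapAt j m) (≡.trans (onlyFirst-all (swapAt j m)) (≡.sym (onlyFirst-all m))))) (h-zero n m))

  shift-swap : ∀ n j f → suc j < n → swap j (shift n (suc j) f) ≈ₚ shift n j (swap j f)
  shift-swap (suc (suc n)) zero f r (zero ∷ q ∷ m) = refl
  shift-swap (suc (suc n)) zero f r (suc p ∷ q ∷ m) = refl
  shift-swap (suc n) (suc j) f (s≤s r) (x ∷ m) = shift-swap n j (slice f x) r m
  shift-swap (suc zero) zero f (s≤s ()) m

  -- If x_j f = x_(j+1) f, the coefficients of f are constant along each antidiagonal in these two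
  -- exponents, and the one with exponent 0 of x_(j+1) is 0.
  shift-injective : ∀ n j f → suc j < n → shift n j f ≈ₚ shift n (suc j) f → ∀ m → f m ≈ 0#
  shift-injective (suc zero) zero f (s≤s ()) h m
  shift-injective (suc (suc n)) zero f r h (p ∷ q ∷ m) = go p q
    where
    go : ∀ p q → f (p ∷ q ∷ m) ≈ 0#
    go p zero = h (suc p ∷ 0 ∷ m)
    go p (suc q) = trans (h (suc p ∷ suc q ∷ m)) (go (suc p) q)
  shift-injective (suc n) (suc j) f (s≤s r) h (x ∷ m) = shift-injective n j (slice f x) r (λ m → h (x ∷ m)) m

  module _ (n : ℕ) where
    private module P = CommutativeRing (polyRing n)
    private module T = RingTools (polyRing n)

    gap : ℕ → Poly F n
    gap i = variable′ n i P.- variable′ n (suc i)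

    gap-cancel : ∀ i f g → suc i < n → mul n (gap i) f ≈ₚ mul n (gap i) g → f ≈ₚ g
    gap-cancel i f g r h = T.sub-zero {f} {g} (shift-injective n i (f P.- g) r λ m →
      trans (sym (mul-variable n i (f P.- g) m)) (trans (T.sub-zero {variable′ n i P.* (f P.- g)} {variable′ n (suc i) P.* (f P.- g)}
        (P.trans (T.solve 4 (λ x y f g → x T.:* (f T.:- g) T.:- y T.:* (f T.:- g) T.:= (x T.:- y) T.:* f T.:- (x T.:- y) T.:* g) P.refl
          (variable′ n i) (variable′ n (suc i)) f g) (T.zero-sub h)) m) (mul-variable n (suc i) (f P.- g) m)))

module SwapAction {c ℓ : Level} (F : Field c ℓ) (n : ℕ) where
  open Field F hiding (zero)
  open Symmetry F public
  open Ideals F n public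
  private module P = CommutativeRing finiteRing
  private module T = RingTools finiteRing

  swapFinite : ℕ → Finite → Finite
  swapFinite j (f , D , p) = swap j f , D , λ m q → p (swapAt j m) (subst (D <_) (≡.sym (deg-swapAt j m)) q)

  H-symmetric : ∀ i d j → j ≤ n → j ≢ suc i → swapFinite i (H d j) P.≈ H d j
  H-symmetric i d j p q m = trans (sym (h≈H d j p (swapAt i m))) (trans
    (indicator-≡ (cong₂ (λ a b → (a ℕ.≡ᵇ d) ∧ b) (deg-swapAt i m) (onlyFirst-swapAt i j m q)))
    (h≈H d j p m))

  E-symmetric : ∀ i d → swapFinite i (E d n) P.≈ E d n
  E-symmetric i d m = trans (sym (e≈E d (swapAt i m))) (trans
    (indicator-≡ (cong₂ (λ a b → (a ℕ.≡ᵇ d) ∧ b) (deg-swapAt i m) (squarefree-swapAt i m)))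
    (e≈E d m))

  H-gap : ∀ i d → suc i < n →
    (x i P.- x (suc i)) P.* H d (suc (suc i)) P.≈ x i P.* H d (suc i) P.+ (P.- x (suc i)) P.* swapFinite i (H d (suc i))
  H-gap i zero r = T.gap-one (x i) (x (suc i)) P.1# (swapFinite i P.1#) (λ m → sym (one-swap n i m))
  H-gap i (suc d) r = T.gap-step X Y A B A' λ m → trans
      (sym (H-symmetric i (suc d) (suc (suc i)) r (λ e → ℕ.1+n≢n (ℕ.suc-injective e)) m))
      (+-congˡ (swapped m))
    where
    X = x i
    Y = x (suc i)
    A = H (suc d) (suc i)
    B = H d (suc (suc i))
    A' = swapFinite i A
    swapped : swapFinite i (Y P.* B) P.≈ X P.* B
    swapped m = trans (sym (mul-swap n i (proj₁ Y) (proj₁ B) m)) (mul-cong n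
      (λ m → trans (shift-swap n i (one n) r m) (shift-cong n i (one-swap n i) m))
      (H-symmetric i d (suc (suc i)) r (λ e → ℕ.1+n≢n (ℕ.suc-injective e))) m)

-- Demazure characters

-- The positive entries of a with their positions (counted from q), the last one first, pushed onto rest.
parts : ∀ {n} → ℕ → Mono n → List (ℕ × ℕ) → List (ℕ × ℕ)
parts q [] rest = rest
parts q (zero ∷ a) rest = parts (suc q) a rest
parts q (suc d ∷ a) rest = parts (suc q) a ((q , suc d) ∷ rest)

parts-++ : ∀ {n} q (a : Mono n) rest → parts q a rest ≡ parts q a [] ++ rest
parts-++ q [] rest = ≡.refl
parts-++ q (zero ∷ a) rest = parts-++ (suc q) a rest
parts-++ q (suc d ∷ a) rest = ≡.trans (parts-++ (suc q) a _)
  (≡.trans (≡.sym (List.++-assoc (parts (suc q) a []) _ rest))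
    (cong (List._++ rest) (≡.sym (parts-++ (suc q) a ((q , suc d) ∷ [])))))

parts-bounds : ∀ {n} {ℓ : Level} (P : ℕ × ℕ → Set ℓ) q (a : Mono n) rest →
  (∀ r → q ≤ proj₁ r → proj₁ r < q ℕ.+ n → P r) → All P rest → All P (parts q a rest)
parts-bounds P q [] rest h p = p
parts-bounds {suc n} P q (zero ∷ a) rest h p =
  parts-bounds P (suc q) a rest (λ r u v → h r (ℕ.<⇒≤ u) (subst (proj₁ r <_) (≡.sym (ℕ.+-suc q n)) v)) p
parts-bounds {suc n} P q (suc d ∷ a) rest h p =
  parts-bounds P (suc q) a _ (λ r u v → h r (ℕ.<⇒≤ u) (subst (proj₁ r <_) (≡.sym (ℕ.+-suc q n)) v))
    (h (q , suc d) ℕ.≤-refl (ℕ.m<m+n q (s≤s z≤n)) ∷ p)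

-- The list starts with the last part, so this says that the positive entries weakly decrease from
-- left to right.
Increasing : List (ℕ × ℕ) → Set
Increasing rs = Linked _≤_ (List.map proj₂ rs)

-- xs and ys are the parts of two compositions differing by moving a part y from position j to j + 1.
record Split (N j y : ℕ) (xs ys : List (ℕ × ℕ)) : Set where
  field
    R L : List (ℕ × ℕ)
    xs-split : xs ≡ R ++ (suc j , y) ∷ L
    ys-split : ys ≡ R ++ (j , y) ∷ L
    R-bound : All (λ r → suc j < proj₁ r × proj₁ r < N) R
    L-bound : All (λ r → proj₁ r < j) L
    j-bound : suc j < N

parts-split : ∀ {n} q (a : Mono n) rest i i' → toℕ i' ≡ suc (toℕ i) → lookup a i ≡ 0 → ∀ {y} → lookup a i' ≡ suc y →
  All (λ r → proj₁ r < q) rest → Split (q ℕ.+ n) (q ℕ.+ toℕ i) (suc y) (parts q a rest) (parts q (swapAt (toℕ i) a) rest)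
parts-split {suc (suc n)} q (zero ∷ suc y ∷ a) rest zero (suc zero) p ≡.refl ≡.refl b
  rewrite ℕ.+-identityʳ q | ℕ.+-suc q (suc n) | ℕ.+-suc q n = record
  { R = parts (suc (suc q)) a [] ; L = rest
  ; xs-split = parts-++ (suc (suc q)) a _ ; ys-split = parts-++ (suc (suc q)) a _
  ; R-bound = parts-bounds _ (suc (suc q)) a [] (λ r u v → u , v) []
  ; L-bound = b
  ; j-bound = s≤s (s≤s (ℕ.m≤m+n q n)) }
parts-split q (zero ∷ zero ∷ a) rest zero (suc zero) p e () b
parts-split q (zero ∷ zero ∷ a) rest zero (suc (suc i')) () e e' b
parts-split {suc n} q (zero ∷ a) rest (suc i) (suc i') p e e' b
  rewrite ℕ.+-suc q (toℕ i) | ℕ.+-suc q n =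
  parts-split (suc q) a rest i i' (ℕ.suc-injective p) e e' (All.map ℕ.m≤n⇒m≤1+n b)
parts-split {suc n} q (suc d ∷ a) rest (suc i) (suc i') p e e' b
  rewrite ℕ.+-suc q (toℕ i) | ℕ.+-suc q n =
  parts-split (suc q) a _ i i' (ℕ.suc-injective p) e e' (ℕ.≤-refl ∷ All.map ℕ.m≤n⇒m≤1+n b)

parts-adjacent : ∀ {n} q (a : Mono n) rest i i' → toℕ i' ≡ suc (toℕ i) → ∀ {x y} →
  lookup a i ≡ suc x → lookup a i' ≡ suc y →
  ∃ λ R → ∃ λ L → ∃ λ j → parts q a rest ≡ R ++ (suc j , suc y) ∷ (j , suc x) ∷ L
parts-adjacent q (suc x ∷ suc y ∷ a) rest zero (suc zero) p ≡.refl ≡.refl =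
  parts (suc (suc q)) a [] , rest , q , parts-++ (suc (suc q)) a _
parts-adjacent q (suc x ∷ zero ∷ a) rest zero (suc zero) p e ()
parts-adjacent q (suc x ∷ zero ∷ a) rest zero (suc (suc i')) () e e'
parts-adjacent q (zero ∷ a) rest (suc i) (suc i') p e e' = parts-adjacent (suc q) a rest i i' (ℕ.suc-injective p) e e'
parts-adjacent q (suc d ∷ a) rest (suc i) (suc i') p e e' = parts-adjacent (suc q) a _ i i' (ℕ.suc-injective p) e e'

increasing-adjacent : ∀ R {r r' L} → Increasing (R ++ r ∷ r' ∷ L) → proj₂ r ≤ proj₂ r'
increasing-adjacent [] (p ∷ _) = p
increasing-adjacent (_ ∷ R) h = increasing-adjacent R (Linked.tail h)

increasing-split : ∀ {N j y xs ys} → Split N j y xs ys → Increasing xs → Increasing ys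
increasing-split {j = j} {y} s h = subst (Linked _≤_) (≡.trans (cong (List.map proj₂) xs-split)
  (≡.trans (List.map-++ proj₂ R _) (≡.trans (≡.sym (List.map-++ proj₂ R ((j , y) ∷ L)))
    (≡.sym (cong (List.map proj₂) ys-split))))) h
  where open Split s

-- Two adjacent positive entries never ascend under `Increasing`. The Demazure recursion therefore
-- only moves a part across a zero and never exchanges two parts.
ascent-gap : ∀ {n} (a : Mono n) i i' → toℕ i' ≡ suc (toℕ i) → lookup a i < lookup a i' → Increasing (parts 0 a []) →
  lookup a i ≡ 0
ascent-gap a i i' p lt h with lookup a i in e | lookup a i' in e'
... | zero | _ = ≡.refl
... | suc x | suc y with parts-adjacent 0 a [] i i' p e e'
...   | R , L , j , q = ⊥-elim (ℕ.<⇒≱ lt (increasing-adjacent R (subst Increasing q h)))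

-- The sum of the positions is the termination measure: undoing an ascent moves one part a single
-- place to the left.
weight : List (ℕ × ℕ) → ℕ
weight [] = 0
weight ((q , _) ∷ rs) = q ℕ.+ weight rs

weight-split : ∀ {N j y xs ys} → Split N j y xs ys → weight ys < weight xs
weight-split s rewrite Split.xs-split s | Split.ys-split s = go (Split.R s)
  where
  go : ∀ R {j y L} → weight (R ++ (j , y) ∷ L) < weight (R ++ (suc j , y) ∷ L)
  go [] = ℕ.≤-refl
  go ((q , _) ∷ R) = ℕ.+-monoʳ-< q (go R)

ascent-or-dominant : ∀ {n} (a : Mono n) →
  (∃ λ i → ∃ λ i' → toℕ i' ≡ suc (toℕ i) × lookup a i < lookup a i') ⊎
  (∀ (i j : Fin n) → i Fin.≤ j → lookup a j ≤ lookup a i)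
ascent-or-dominant [] = inj₂ λ ()
ascent-or-dominant (x ∷ []) = inj₂ λ { zero zero _ → ℕ.≤-refl }
ascent-or-dominant (x ∷ y ∷ a) with x ℕ.<? y | ascent-or-dominant (y ∷ a)
... | yes p | _ = inj₁ (zero , suc zero , ≡.refl , p)
... | no p | inj₁ (i , i' , q , r) = inj₁ (suc i , suc i' , cong suc q , r)
... | no p | inj₂ h = inj₂ λ
  { zero zero _ → ℕ.≤-refl
  ; zero (suc j) _ → ℕ.≤-trans (h zero j z≤n) (ℕ.≮⇒≥ p)
  ; (suc i) (suc j) (s≤s q) → h i j q }

partsMono : ∀ n → List (ℕ × ℕ) → Mono n
partsMono n [] = Vec.replicate n 0
partsMono n ((q , d) ∷ rs) = single n q d ⊕ partsMono n rs

partsMono-++ : ∀ n rs rs' → partsMono n (rs ++ rs') ≡ partsMono n rs ⊕ partsMono n rs'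
partsMono-++ n [] rs' = ≡.sym (⊕-identityˡ _)
partsMono-++ n ((q , d) ∷ rs) rs' =
  ≡.trans (cong (single n q d ⊕_) (partsMono-++ n rs rs')) (≡.sym (⊕-assoc (single n q d) _ _))

shiftPart : ℕ × ℕ → ℕ × ℕ
shiftPart (q , d) = suc q , d

partsMono-shift : ∀ n rs → partsMono (suc n) (List.map shiftPart rs) ≡ 0 ∷ partsMono n rs
partsMono-shift n [] = ≡.refl
partsMono-shift n ((q , d) ∷ rs) = cong ((0 ∷ single n q d) ⊕_) (partsMono-shift n rs)

parts-shift : ∀ {n} q (a : Mono n) rest → parts (suc q) a (List.map shiftPart rest) ≡ List.map shiftPart (parts q a rest)
parts-shift q [] rest = ≡.refl
parts-shift q (zero ∷ a) rest = parts-shift (suc q) a rest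
parts-shift q (suc d ∷ a) rest = parts-shift (suc q) a _

partsMono-parts : ∀ {n} (a : Mono n) → partsMono n (parts 0 a []) ≡ a
partsMono-parts [] = ≡.refl
partsMono-parts {suc n} (zero ∷ a) = ≡.trans (cong (partsMono (suc n)) (parts-shift 0 a []))
  (≡.trans (partsMono-shift n (parts 0 a [])) (cong (0 ∷_) (partsMono-parts a)))
partsMono-parts {suc n} (suc d ∷ a) = ≡.trans
  (cong (partsMono (suc n)) (≡.trans (parts-++ 1 a _) (cong (List._++ (0 , suc d) ∷ []) (parts-shift 0 a []))))
  (≡.trans (partsMono-++ (suc n) (List.map shiftPart (parts 0 a [])) _)
    (≡.trans (cong₂ _⊕_ (≡.trans (partsMono-shift n (parts 0 a [])) (cong (0 ∷_) (partsMono-parts a)))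
                          (⊕-identityʳ (suc d ∷ Vec.replicate n 0)))
      (cong (suc d ∷_) (⊕-identityʳ a))))

module KeyPolynomials {c ℓ : Level} (F : Field c ℓ) (n : ℕ) where
  open Field F hiding (zero)
  open SwapAction F n
  open FlaggedSchur finiteRing x
  open Exterior finiteRing using (wedges; wedges-linear; wedges-map; det)
  private module P = CommutativeRing finiteRing
  private module T = RingTools finiteRing

  row-symmetric : ∀ i λ′ t p j → p ≤ n → p ≢ suc i → row λ′ t p j P.≈ swapFinite i (row λ′ t p j)
  row-symmetric i λ′ zero p j r s m = sym (H-symmetric i (λ′ ℕ.+ j) p r s m)
  row-symmetric i (suc λ′) (suc t) p j r s = row-symmetric i λ′ t p j r s
  row-symmetric i zero (suc t) p zero r s m = refl
  row-symmetric i zero (suc t) p (suc j) r s = row-symmetric i zero t p j r s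

  row-gap : ∀ i λ′ t j → suc i < n → (x i P.- x (suc i)) P.* row λ′ t (suc (suc i)) j P.≈
    x i P.* row λ′ t (suc i) j P.+ (P.- x (suc i)) P.* swapFinite i (row λ′ t (suc i) j)
  row-gap i λ′ zero j r = H-gap i (λ′ ℕ.+ j) r
  row-gap i (suc λ′) (suc t) j r = row-gap i λ′ t j r
  row-gap i zero (suc t) zero r = T.gap-one (x i) (x (suc i)) P.0# (swapFinite i P.0#) (λ m → refl)
  row-gap i zero (suc t) (suc j) r = row-gap i zero t j r

  rows⁺-symmetric : ∀ i R t → All (λ r → suc i < proj₁ r × proj₁ r < n) R →
    Pointwise (λ ρ' ρ → ∀ j → ρ' j P.≈ swapFinite i (ρ j)) (rows⁺ R t) (rows⁺ R t)
  rows⁺-symmetric i [] t [] = []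
  rows⁺-symmetric i ((q , d) ∷ R) t ((u , v) ∷ b) =
    (λ j → row-symmetric i d (length R ℕ.+ t) (suc q) j v (λ e → ℕ.<-irrefl (≡.sym (ℕ.suc-injective e)) (ℕ.<⇒≤ u)))
    ∷ rows⁺-symmetric i R t b

  rows-symmetric : ∀ i L → i < n → All (λ r → proj₁ r < i) L →
    Pointwise (λ ρ' ρ → ∀ j → ρ' j P.≈ swapFinite i (ρ j)) (rows L) (rows L)
  rows-symmetric i [] r [] = []
  rows-symmetric i ((q , d) ∷ L) r (u ∷ b) =
    (λ j → row-symmetric i d (length L) (suc q) j (ℕ.<-trans u r) (λ e → ℕ.<-irrefl (ℕ.suc-injective e) u))
    ∷ rows-symmetric i L r b

  -- The alphabets of the rows from `R` contain both x_i and x_(i+1), those of the rows from `L`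
  -- contain neither, so the swap fixes these rows. Only the row of the moved part changes, by
  -- `row-gap`, and the determinant is linear in it.
  schur-split : ∀ i {y xs ys} → Split n i y xs ys →
    (x i P.- x (suc i)) P.* schur xs P.≈ x i P.* schur ys P.+ (P.- x (suc i)) P.* swapFinite i (schur ys)
  schur-split i {y} s rewrite Split.xs-split s | Split.ys-split s = go
    where
    open Split s using (R; L; R-bound; L-bound; j-bound)
    M = length (R ++ (i , y) ∷ L)
    same-length : length (R ++ (suc i , y) ∷ L) ≡ M
    same-length = ≡.trans (List.length-++ R) (≡.sym (List.length-++ R))
    t = length L
    ρ : ℕ → ℕ → Finite
    ρ p = row y t p
    ρ′ : ℕ → Finite
    ρ′ j = swapFinite i (ρ (suc i) j)
    R⁺ = rows⁺ R (suc t)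
    go : (x i P.- x (suc i)) P.* schur (R ++ (suc i , y) ∷ L) P.≈
      x i P.* schur (R ++ (i , y) ∷ L) P.+ (P.- x (suc i)) P.* swapFinite i (schur (R ++ (i , y) ∷ L))
    go rewrite same-length | rows-++ R ((suc i , y) ∷ L) | rows-++ R ((i , y) ∷ L) = P.trans
      {(x i P.- x (suc i)) P.* det M (R⁺ ++ ρ (suc (suc i)) ∷ rows L)}
      {x i P.* det M (R⁺ ++ ρ (suc i) ∷ rows L) P.+ (P.- x (suc i)) P.* det M (R⁺ ++ ρ′ ∷ rows L)}
      {x i P.* det M (R⁺ ++ ρ (suc i) ∷ rows L) P.+ (P.- x (suc i)) P.* swapFinite i (det M (R⁺ ++ ρ (suc i) ∷ rows L))}
      (wedges-linear M R⁺ {ρ (suc (suc i))} {ρ (suc i)} {ρ′} {x i P.- x (suc i)} {x i} {P.- x (suc i)} (rows L)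
        (λ j → row-gap i y t j j-bound) _)
      (P.+-congˡ {x i P.* det M (R⁺ ++ ρ (suc i) ∷ rows L)}
        {(P.- x (suc i)) P.* det M (R⁺ ++ ρ′ ∷ rows L)}
        {(P.- x (suc i)) P.* swapFinite i (det M (R⁺ ++ ρ (suc i) ∷ rows L))}
        (P.*-congˡ {P.- x (suc i)} {det M (R⁺ ++ ρ′ ∷ rows L)} {swapFinite i (det M (R⁺ ++ ρ (suc i) ∷ rows L))}
          (wedges-map (swapFinite i) (λ m → refl) (one-swap n i) (λ a b m → sym (mul-swap n i (proj₁ a) (proj₁ b) m))
            (λ a b m → refl) M
            (Pointwise.++⁺ (rows⁺-symmetric i R (suc t) R-bound)
              ((λ j m → refl) ∷ rows-symmetric i L (ℕ.<-trans ℕ.≤-refl j-bound) L-bound)) _)))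

  key : Mono n → Poly F n
  key a = proj₁ (schur (parts 0 a []))

  swapP≈swap : ∀ i i' g → toℕ i' ≡ suc (toℕ i) → swapP F n i i' g ≈ₚ swap (toℕ i) g
  swapP≈swap i i' g p m = reflexive (cong g (swapV≡swapAt i i' p m))

  variable-suc : ∀ (i i' : Fin n) → toℕ i' ≡ suc (toℕ i) → var F n i' ≈ₚ variable′ n (suc (toℕ i))
  variable-suc i i' p m = trans (var≈variable′ n i' m) (reflexive (cong (λ z → variable′ n z m) p))

  gap-var : ∀ i i' f → toℕ i' ≡ suc (toℕ i) →
    _*p_ F n (_-p_ F n (var F n i) (var F n i')) f ≈ₚ mul n (gap n (toℕ i)) f
  gap-var i i' f p m = trans (*p≈mul n _ f m)
    (mul-cong n {g = f} {f} (λ m → +-cong (var≈variable′ n i m) (-‿cong (variable-suc i i' p m))) (λ _ → refl) m)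

  demazure-side : ∀ i i' g → toℕ i' ≡ suc (toℕ i) →
    _-p_ F n (_*p_ F n (var F n i) g) (_*p_ F n (var F n i') (swapP F n i i' g)) ≈ₚ
    (λ m → mul n (variable′ n (toℕ i)) g m - mul n (variable′ n (suc (toℕ i))) (swap (toℕ i) g) m)
  demazure-side i i' g p m = +-cong
    (trans (*p≈mul n (var F n i) g m) (mul-cong n {g = g} {g} (var≈variable′ n i) (λ _ → refl) m))
    (-‿cong (trans (*p≈mul n (var F n i') (swapP F n i i' g) m) (mul-cong n {g = swapP F n i i' g} {swap (toℕ i) g} (variable-suc i i' p) (swapP≈swap i i' g p) m)))

  ascent-split : ∀ a i i' → toℕ i' ≡ suc (toℕ i) → lookup a i < lookup a i' → Increasing (parts 0 a []) →
    Split n (toℕ i) (lookup a i') (parts 0 a []) (parts 0 (swapV i i' a) [])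
  ascent-split a i i' p lt h = subst (λ b → Split n (toℕ i) (lookup a i') (parts 0 a []) (parts 0 b []))
    (≡.sym (swapV≡swapAt i i' p a))
    (subst (λ z → Split n (toℕ i) z (parts 0 a []) (parts 0 (swapAt (toℕ i) a) [])) (ℕ.suc-pred (lookup a i') {{ℕ.>-nonZero (ℕ.≤-<-trans z≤n lt)}})
      (parts-split 0 a [] i i' p (ascent-gap a i i' p lt h) (≡.sym (ℕ.suc-pred (lookup a i') {{ℕ.>-nonZero (ℕ.≤-<-trans z≤n lt)}})) []))

  key-gap : ∀ a i i' → toℕ i' ≡ suc (toℕ i) → lookup a i < lookup a i' → Increasing (parts 0 a []) →
    mul n (gap n (toℕ i)) (key a) ≈ₚ
    (λ m → mul n (variable′ n (toℕ i)) (key (swapV i i' a)) m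
         - mul n (variable′ n (suc (toℕ i))) (swap (toℕ i) (key (swapV i i' a))) m)
  key-gap a i i' p lt h m = trans (schur-split (toℕ i) (ascent-split a i i' p lt h) m) (+-congˡ
    (sym (-‿distribˡ-* (variable′ n (suc (toℕ i))) (swap (toℕ i) (key (swapV i i' a))) m)))
    where open import Algebra.Properties.Ring (CommutativeRing.ring (polyRing n)) using (-‿distribˡ-*)

  pow-monomial : ∀ q d → q < n → proj₁ (pow (x q) d) ≈ₚ monomial F n (single n q d)
  pow-monomial q zero r m = trans (one≈monomial m) (reflexive (cong (λ a → monomial F n a m) (≡.sym (single-0 n q))))
  pow-monomial q (suc d) r m = trans
    (mul-cong n (λ m → sym (monomial≈variable′ n q r m)) (pow-monomial q d r) m)
    (trans (monomial-⊕ (single n q 1) (single n q d) m) (reflexive (cong (λ a → monomial F n a m) (single-suc n q d))))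

  schur-Initial : ∀ {rs} → Initial rs → length rs ≤ n → proj₁ (schur rs) ≈ₚ monomial F n (partsMono n rs)
  schur-Initial [] le = one≈monomial
  schur-Initial (_∷_ {rs} d i) le m = trans (schur-initial d i m)
    (trans (mul-cong n (pow-monomial (length rs) d le) (schur-Initial i (ℕ.<⇒≤ le)) m)
      (monomial-⊕ (single n (length rs) d) (partsMono n rs) m))

  parts-zero : ∀ {n} q (a : Mono n) rest → (∀ i → lookup a i ≡ 0) → parts q a rest ≡ rest
  parts-zero q [] rest h = ≡.refl
  parts-zero q (zero ∷ a) rest h = parts-zero (suc q) a rest (λ i → h (suc i))
  parts-zero q (suc d ∷ a) rest h with h zero
  ... | ()

  parts-initial : ∀ {n} (a : Mono n) rest → Initial rest → (∀ i j → i Fin.≤ j → lookup a j ≤ lookup a i) →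
    Initial (parts (length rest) a rest)
  parts-initial [] rest i h = i
  parts-initial (zero ∷ a) rest i h =
    subst Initial (≡.sym (parts-zero (suc (length rest)) a rest (λ j → ℕ.n≤0⇒n≡0 (h zero (suc j) z≤n)))) i
  parts-initial (suc d ∷ a) rest i h = parts-initial a _ (suc d ∷ i) (λ u v w → h (suc u) (suc v) (s≤s w))

  parts-length : ∀ {n} q (a : Mono n) rest → length (parts q a rest) ≤ n ℕ.+ length rest
  parts-length q [] rest = ℕ.≤-refl
  parts-length q (zero ∷ a) rest = ℕ.m≤n⇒m≤1+n (parts-length (suc q) a rest)
  parts-length {suc n} q (suc d ∷ a) rest =
    subst (length (parts (suc q) a ((q , suc d) ∷ rest)) ≤_) (ℕ.+-suc n (length rest)) (parts-length (suc q) a _)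

  key-dominant : ∀ a → (∀ i j → i Fin.≤ j → lookup a j ≤ lookup a i) → key a ≈ₚ monomial F n a
  key-dominant a h m = trans
    (schur-Initial (parts-initial a [] [] h) (subst (length (parts 0 a []) ≤_) (ℕ.+-identityʳ n) (parts-length 0 a [])) m)
    (reflexive (cong (λ b → monomial F n b m) (partsMono-parts a)))

  -- `IsKappa` leaves the choice of the ascent open. The determinant satisfies the recursion at
  -- every ascent, so by induction on the derivation both sides agree after multiplication by x_i -
  -- x_(i+1), which is then cancelled.
  kappa-unique : ∀ {a f} → IsKappa F n a f → Increasing (parts 0 a []) → f ≈ₚ key a
  kappa-unique {a} (dominant h p) inc m = trans (p m) (sym (key-dominant a h m))
  kappa-unique {a} {f} (demazure {g = g} i i' p lt κ e) inc =
    gap-cancel n (toℕ i) f (key a) (Split.j-bound (ascent-split a i i' p lt inc)) λ m →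
      trans (sym (gap-var i i' f p m)) (trans (e m) (trans (demazure-side i i' g p m)
        (trans (+-cong (mul-cong n {variable′ n (toℕ i)} {variable′ n (toℕ i)} (λ _ → refl) g≈ m)
                       (-‿cong (mul-cong n {variable′ n (suc (toℕ i))} {variable′ n (suc (toℕ i))} (λ _ → refl) (λ m → g≈ (swapAt (toℕ i) m)) m)))
          (sym (key-gap a i i' p lt inc m)))))
    where
    g≈ : g ≈ₚ key (swapV i i' a)
    g≈ = kappa-unique κ (increasing-split (ascent-split a i i' p lt inc) inc)

  -- Needed to exhibit elements of `Gset`: any ascent may be chosen, and each step lowers `weight`.
  kappa-exists : ∀ a → Increasing (parts 0 a []) → IsKappa F n a (key a)
  kappa-exists a inc = go a inc (<-wellFounded (weight (parts 0 a [])))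
    where
    go : ∀ a → Increasing (parts 0 a []) → Acc _<_ (weight (parts 0 a [])) → IsKappa F n a (key a)
    go a inc (acc h) with ascent-or-dominant a
    ... | inj₂ d = dominant d (key-dominant a d)
    ... | inj₁ (i , i' , p , lt) = demazure i i' p lt
      (go (swapV i i' a) (increasing-split s inc) (h (weight-split s)))
      (λ m → trans (gap-var i i' (key a) p m) (trans (key-gap a i i' p lt inc m) (sym (demazure-side i i' (key (swapV i i' a)) p m))))
      where
      s = ascent-split a i i' p lt inc

-- Leading monomials of the determinants

NonTrivial : ∀ {n} → Mono n → Set
NonTrivial [] = ⊥
NonTrivial (x ∷ m) = 0 < x ⊎ NonTrivial m

-- For q < n the negation says that the monomial involves only x_0, ..., x_q and has degree less
-- than d in x_q. Being closed upwards for `≺`, the condition turns such degree bounds into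
-- statements about leading monomials.
Exceeds : ∀ {n} → ℕ → ℕ → Mono n → Set
Exceeds q d [] = ⊥
Exceeds zero d (x ∷ m) = d ≤ x ⊎ NonTrivial m
Exceeds (suc q) d (x ∷ m) = Exceeds q d m

nonTrivial-split : ∀ {n} (u v : Mono n) → NonTrivial (u ⊕ v) → NonTrivial u ⊎ NonTrivial v
nonTrivial-split [] [] ()
nonTrivial-split (zero ∷ u) (y ∷ v) (inj₁ p) = inj₂ (inj₁ p)
nonTrivial-split (suc x ∷ u) (y ∷ v) (inj₁ p) = inj₁ (inj₁ (s≤s z≤n))
nonTrivial-split (x ∷ u) (y ∷ v) (inj₂ p) with nonTrivial-split u v p
... | inj₁ q = inj₁ (inj₂ q)
... | inj₂ q = inj₂ (inj₂ q)

exceeds-split : ∀ {n} q d (u v : Mono n) → Exceeds q d (u ⊕ v) → Exceeds q d u ⊎ Exceeds q 1 v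
exceeds-split q d [] [] ()
exceeds-split zero d (x ∷ u) (zero ∷ v) (inj₁ p) = inj₁ (inj₁ (subst (d ≤_) (ℕ.+-identityʳ x) p))
exceeds-split zero d (x ∷ u) (suc y ∷ v) (inj₁ p) = inj₂ (inj₁ (s≤s z≤n))
exceeds-split zero d (x ∷ u) (y ∷ v) (inj₂ p) with nonTrivial-split u v p
... | inj₁ q = inj₁ (inj₂ q)
... | inj₂ q = inj₂ (inj₂ q)
exceeds-split (suc q) d (x ∷ u) (y ∷ v) p = exceeds-split q d u v p

nonTrivial-≺ : ∀ {n} {a b : Mono n} → a ≺ b → NonTrivial b
nonTrivial-≺ {a = []} {[]} ()
nonTrivial-≺ {a = x ∷ a} {y ∷ b} (inj₁ p) = inj₂ (nonTrivial-≺ p)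
nonTrivial-≺ {a = x ∷ a} {y ∷ b} (inj₂ (_ , p)) = inj₁ (ℕ.≤-<-trans z≤n p)

exceeds-≺ : ∀ {n} q d {a b : Mono n} → Exceeds q d a → a ≺ b → Exceeds q d b
exceeds-≺ zero d {x ∷ a} {y ∷ b} e (inj₁ p) = inj₂ (nonTrivial-≺ p)
exceeds-≺ zero d {x ∷ a} {y ∷ b} (inj₁ e) (inj₂ (≡.refl , p)) = inj₁ (ℕ.≤-trans e (ℕ.<⇒≤ p))
exceeds-≺ zero d {x ∷ a} {y ∷ b} (inj₂ e) (inj₂ (≡.refl , p)) = inj₂ e
exceeds-≺ (suc q) d {x ∷ a} {y ∷ b} e (inj₁ p) = exceeds-≺ q d e p
exceeds-≺ (suc q) d {x ∷ a} {y ∷ b} e (inj₂ (≡.refl , p)) = e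

exceeds-single : ∀ n q d (u : Mono n) → q < n → Exceeds q d (single n q d ⊕ u)
exceeds-single (suc n) zero d (x ∷ u) p = inj₁ (ℕ.m≤m+n d x)
exceeds-single (suc n) (suc q) d (x ∷ u) (s≤s p) = exceeds-single n q d u p

exceeds-weaken : ∀ {n} q d (m : Mono n) → Exceeds q (suc d) m → Exceeds q d m
exceeds-weaken zero d (x ∷ m) (inj₁ p) = inj₁ (ℕ.<⇒≤ p)
exceeds-weaken zero d (x ∷ m) (inj₂ p) = inj₂ p
exceeds-weaken (suc q) d (x ∷ m) p = exceeds-weaken q d m p

nonTrivial-onlyFirst : ∀ {n} (m : Mono n) → NonTrivial m → onlyFirst 0 m ≡ false
nonTrivial-onlyFirst (suc x ∷ m) p = ≡.refl
nonTrivial-onlyFirst (zero ∷ m) (inj₂ p) = nonTrivial-onlyFirst m p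

exceeds-onlyFirst : ∀ {n} q p (m : Mono n) → p ≤ q → Exceeds q 1 m → onlyFirst p m ≡ false
exceeds-onlyFirst zero zero (suc x ∷ m) r e = ≡.refl
exceeds-onlyFirst zero zero (zero ∷ m) r (inj₂ e) = nonTrivial-onlyFirst m e
exceeds-onlyFirst (suc q) zero (suc x ∷ m) r e = ≡.refl
exceeds-onlyFirst (suc q) zero (zero ∷ m) r e = exceeds-onlyFirst q zero m z≤n e
exceeds-onlyFirst (suc q) (suc p) (x ∷ m) (s≤s r) e = exceeds-onlyFirst q p m r e

exceeds-degree : ∀ {n} q d (m : Mono n) → Exceeds q d m → d ≤ deg m ⊎ onlyFirst (suc q) m ≡ false
exceeds-degree zero d (x ∷ m) (inj₁ p) = inj₁ (ℕ.≤-trans p (ℕ.m≤m+n x (deg m)))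
exceeds-degree zero d (x ∷ m) (inj₂ p) = inj₂ (nonTrivial-onlyFirst m p)
exceeds-degree (suc q) d (x ∷ m) p with exceeds-degree q d m p
... | inj₁ r = inj₁ (ℕ.≤-trans r (ℕ.m≤n+m (deg m) x))
... | inj₂ r = inj₂ r

deg-zero : ∀ n → deg (Vec.replicate n 0) ≡ 0
deg-zero zero = ≡.refl
deg-zero (suc n) = deg-zero n

deg-single : ∀ n q d → q < n → deg (single n q d) ≡ d
deg-single (suc n) zero d p = ≡.trans (cong (d ℕ.+_) (deg-zero n)) (ℕ.+-identityʳ d)
deg-single (suc n) (suc q) d (s≤s p) = deg-single n q d p

onlyFirst-zero : ∀ n → onlyFirst 0 (Vec.replicate n 0) ≡ true
onlyFirst-zero zero = ≡.refl
onlyFirst-zero (suc n) = onlyFirst-zero n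

onlyFirst-single : ∀ n q d → onlyFirst (suc q) (single n q d) ≡ true
onlyFirst-single zero q d = ≡.refl
onlyFirst-single (suc n) zero d = onlyFirst-zero n
onlyFirst-single (suc n) (suc q) d = onlyFirst-single n q d

single-≺ : ∀ n q d (m : Mono n) → q < n → single n q d ≺ m → d < deg m ⊎ onlyFirst (suc q) m ≡ false
single-≺ (suc n) zero d (x ∷ m) p (inj₁ r) = inj₂ (nonTrivial-onlyFirst m (nonTrivial-≺ r))
single-≺ (suc n) zero d (x ∷ m) p (inj₂ (≡.refl , r)) = inj₁ (ℕ.<-≤-trans r (ℕ.m≤m+n x _))
single-≺ (suc n) (suc q) d (x ∷ m) (s≤s p) (inj₁ r) with single-≺ n q d m p r
... | inj₁ s = inj₁ (ℕ.<-≤-trans s (ℕ.m≤n+m (deg m) x))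
... | inj₂ s = inj₂ s
single-≺ (suc n) (suc q) d (x ∷ m) (s≤s p) (inj₂ (≡.refl , r)) =
  inj₁ (subst (λ z → d < x ℕ.+ z) (≡.sym (deg-single n q d p)) (ℕ.m<n+m d r))

data Decreasing (n : ℕ) : List (ℕ × ℕ) → Set where
  [] : Decreasing n []
  add : ∀ {q d rs} → q < n → All (λ r → proj₁ r < q) rs → Decreasing n rs → Decreasing n ((q , d) ∷ rs)

parts-decreasing : ∀ {n N} q (a : Mono n) rest → q ℕ.+ n ≡ N → Decreasing N rest → All (λ r → proj₁ r < q) rest →
  Decreasing N (parts q a rest)
parts-decreasing q [] rest e h b = h
parts-decreasing {suc n} q (zero ∷ a) rest e h b =
  parts-decreasing (suc q) a rest (≡.trans (≡.sym (ℕ.+-suc q n)) e) h (All.map ℕ.m≤n⇒m≤1+n b)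
parts-decreasing {suc n} q (suc d ∷ a) rest e h b =
  parts-decreasing (suc q) a _ (≡.trans (≡.sym (ℕ.+-suc q n)) e)
    (add (subst (q <_) e (ℕ.m<m+n q (s≤s z≤n))) b h)
    (ℕ.≤-refl ∷ All.map ℕ.m≤n⇒m≤1+n b)

module LeadingMonomials {c ℓ : Level} (F : Field c ℓ) (n : ℕ) where
  open Field F hiding (zero)
  open Ideals F n
  open FlaggedSchur finiteRing x
  open Exterior finiteRing using (wedge; wedges; wedge-closed; det; det-expand)
  open KeyPolynomials F n using (key)
  private module P = CommutativeRing finiteRing

  Below : ℕ → ℕ → Finite → Set ℓ
  Below q d f = ∀ m → Exceeds q d m → proj₁ f m ≈ 0#

  below-sub : ∀ {q d} {f g} → Below q d f → Below q d g → Below q d (f P.- g)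
  below-sub p r m e = +-zero (p m e) (neg-zero (r m e))

  below-mul : ∀ {q d} {f g} → Below q d f → Below q 1 g → Below q d (f P.* g)
  below-mul {q} {d} {f} {g} p r m e = mul-vanish n (proj₁ f) (proj₁ g) m λ u v s →
    split u v (exceeds-split q d u v (subst (Exceeds q d) (≡.sym s) e))
    where
    split : ∀ u v → Exceeds q d u ⊎ Exceeds q 1 v → proj₁ f u * proj₁ g v ≈ 0#
    split u v (inj₁ e) = *-zeroL _ (p u e)
    split u v (inj₂ e) = *-zeroR _ (r v e)

  h-vanish : ∀ d j (m : Mono n) → d < deg m ⊎ onlyFirst j m ≡ false → h F n d j m ≈ 0#
  h-vanish d j m (inj₂ p) = indicator-∧-false _ p
  h-vanish d j m (inj₁ p) = indicator-≡ (cong (_∧ onlyFirst j m) (dec-false (deg m ℕ.≟ d) (λ e → ℕ.<-irrefl (≡.sym e) p)))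

  H-vanish : ∀ d j m → j ≤ n → d < deg m ⊎ onlyFirst j m ≡ false → proj₁ (H d j) m ≈ 0#
  H-vanish d j m p r = trans (sym (h≈H d j p m)) (h-vanish d j m r)

  H-TopLe : ∀ d q → q < n → TopLe (proj₁ (H d (suc q))) (single n q d)
  H-TopLe d q p m r = H-vanish d (suc q) m p (single-≺ n q d m p r)

  h-top : ∀ d q → q < n → h F n d (suc q) (single n q d) ≈ 1#
  h-top d q p = indicator-≡ (cong₂ _∧_ (dec-true (deg (single n q d) ℕ.≟ d) (deg-single n q d p)) (onlyFirst-single n q d))

  H-top : ∀ d q → q < n → proj₁ (H d (suc q)) (single n q d) ≈ 1#
  H-top d q p = trans (sym (h≈H d (suc q) p _)) (h-top d q p)

  H-below : ∀ d q → q < n → Below q (suc d) (H d (suc q))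
  H-below d q p m e = H-vanish d (suc q) m p (exceeds-degree q (suc d) m e)

  H-below-1 : ∀ d q p → p ≤ q → q < n → Below q 1 (H d p)
  H-below-1 d q p r s m e = H-vanish d p m (ℕ.≤-trans r (ℕ.<⇒≤ s)) (inj₂ (exceeds-onlyFirst q p m r e))

  row-below-1 : ∀ λ′ t q p j → p ≤ q → q < n → Below q 1 (row λ′ t p j)
  row-below-1 λ′ zero q p j r s = H-below-1 (λ′ ℕ.+ j) q p r s
  row-below-1 (suc λ′) (suc t) q p j r s = row-below-1 λ′ t q p j r s
  row-below-1 zero (suc t) q p zero r s m e = refl
  row-below-1 zero (suc t) q p (suc j) r s = row-below-1 zero t q p j r s

  row-value : ∀ λ′ t p s → proj₁ (row λ′ t p (s ℕ.+ t)) ≈ₚ proj₁ (H (s ℕ.+ λ′) p)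
  row-value λ′ zero p s rewrite ℕ.+-identityʳ s | ℕ.+-comm s λ′ = λ m → refl
  row-value zero (suc t) p s rewrite ℕ.+-suc s t = row-value zero t p s
  row-value (suc λ′) (suc t) p s rewrite ℕ.+-suc s t | ℕ.+-suc s λ′ = row-value λ′ t p (suc s)

  row-below : ∀ λ′ t q j → j < t → q < n → Below q λ′ (row λ′ t (suc q) j)
  row-below zero (suc t) q zero r s m e = refl
  row-below zero (suc t) q (suc j) (s≤s r) s = row-below zero t q j r s
  row-below (suc λ′) (suc t) q j (s≤s r) s m e with ℕ.m≤n⇒m<n∨m≡n r
  ... | inj₁ j<t = row-below λ′ t q j j<t s m (exceeds-weaken q λ′ m e)
  ... | inj₂ ≡.refl = trans (row-value λ′ t (suc q) 0 m) (H-below λ′ q s m e)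

  wedges-below : ∀ N q rs → q < n → All (λ r → proj₁ r < q) rs → ∀ b → Below q 1 (wedges N (rows rs) b)
  wedges-below N q [] r [] b = unit-below N b
    where
    unit-below : ∀ N b → Below q 1 (Exterior.unit finiteRing N b)
    unit-below zero [] m e = trans (sym (h-zero 0 m)) (indicator-∧-false (deg m ℕ.≡ᵇ 0) (exceeds-onlyFirst q 0 m z≤n e))
    unit-below (suc N) (false ∷ b) = unit-below N b
    unit-below (suc N) (true ∷ b) m e = refl
  wedges-below N q ((q' , d) ∷ rs) r (p ∷ ps) = wedge-closed {P = Below q 1} {Below q 1} {Below q 1}
    (λ m e → refl) (λ {f} {g} → below-sub {q} {1} {f} {g}) (λ {f} {g} → below-mul {q} {1} {f} {g}) N _ _
    (λ j _ → row-below-1 d (length rs) q (suc q') j p r) (wedges-below N q rs r ps)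

  -- In the expansion along the last row the entries left of the diagonal have degree less than d,
  -- and the complementary minors do not contain x_q. These terms thus have degree below d in x_q,
  -- while the diagonal term has as its leading monomial x_q^d times that of the smaller
  -- determinant.
  schur-top : ∀ {rs} → Decreasing n rs →
    TopLe (proj₁ (schur rs)) (partsMono n rs) × proj₁ (schur rs) (partsMono n rs) ≈ 1#
  schur-top [] = (λ m p → trans (one≈monomial m) (monomial-TopLe (Vec.replicate n 0) m p))
               , trans (one≈monomial (Vec.replicate n 0)) (monomial-≡ {a = Vec.replicate n 0} ≡.refl)
  schur-top (add {q} {d} {rs} lt b h) =
      (λ m p → trans (expand m) (+-zero (mul-TopLe diagonal-TopLe (proj₁ ih) m p)
        (neg-zero (rest-below m (exceeds-≺ q d (exceeds-single n q d (partsMono n rs) lt) p)))))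
    , trans (expand (single n q d ⊕ partsMono n rs)) (trans (+-cong
        (trans (mul-top diagonal-TopLe (proj₁ ih)) (trans (*-cong (trans (row-value d t (suc q) 0 _) (H-top d q lt)) (proj₂ ih)) (*-identityˡ _)))
        (neg-zero (rest-below (single n q d ⊕ partsMono n rs) (exceeds-single n q d (partsMono n rs) lt))))
        (+-identityʳ _))
    where
    ih = schur-top h
    t = length rs
    ρ : ℕ → Finite
    ρ = row d t (suc q)
    rest : Finite
    rest = wedge t ρ (λ b → wedges (suc t) (rows rs) (true ∷ b)) (full t)
    expand : ∀ m → proj₁ (schur ((q , d) ∷ rs)) m ≈ mul n (proj₁ (ρ t)) (proj₁ (schur rs)) m - proj₁ rest m
    expand = det-expand t ρ (rows rs)
    diagonal-TopLe : TopLe (proj₁ (ρ t)) (single n q d)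
    diagonal-TopLe m p = trans (row-value d t (suc q) 0 m) (H-TopLe d q lt m p)
    rest-below : Below q d rest
    rest-below = wedge-closed {P = Below q d} {Below q 1} {Below q d}
      (λ m e → refl) (λ {f} {g} → below-sub {q} {d} {f} {g}) (λ {f} {g} → below-mul {q} {d} {f} {g}) t ρ _
      (λ j r → row-below d t q j r lt) (λ b′ → wedges-below (suc t) q rs lt b (true ∷ b′)) (full t)

  key-top : ∀ a → TopLe (key a) a × key a a ≈ 1#
  key-top a = subst (λ b → TopLe (key a) b × key a b ≈ 1#) (partsMono-parts a)
    (schur-top (parts-decreasing 0 a [] ≡.refl [] []))

-- The compositions γ(S)*

-- The composition γ with the running value s_j - j + 1 of the next element made explicit.
composition : ∀ {n} → ℕ → Subset n → Mono n
composition r [] = []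
composition r (inside ∷ S) = r ∷ composition r S
composition r (outside ∷ S) = 0 ∷ composition (suc r) S

γ≡composition : ∀ {n} (S : Subset n) → γ S ≡ composition 1 S
γ≡composition S = go 0 0 S z≤n
  where
  go : ∀ {n} p c (S : Subset n) → c ≤ p → gammaAux p c S ≡ composition (suc p ℕ.∸ c) S
  go p c [] h = ≡.refl
  go p c (inside ∷ S) h = cong (suc p ℕ.∸ c ∷_) (go (suc p) (suc c) S (s≤s h))
  go p c (outside ∷ S) h = cong (0 ∷_) (≡.trans (go (suc p) c S (ℕ.m≤n⇒m≤1+n h))
    (cong (λ z → composition z S) (ℕ.+-∸-assoc 1 (ℕ.m≤n⇒m≤1+n h))))

partsRev : ∀ {n} → Mono n → List (ℕ × ℕ)
partsRev [] = []
partsRev (zero ∷ a) = partsRev a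
partsRev {suc n} (suc d ∷ a) = (n , suc d) ∷ partsRev a

parts-snoc-zero : ∀ {n} q (a : Mono n) rest → parts q (a Vec.∷ʳ 0) rest ≡ parts q a rest
parts-snoc-zero q [] rest = ≡.refl
parts-snoc-zero q (zero ∷ a) rest = parts-snoc-zero (suc q) a rest
parts-snoc-zero q (suc d ∷ a) rest = parts-snoc-zero (suc q) a _

parts-snoc-suc : ∀ {n} q (a : Mono n) d rest → parts q (a Vec.∷ʳ suc d) rest ≡ (q ℕ.+ n , suc d) ∷ parts q a rest
parts-snoc-suc q [] d rest rewrite ℕ.+-identityʳ q = ≡.refl
parts-snoc-suc {suc n} q (zero ∷ a) d rest rewrite ℕ.+-suc q n = parts-snoc-suc (suc q) a d rest
parts-snoc-suc {suc n} q (suc _ ∷ a) d rest rewrite ℕ.+-suc q n = parts-snoc-suc (suc q) a d _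

parts-reverse : ∀ {n} (a : Mono n) → parts 0 (Vec.reverse a) [] ≡ partsRev a
parts-reverse [] = ≡.refl
parts-reverse (zero ∷ a) rewrite Vec.reverse-∷ 0 a = ≡.trans (parts-snoc-zero 0 (Vec.reverse a) []) (parts-reverse a)
parts-reverse {suc n} (suc d ∷ a) rewrite Vec.reverse-∷ (suc d) a =
  ≡.trans (parts-snoc-suc 0 (Vec.reverse a) d []) (cong ((n , suc d) ∷_) (parts-reverse a))

partsRev-length : ∀ {n} r (S : Subset n) → length (partsRev (composition (suc r) S)) ≡ ∣ S ∣
partsRev-length r [] = ≡.refl
partsRev-length r (inside ∷ S) = cong suc (partsRev-length r S)
partsRev-length r (outside ∷ S) = partsRev-length (suc r) S

partsRev-≥ : ∀ {n} r (S : Subset n) → All (suc r ≤_) (List.map proj₂ (partsRev (composition (suc r) S)))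
partsRev-≥ r [] = []
partsRev-≥ r (inside ∷ S) = ℕ.≤-refl ∷ partsRev-≥ r S
partsRev-≥ r (outside ∷ S) = All.map ℕ.<⇒≤ (partsRev-≥ (suc r) S)

partsRev-increasing : ∀ {n} r (S : Subset n) → Increasing (partsRev (composition (suc r) S))
partsRev-increasing r [] = []
partsRev-increasing r (inside ∷ S) = cons (partsRev-≥ r S) (partsRev-increasing r S)
  where
  cons : ∀ {x xs} → All (x ≤_) xs → Linked _≤_ xs → Linked _≤_ (x ∷ xs)
  cons [] h = [-]
  cons (p ∷ ps) h = p ∷ h
partsRev-increasing r (outside ∷ S) = partsRev-increasing (suc r) S

key-increasing : ∀ {n} (S : Subset n) → Increasing (parts 0 (γ* S) [])
key-increasing S = subst Increasing
  (≡.sym (≡.trans (cong (λ a → parts 0 (Vec.reverse a) []) (γ≡composition S)) (parts-reverse (composition 1 S))))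
  (partsRev-increasing 0 S)

lookup-∷ʳ-inject₁ : ∀ {n} (a : Mono n) x i → lookup (a Vec.∷ʳ x) (Fin.inject₁ i) ≡ lookup a i
lookup-∷ʳ-inject₁ (y ∷ a) x zero = ≡.refl
lookup-∷ʳ-inject₁ (y ∷ a) x (suc i) = lookup-∷ʳ-inject₁ a x i

lookup-∷ʳ-last : ∀ {n} (a : Mono n) x → lookup (a Vec.∷ʳ x) (Fin.fromℕ n) ≡ x
lookup-∷ʳ-last [] x = ≡.refl
lookup-∷ʳ-last (y ∷ a) x = lookup-∷ʳ-last a x

lookup-reverse : ∀ {n} (a : Mono n) i → lookup (Vec.reverse a) (Fin.opposite i) ≡ lookup a i
lookup-reverse {suc n} (x ∷ a) i rewrite Vec.reverse-∷ x a with i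
... | zero = lookup-∷ʳ-last (Vec.reverse a) x
... | suc i = ≡.trans (lookup-∷ʳ-inject₁ (Vec.reverse a) x (Fin.opposite i)) (lookup-reverse a i)

reverse-∣ₘ : ∀ {n} (a b : Mono n) → a ∣ₘ b → Vec.reverse a ∣ₘ Vec.reverse b
reverse-∣ₘ a b h i = subst (λ i → lookup (Vec.reverse a) i ≤ lookup (Vec.reverse b) i) (Fin.opposite-involutive i)
  (subst₂ _≤_ (≡.sym (lookup-reverse a (Fin.opposite i))) (≡.sym (lookup-reverse b (Fin.opposite i))) (h (Fin.opposite i)))

LastOutside : ∀ {n} → Subset n → Set
LastOutside {n} S = ∀ i → i ∈ S → suc (toℕ i) < n

composition-positive : ∀ {n} r (S : Subset n) i → i ∈ S → suc r ≤ lookup (composition (suc r) S) i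
composition-positive r (inside ∷ S) zero here = ℕ.≤-refl
composition-positive r (inside ∷ S) (suc i) (there p) = composition-positive r S i p
composition-positive r (outside ∷ S) (suc i) (there p) = ℕ.<⇒≤ (composition-positive (suc r) S i p)

size-bound : ∀ {n} (S : Subset (suc n)) → LastOutside S → ∣ S ∣ ≤ n
size-bound {zero} (inside ∷ []) h with h zero here
... | s≤s ()
size-bound {zero} (outside ∷ []) h = z≤n
size-bound {suc n} (inside ∷ S) h = s≤s (size-bound S (λ i p → ℕ.≤-pred (h (suc i) (there p))))
size-bound {suc n} (outside ∷ S) h = ℕ.m≤n⇒m≤1+n (size-bound S (λ i p → ℕ.≤-pred (h (suc i) (there p))))

-- For r = 1 the value at an element of S is one more than the number of positions outside S before
-- it. There are k - 1 positions outside, the last position is one of them, so at most k - 2 come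
-- before an element. The equation is preserved along the scan.
composition-bound : ∀ {n} k r (S : Subset n) → LastOutside S → r ℕ.+ n ≡ k ℕ.+ ∣ S ∣ → ∀ i → lookup (composition r S) i ≤ k ℕ.∸ 1
composition-bound {suc zero} k r (inside ∷ []) h e zero with h zero here
... | s≤s ()
composition-bound {suc (suc n)} k r (inside ∷ S) h e zero =
  ℕ.≤-trans (ℕ.≤-reflexive (≡.sym (ℕ.m+n∸n≡m r 1))) (ℕ.∸-monoˡ-≤ 1 (ℕ.+-cancelʳ-≤ n (r ℕ.+ 1) k (begin
    r ℕ.+ 1 ℕ.+ n ≡⟨ ℕ.+-assoc r 1 n ⟩
    r ℕ.+ suc n ≡⟨ ℕ.suc-injective (≡.trans (≡.sym (ℕ.+-suc r (suc n))) (≡.trans e (ℕ.+-suc k ∣ S ∣))) ⟩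
    k ℕ.+ ∣ S ∣ ≤⟨ ℕ.+-monoʳ-≤ k (size-bound S (λ i p → ℕ.≤-pred (h (suc i) (there p)))) ⟩
    k ℕ.+ n ∎)))
  where open ℕ.≤-Reasoning
composition-bound {suc n} k r (outside ∷ S) h e zero = z≤n
composition-bound {suc n} k r (inside ∷ S) h e (suc i) = composition-bound k r S (λ i p → ℕ.≤-pred (h (suc i) (there p)))
  (ℕ.suc-injective (≡.trans (≡.sym (ℕ.+-suc r n)) (≡.trans e (ℕ.+-suc k ∣ S ∣)))) i
composition-bound {suc n} k r (outside ∷ S) h e (suc i) = composition-bound k (suc r) S (λ i p → ℕ.≤-pred (h (suc i) (there p)))
  (≡.trans (≡.sym (ℕ.+-suc r n)) e) i

composition-size : ∀ {n} r r' (S S' : Subset n) → composition (suc r) S ∣ₘ composition r' S' → ∣ S ∣ ≤ ∣ S' ∣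
composition-size r r' [] [] h = z≤n
composition-size r r' (inside ∷ S) (inside ∷ S') h = s≤s (composition-size r r' S S' (λ i → h (suc i)))
composition-size r r' (inside ∷ S) (outside ∷ S') h with h zero
... | ()
composition-size r r' (outside ∷ S) (inside ∷ S') h =
  ℕ.m≤n⇒m≤1+n (composition-size (suc r) r' S S' (λ i → h (suc i)))
composition-size r r' (outside ∷ S) (outside ∷ S') h = composition-size (suc r) (suc r') S S' (λ i → h (suc i))

-- The exponents at elements of S are positive, so divisibility gives S ⊆ S', and equal sizes force
-- equality. The starting values are independent since only the supports are compared.
composition-∣ₘ : ∀ {n} r r' (S S' : Subset n) → composition (suc r) S ∣ₘ composition r' S' → ∣ S ∣ ≡ ∣ S' ∣ → S ≡ S'
composition-∣ₘ r r' [] [] h e = ≡.refl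
composition-∣ₘ r r' (inside ∷ S) (inside ∷ S') h e =
  cong (inside ∷_) (composition-∣ₘ r r' S S' (λ i → h (suc i)) (ℕ.suc-injective e))
composition-∣ₘ r r' (inside ∷ S) (outside ∷ S') h e with h zero
... | ()
composition-∣ₘ r r' (outside ∷ S) (inside ∷ S') h e =
  ⊥-elim (ℕ.<-irrefl e (s≤s (composition-size (suc r) r' S S' (λ i → h (suc i)))))
composition-∣ₘ r r' (outside ∷ S) (outside ∷ S') h e =
  cong (outside ∷_) (composition-∣ₘ (suc r) (suc r') S S' (λ i → h (suc i)) e)

nonempty : ∀ {n} (S : Subset n) → 1 ≤ ∣ S ∣ → ∃ λ i → i ∈ S
nonempty (inside ∷ S) p = zero , here
nonempty (outside ∷ S) p with nonempty S p
... | i , q = suc i , there q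

two-elements : ∀ {n} (S : Subset n) → 2 ≤ ∣ S ∣ → ∃ λ i → ∃ λ j → i ≢ j × i ∈ S × j ∈ S
two-elements (inside ∷ S) (s≤s p) with nonempty S p
... | j , q = zero , suc j , (λ ()) , here , there q
two-elements (outside ∷ S) p with two-elements S p
... | i , j , r , s , t = suc i , suc j , (λ e → r (Fin.suc-injective e)) , there s , there t

lookup-single : ∀ n q d (i : Fin n) → toℕ i ≡ q → lookup (single n q d) i ≡ d
lookup-single (suc n) zero d zero p = ≡.refl
lookup-single (suc n) (suc q) d (suc i) p = lookup-single n q d i (ℕ.suc-injective p)

lookup-single-≢ : ∀ n q d (i : Fin n) → toℕ i ≢ q → lookup (single n q d) i ≡ 0
lookup-single-≢ (suc n) zero d zero p = ⊥-elim (p ≡.refl)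
lookup-single-≢ (suc n) zero d (suc i) p = Vec.lookup-replicate i 0
lookup-single-≢ (suc n) (suc q) d zero p = ≡.refl
lookup-single-≢ (suc n) (suc q) d (suc i) p = lookup-single-≢ n q d i (λ e → p (cong suc e))

single-∣ₘ : ∀ n q d (a : Mono n) (i : Fin n) → toℕ i ≡ q → d ≤ lookup a i → single n q d ∣ₘ a
single-∣ₘ n q d a i p r j with toℕ j ℕ.≟ q
... | yes e rewrite Fin.toℕ-injective (≡.trans e (≡.sym p)) | lookup-single n q d i p = r
... | no e rewrite lookup-single-≢ n q d j e = z≤n

composition-empty : ∀ {n} r → composition r (Vec.replicate n outside) ≡ Vec.replicate n 0
composition-empty {zero} r = ≡.refl
composition-empty {suc n} r = cong (0 ∷_) (composition-empty (suc r))

∣empty∣ : ∀ n → ∣ Vec.replicate n outside ∣ ≡ 0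
∣empty∣ zero = ≡.refl
∣empty∣ (suc n) = ∣empty∣ n

empty-∉ : ∀ {n} (i : Fin n) → ¬ (i ∈ Vec.replicate n outside)
empty-∉ (suc i) (there p) = empty-∉ i p

-- Shuffles and the combinatorics of standard monomials

upFrom : ℕ → ℕ → List ℕ
upFrom ρ zero = []
upFrom ρ (suc c) = ρ ∷ upFrom (suc ρ) c

-- Shuffle t L j w: the word w is a shuffle of L with j copies of t.
data Shuffle (t : ℕ) : List ℕ → ℕ → List ℕ → Set where
  nil : Shuffle t [] 0 []
  keep : ∀ {L j w} x → Shuffle t L j w → Shuffle t (x ∷ L) j (x ∷ w)
  insert : ∀ {L j w} → Shuffle t L j w → Shuffle t L (suc j) (t ∷ w)

shuffle-replicate : ∀ t j → Shuffle t [] j (List.replicate j t)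
shuffle-replicate t zero = nil
shuffle-replicate t (suc j) = insert (shuffle-replicate t j)

-- Scanning a monomial from its last variable, an exponent above the current value ρ is charged to S.
subset-or-shuffle : ∀ {n} k c B ρ (m : Mono n) → n ≡ c ℕ.+ B → ρ ℕ.+ c ≡ suc k → (∀ i → lookup m i ≤ k) →
  (∃ λ (S : Subset n) → ∣ S ∣ ≡ suc B × LastOutside S × composition (suc ρ) S ∣ₘ m) ⊎
  (∃ λ (w : Mono n) → m ∣ₘ w × Shuffle k (upFrom ρ c) B (Vec.toList w))
subset-or-shuffle {n} k zero B ρ m ≡.refl e h = inj₂ (Vec.replicate n k ,
  (λ i → subst (lookup m i ≤_) (≡.sym (Vec.lookup-replicate i k)) (h i)) ,
  subst (Shuffle k [] B) (≡.sym (Vec.toList-replicate n k)) (shuffle-replicate k B))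
subset-or-shuffle k (suc c) B ρ (x ∷ m) e e' h with x ℕ.≤? ρ
... | yes p with subset-or-shuffle k c B (suc ρ) m (ℕ.suc-injective e) (≡.trans (≡.sym (ℕ.+-suc ρ c)) e') (λ i → h (suc i))
...   | inj₁ (S , u , v , w) = inj₁ (outside ∷ S , u , (λ { (suc i) (there q) → s≤s (v i q) }) ,
                                 λ { zero → z≤n ; (suc i) → w i })
...   | inj₂ (w , u , v) = inj₂ (ρ ∷ w , (λ { zero → p ; (suc i) → u i }) , keep ρ v)
-- No spare letter `k` is left for an exponent above `ρ`, so this position completes S, which has
-- one element more than there were spare letters; the remaining positions stay outside.
subset-or-shuffle {suc n} k (suc c) zero ρ (x ∷ m) e e' h | no p = inj₁
  (inside ∷ Vec.replicate n outside , cong suc (∣empty∣ n) ,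
   (λ { zero here → s≤s tail-nonempty ; (suc i) (there q) → ⊥-elim (empty-∉ i q) }) ,
   λ { zero → ℕ.≰⇒> p ; (suc i) → subst (_≤ lookup m i)
         (≡.sym (≡.trans (cong (λ a → lookup a i) (composition-empty (suc ρ))) (Vec.lookup-replicate i 0))) z≤n })
  where
  tail-nonempty : 0 < n
  tail-nonempty = go c e e'
    where
    go : ∀ c → suc n ≡ suc (c ℕ.+ 0) → ρ ℕ.+ suc c ≡ suc k → 0 < n
    go (suc c) ≡.refl _ = s≤s z≤n
    -- At the last position ρ = k, and no exponent exceeds k.
    go zero _ r = ⊥-elim (p (ℕ.≤-trans (h zero)
      (ℕ.≤-reflexive (ℕ.suc-injective (≡.trans (≡.sym r) (ℕ.+-comm ρ 1))))))
subset-or-shuffle {suc n} k (suc c) (suc B) ρ (x ∷ m) e e' h | no p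
  with subset-or-shuffle k (suc c) B ρ m (≡.trans (ℕ.suc-injective e) (ℕ.+-suc c B)) e' (λ i → h (suc i))
... | inj₁ (S , u , v , w) = inj₁ (inside ∷ S , cong suc u ,
        (λ { zero here → s≤s (ℕ.≤-trans (subst (1 ≤_) (≡.sym u) (s≤s z≤n)) (∣p∣≤n S)) ; (suc i) (there q) → s≤s (v i q) }) ,
        λ { zero → ℕ.≰⇒> p ; (suc i) → w i })
... | inj₂ (w , u , v) = inj₂ (k ∷ w , (λ { zero → h zero ; (suc i) → u i }) , insert v)

-- Reach t l l': the word l' arises from l by moving letters t to the right past smaller letters.
data Reach (t : ℕ) (l : List ℕ) : List ℕ → Set where
  done : Reach t l l
  step : ∀ {s} u v → s ≤ t → Reach t l (u ++ t ∷ s ∷ v) → Reach t l (u ++ s ∷ t ∷ v)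

reach-trans : ∀ {t l l' l''} → Reach t l l' → Reach t l' l'' → Reach t l l''
reach-trans r done = r
reach-trans r (step u v p q) = step u v p (reach-trans r q)

reach-cons : ∀ {t l l'} x → Reach t l l' → Reach t (x ∷ l) (x ∷ l')
reach-cons x done = done
reach-cons x (step u v p q) = step (x ∷ u) v p (reach-cons x q)

reach-move : ∀ {t x} j L → x ≤ t → Reach t (List.replicate j t ++ x ∷ L) (x ∷ List.replicate j t ++ L)
reach-move zero L p = done
reach-move {t} (suc j) L p = step [] (List.replicate j t ++ L) p (reach-cons t (reach-move j L p))

-- The copies of `t` start as a block in front. The whole remaining block passes a kept letter, and
-- an inserted `t` is the first letter of the block.
shuffle-reach : ∀ {t L j w} → Shuffle t L j w → All (_≤ t) L → Reach t (List.replicate j t ++ L) w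
shuffle-reach nil [] = done
shuffle-reach {j = j} (keep {L} x s) (p ∷ ps) = reach-trans (reach-move j L p) (reach-cons x (shuffle-reach s ps))
shuffle-reach {t} (insert s) ps = reach-cons t (shuffle-reach s ps)

upFrom-≤ : ∀ k ρ c → ρ ℕ.+ c ≡ suc k → All (_≤ k) (upFrom ρ c)
upFrom-≤ k ρ zero e = []
upFrom-≤ k ρ (suc c) e =
  ℕ.≤-trans (ℕ.m≤m+n ρ c) (ℕ.≤-reflexive (ℕ.suc-injective (≡.trans (≡.sym (ℕ.+-suc ρ c)) e)))
  ∷ upFrom-≤ k (suc ρ) c (≡.trans (≡.sym (ℕ.+-suc ρ c)) e)

-- Membership of the Demazure characters in J

module KeyMembership {c ℓ : Level} (F : Field c ℓ) (n k : ℕ) where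
  open Ideals F n
  open FlaggedSchur finiteRing x
  open KeyPolynomials F n using (key)

  -- The equation is invariant along the scan: an element of S lowers the length and the size
  -- together, a position outside S trades length for `r`. At an element with n' positions after it,
  -- reversal puts the value r + 1 at position n', and the equation becomes the condition of
  -- `Fitting`.
  composition-fitting : ∀ {n'} r (S : Subset n') → n' ≤ n → suc r ℕ.+ n' ≡ k ℕ.+ ∣ S ∣ →
    Fitting k n (partsRev (composition (suc r) S))
  composition-fitting r [] h e = []
  composition-fitting {suc n'} r (inside ∷ S) h e = add (≡.trans e' (cong (k ℕ.+_) (≡.sym (partsRev-length r S)))) h
    (composition-fitting r S (ℕ.<⇒≤ h) e')
    where
    e' : suc r ℕ.+ n' ≡ k ℕ.+ ∣ S ∣
    e' = ℕ.suc-injective (≡.trans (≡.sym (ℕ.+-suc (suc r) n')) (≡.trans e (ℕ.+-suc k ∣ S ∣)))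
  composition-fitting {suc n'} r (outside ∷ S) h e =
    composition-fitting (suc r) S (ℕ.<⇒≤ h) (≡.trans (≡.sym (ℕ.+-suc (suc r) n')) e)

  key∈J : k ≤ n → (S : Subset n) → ∣ S ∣ ≡ n ℕ.∸ k ℕ.+ 1 → J F n k (key (γ* S))
  key∈J le S e = subst (λ rs → J F n k (proj₁ (schur rs)))
    (≡.sym (≡.trans (cong (λ a → parts 0 (Vec.reverse a) []) (γ≡composition S)) (parts-reverse (composition 1 S))))
    (schur-fitting (J-isIdeal k) k n (n ℕ.∸ k) (ℕ.m+[n∸m]≡n le)
      (λ l p → N∈J k l (subst (_≤ l) (ℕ.+-comm 1 (n ℕ.∸ k)) p))
      (composition-fitting 0 S ℕ.≤-refl (begin
        suc n ≡⟨ cong suc (ℕ.m+[n∸m]≡n le) ⟨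
        suc (k ℕ.+ (n ℕ.∸ k)) ≡⟨ ℕ.+-suc k _ ⟨
        k ℕ.+ suc (n ℕ.∸ k) ≡⟨ cong (k ℕ.+_) (≡.trans (ℕ.+-comm 1 _) (≡.sym e)) ⟩
        k ℕ.+ ∣ S ∣ ∎))
      (≡.trans (partsRev-length 0 S) (≡.trans e (ℕ.+-comm _ 1))))
    where open ≡.≡-Reasoning

-- Linear functionals vanishing on J

exponent : ∀ {n} → Mono n → ℕ → ℕ
exponent [] j = 0
exponent (x ∷ a) zero = x
exponent (x ∷ a) (suc j) = exponent a j

exponent-⊕ : ∀ {n} (a b : Mono n) j → exponent (a ⊕ b) j ≡ exponent a j ℕ.+ exponent b j
exponent-⊕ [] [] j = ≡.refl
exponent-⊕ (x ∷ a) (y ∷ b) zero = ≡.refl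
exponent-⊕ (x ∷ a) (y ∷ b) (suc j) = exponent-⊕ a b j

exponent-zero : ∀ n j → exponent (Vec.replicate n 0) j ≡ 0
exponent-zero zero j = ≡.refl
exponent-zero (suc n) zero = ≡.refl
exponent-zero (suc n) (suc j) = exponent-zero n j

exponent-single : ∀ n j d → j < n → exponent (single n j d) j ≡ d
exponent-single (suc n) zero d p = ≡.refl
exponent-single (suc n) (suc j) d (s≤s p) = exponent-single n j d p

exponent-single-≢ : ∀ n j d i → i ≢ j → exponent (single n j d) i ≡ 0
exponent-single-≢ zero j d i p = ≡.refl
exponent-single-≢ (suc n) zero d zero p = ⊥-elim (p ≡.refl)
exponent-single-≢ (suc n) zero d (suc i) p = exponent-zero n i
exponent-single-≢ (suc n) (suc j) d zero p = ≡.refl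
exponent-single-≢ (suc n) (suc j) d (suc i) p = exponent-single-≢ n j d i (λ e → p (cong suc e))

-- staircase n j = (0, 1, …, j - 1, 0, …, 0)
staircase : ∀ n → ℕ → Mono n
staircase n zero = Vec.replicate n 0
staircase n (suc j) = staircase n j ⊕ single n j j

exponent-staircase-≥ : ∀ n j i → j ≤ i → exponent (staircase n j) i ≡ 0
exponent-staircase-≥ n zero i p = exponent-zero n i
exponent-staircase-≥ n (suc j) i p = ≡.trans (exponent-⊕ (staircase n j) (single n j j) i)
  (cong₂ ℕ._+_ (exponent-staircase-≥ n j i (ℕ.<⇒≤ p)) (exponent-single-≢ n j j i (λ e → ℕ.<-irrefl (≡.sym e) p)))

exponent-staircase : ∀ n j i → j ≤ n → i < j → exponent (staircase n j) i ≡ i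
exponent-staircase n (suc j) i p q with ℕ.m≤n⇒m<n∨m≡n (ℕ.≤-pred q)
... | inj₁ i<j = ≡.trans (exponent-⊕ (staircase n j) (single n j j) i)
  (≡.trans (cong₂ ℕ._+_ (exponent-staircase n j i (ℕ.<⇒≤ p) i<j) (exponent-single-≢ n j j i (λ e → ℕ.<-irrefl e i<j)))
    (ℕ.+-identityʳ i))
... | inj₂ ≡.refl = ≡.trans (exponent-⊕ (staircase n j) (single n j j) i)
  (cong₂ ℕ._+_ (exponent-staircase-≥ n j i ℕ.≤-refl) (exponent-single n j j p))

module Functionals {c ℓ : Level} (F : Field c ℓ) (n : ℕ) where
  open Field F hiding (zero)
  open Ideals F n
  open LeadingMonomials F n
  private module P = CommutativeRing finiteRing

  record Functional (k : ℕ) (a : Mono n) : Set (c ⊔ ℓ) where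
    field
      φ : Poly F n → Carrier
      φ-cong : ∀ {f g} → f ≈ₚ g → φ f ≈ φ g
      φ-+ : ∀ f g → φ (λ m → f m + g m) ≈ φ f + φ g
      φ-scale : ∀ r f → φ (λ m → r * f m) ≈ r * φ f
      φ-J : ∀ {f} → J F n k f → φ f ≈ 0#
      φ-low : ∀ b → b ≺ a → φ (monomial F n b) ≈ 0#
      φ-top : φ (monomial F n a) ≈ 1#

  N-below : ∀ q j d → j ≤ q → q < n → Below q 1 (N d j)
  N-below q j zero r s m e = H-below-1 0 q 0 z≤n s m e
  N-below q zero (suc d) r s m e = refl
  N-below q (suc j) (suc d) r s = below-sub {q} {1} {N (suc d) j} {x j P.* N d j} (N-below q j (suc d) (ℕ.<⇒≤ r) s)
    (below-mul {q} {1} {x j} {N d j} variable-below (N-below q j d (ℕ.<⇒≤ r) s))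
    where
    variable-below : Below q 1 (x j)
    variable-below m e = trans (sym (monomial≈variable′ n j (ℕ.<-trans r s) m))
      (monomial-≢ {a = single n j 1} {m} λ { ≡.refl → false≢true
        (≡.trans (≡.sym (exceeds-onlyFirst q (suc j) (single n j 1) r e)) (onlyFirst-single n j 1)) })
      where
      false≢true : false ≢ true
      false≢true ()

  pow-below : ∀ j i → j < n → Below j (suc i) (pow (x j) i)
  pow-below j i p m e = trans (KeyPolynomials.pow-monomial F n j i p m)
    (monomial-≢ {a = single n j i} {m} λ { ≡.refl → absurd (exceeds-degree j (suc i) (single n j i) e) })
    where
    absurd : ¬ (suc i ≤ deg (single n j i) ⊎ onlyFirst (suc j) (single n j i) ≡ false)
    absurd (inj₁ q) = ℕ.<-irrefl ≡.refl (subst (suc i ≤_) (deg-single n j i p) q)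
    absurd (inj₂ q) with ≡.trans (≡.sym q) (onlyFirst-single n j i)
    ... | ()

  open PowerSeries finiteRing using (conv)

  factor-rest-below : ∀ j i (f : ℕ → Finite) → j < n → (∀ l → Below j 1 (f l)) → Below j (suc i) (conv f (pow (x j)) i)
  factor-rest-below j zero f p h m e = trans (mul-comm n (proj₁ (f 0)) (proj₁ P.1#) m)
    (below-mul {j} {1} {P.1#} {f 0} (pow-below j 0 p) (h 0) m e)
  factor-rest-below j (suc i) f p h m e = +-zero
    (trans (mul-comm n (proj₁ (f 0)) (proj₁ (pow (x j) (suc i))) m)
      (below-mul {j} {suc (suc i)} {pow (x j) (suc i)} {f 0} (pow-below j (suc i) p) (h 0) m e))
    (factor-rest-below j i (λ l → f (suc l)) p (λ l → h (suc l)) m (exceeds-weaken j (suc i) m e))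

  -- The term l = 0 is x_j^j, and all others have lower degree in x_j.
  factor-top : ∀ j → j < n → TopLe (proj₁ (factor j)) (single n j j) × proj₁ (factor j) (single n j j) ≈ 1#
  factor-top zero p =
      (λ m q → trans (expand m) (monomial-TopLe (single n 0 0) m q))
    , trans (expand (single n 0 0)) (monomial-≡ {a = single n 0 0} ≡.refl)
    where
    expand : proj₁ (factor 0) ≈ₚ monomial F n (single n 0 0)
    expand m = trans (mul-oneˡ n (one n) m) (KeyPolynomials.pow-monomial F n 0 0 p m)
  factor-top (suc j) p =
      (λ m q → trans (expand m) (trans (+-cong (monomial-TopLe a m q)
        (rest-below m (exceeds-≺ (suc j) (suc j) exceeds-a q))) (+-identityˡ _)))
    , trans (expand a) (trans (+-cong (monomial-≡ {a = a} ≡.refl) (rest-below a exceeds-a)) (+-identityʳ _))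
    where
    a = single n (suc j) (suc j)
    exceeds-a : Exceeds (suc j) (suc j) a
    exceeds-a = subst (Exceeds (suc j) (suc j)) (⊕-identityʳ a) (exceeds-single n (suc j) (suc j) (Vec.replicate n 0) p)
    rest : Finite
    rest = conv (λ l → N (suc l) (suc j)) (pow (x (suc j))) j
    rest-below : Below (suc j) (suc j) rest
    rest-below = factor-rest-below (suc j) j _ p (λ l → N-below (suc j) (suc j) (suc l) ℕ.≤-refl p)
    expand : proj₁ (factor (suc j)) ≈ₚ (λ m → monomial F n a m + proj₁ rest m)
    expand m = +-congʳ (trans (mul-oneˡ n (proj₁ (pow (x (suc j)) (suc j))) m) (KeyPolynomials.pow-monomial F n (suc j) (suc j) p m))

  vandermonde : ℕ → Finite
  vandermonde zero = P.1#
  vandermonde (suc j) = vandermonde j P.* factor j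

  vandermonde-top : ∀ j → j ≤ n →
    TopLe (proj₁ (vandermonde j)) (staircase n j) × proj₁ (vandermonde j) (staircase n j) ≈ 1#
  vandermonde-top zero p =
      (λ m q → trans (one≈monomial m) (monomial-TopLe (Vec.replicate n 0) m q))
    , trans (one≈monomial (Vec.replicate n 0)) (monomial-≡ {a = Vec.replicate n 0} ≡.refl)
  vandermonde-top (suc j) p =
      mul-TopLe (proj₁ ih) (proj₁ (factor-top j p))
    , trans (mul-top (proj₁ ih) (proj₁ (factor-top j p)))
        (trans (*-cong (proj₂ ih) (proj₂ (factor-top j p))) (*-identityˡ 1#))
    where
    ih = vandermonde-top j (ℕ.<⇒≤ p)

  -- The ideal generated by the x_j ^ (e_j + 1).
  Beyond : Mono n → Finite → Set ℓ
  Beyond e g = ∀ b → (∀ j → exponent b j ≤ exponent e j) → proj₁ g b ≈ 0#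

  beyond-isIdeal : ∀ e → IsIdeal finiteRing (Beyond e)
  beyond-isIdeal e = record
    { I-cong = λ p q b r → trans (sym (p b)) (q b r)
    ; I-zero = λ b r → refl
    ; I-+ = λ p q b r → +-zero (p b r) (q b r)
    ; I-* = λ f {g} p b r → mul-vanish n (proj₁ f) (proj₁ g) b λ u v s → *-zeroR _ (p v (λ j →
        ℕ.≤-trans (subst (exponent v j ≤_) (≡.trans (≡.sym (exponent-⊕ u v j)) (cong (λ z → exponent z j) s))
          (ℕ.m≤n+m (exponent v j) (exponent u j))) (r j))) }

  pow-beyond : ∀ e j d → j < n → exponent e j < d → Beyond e (pow (x j) d)
  pow-beyond e j d p q b r = trans (KeyPolynomials.pow-monomial F n j d p b)
    (monomial-≢ {a = single n j d} {b} λ { ≡.refl →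
      ℕ.<⇒≱ q (subst (_≤ exponent e j) (exponent-single n j d p) (r j)) })

  module _ (a : Mono n) (descent : ∀ j → suc j < n → exponent a j ≤ suc (exponent a (suc j))) where
    e⁺ : Mono n
    e⁺ = a ⊕ staircase n n

    e⁺-exponent : ∀ j → j < n → exponent e⁺ j ≡ exponent a j ℕ.+ j
    e⁺-exponent j p = ≡.trans (exponent-⊕ a (staircase n n) j)
      (cong (exponent a j ℕ.+_) (exponent-staircase n n j ℕ.≤-refl p))

    open ColonIdeal finiteRing (beyond-isIdeal e⁺)

    -- Modulo the colon ideal of the previous Vandermonde factors, `factor-H` replaces `factor j`
    -- times h_i by x_j^(i+j). Its exponent exceeds a_j + j, the exponent of x_j in `e⁺`.
    H-annihilates-initial : ∀ j i → j < n → exponent a j < i → Beyond e⁺ (H i (suc j) P.* vandermonde (suc j))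
    H-annihilates-initial j i p q = colon-transfer (factor j) (H i (suc j)) (vandermonde j)
      (IsIdeal.I-from (colon (vandermonde j)) {factor j P.* H i (suc j)} {pow (x j) (i ℕ.+ j)}
        (factor-H (colon (vandermonde j)) i j (earlier j p q))
        (IsIdeal.I-*ʳ (beyond-isIdeal e⁺) {pow (x j) (i ℕ.+ j)} (vandermonde j)
          (pow-beyond e⁺ j (i ℕ.+ j) p (subst (_< i ℕ.+ j) (≡.sym (e⁺-exponent j p)) (ℕ.+-monoˡ-< j q)))))
      where
      earlier : ∀ j → j < n → exponent a j < i → ∀ s → i < s → Beyond e⁺ (H s j P.* vandermonde j)
      earlier zero p q (suc s) r = IsIdeal.I-zero (colon P.1#)
      earlier (suc j) p q s r =
        -- The induction hypothesis applies because a_j ≤ a_(j+1) + 1 ≤ i < s.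
        H-annihilates-initial j s (ℕ.<⇒≤ p) (ℕ.≤-<-trans (descent j p) (ℕ.≤-<-trans q r))

    H-annihilates : ∀ j i → j < n → exponent a j < i → Beyond e⁺ (H i (suc j) P.* vandermonde n)
    H-annihilates j i p q = subst (λ z → Beyond e⁺ (H i (suc j) P.* vandermonde z)) (ℕ.m∸n+n≡m p)
      (enlarge (n ℕ.∸ suc j))
      where
      enlarge : ∀ r → Beyond e⁺ (H i (suc j) P.* vandermonde (r ℕ.+ suc j))
      enlarge zero = H-annihilates-initial j i p q
      enlarge (suc r) = colon-enlarge (H i (suc j)) (vandermonde (r ℕ.+ suc j)) (factor (r ℕ.+ suc j)) (enlarge r)

    -- f ↦ [x^(a + (0, 1, …, n - 1))] f · Π_{i<j} (x_j - x_i)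
    baseFunctional : ∀ k → suc k ≤ n → (∀ j → j < n → exponent a j ≤ k) → exponent a k ≡ 0 → Functional (suc k) a
    baseFunctional k k<n bound vanish = record
      { φ = λ f → mul n f Δ e⁺
      ; φ-cong = λ p → mul-cong n p (λ _ → refl) e⁺
      ; φ-+ = λ f g → mul-distribʳ n Δ f g e⁺
      ; φ-scale = λ r f → mul-scale n r f Δ e⁺
      ; φ-J = λ {f} h → inIdeal-elim (Jgens F n (suc k)) Q
          (λ p q b r → trans (mul-cong n (λ m → sym (p m)) (λ _ → refl) b) (q b r))
          (λ b r → CommutativeRing.zeroˡ (polyRing n) Δ b)
          (λ {f} {g} p q b r → trans (mul-distribʳ n Δ f g b) (+-zero (p b r) (q b r)))
          generator h e⁺ (λ j → ℕ.≤-refl)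
      ; φ-low = λ b p → mul-TopLe (monomial-TopLe b) Δ-TopLe e⁺ (⊕-monoˡ-≺ (staircase n n) p)
      ; φ-top = trans (mul-top (monomial-TopLe a) Δ-TopLe)
          (trans (*-cong (monomial-≡ {a = a} ≡.refl) (proj₂ (vandermonde-top n ℕ.≤-refl))) (*-identityˡ 1#)) }
      where
      Δ : Poly F n
      Δ = proj₁ (vandermonde n)
      Δ-TopLe : TopLe Δ (staircase n n)
      Δ-TopLe = proj₁ (vandermonde-top n ℕ.≤-refl)
      -- Vanishing at all divisors of x^(e⁺), and not only at `e⁺`, is an ideal condition, so
      -- multiples of the generators are covered.
      Q : Poly F n → Set ℓ
      Q f = ∀ b → (∀ j → exponent b j ≤ exponent e⁺ j) → mul n f Δ b ≈ 0#
      I : IsIdeal finiteRing (λ g → Beyond e⁺ (g P.* vandermonde n))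
      I = colon (vandermonde n)
      -- The entry 0 of `a` at position k makes all h_s(x_0, ..., x_k) with s > 0 annihilated, hence
      -- all e_d of these k + 1 variables with d > 0. Each of the other n - k - 1 variables raises
      -- the bound on d by one.
      E-annihilates : ∀ d → n ℕ.∸ suc k ℕ.+ 1 ≤ d → Beyond e⁺ (E d n P.* vandermonde n)
      E-annihilates d p = subst (λ z → Beyond e⁺ (E d z P.* vandermonde n)) (ℕ.m∸n+n≡m k<n)
        (E-more-variables I (suc k) small (n ℕ.∸ suc k) d (subst (_≤ d) (ℕ.+-comm (n ℕ.∸ suc k) 1) p))
        where
        small : ∀ d → 0 < d → Beyond e⁺ (E d (suc k) P.* vandermonde n)
        small (suc d) p = E-from-N I (suc d) (suc k)
          (N-from-H I (suc k) (λ s q → H-annihilates k s k<n (subst (_< s) (≡.sym vanish) q)) d)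
      generator : ∀ f g → FinSupp F n f → Jgens F n (suc k) g → Q (mul n f g)
      generator f g s (inj₁ (suc j , _ , p , q)) b r = trans
        (mul-cong n (mul-cong n {f} (λ _ → refl) (λ m → trans (q m) (h≈H (suc k) (suc j) p m))) (λ _ → refl) b)
        (IsIdeal.I-* I (f , s) {H (suc k) (suc j)} (H-annihilates j (suc k) p (s≤s (bound j p))) b r)
      generator f g s (inj₂ (d , p , _ , q)) b r = trans
        (mul-cong n (mul-cong n {f} (λ _ → refl) (λ m → trans (q m) (e≈E d m))) (λ _ → refl) b)
        (IsIdeal.I-* I (f , s) {E d n} (E-annihilates d p) b r)

-- Dominates j c b: the monomial c can occur in the Demazure operator at positions j, j + 1 applied to the monomial b.
Dominates : ∀ {n} → ℕ → Mono n → Mono n → Set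
Dominates zero (p ∷ q ∷ c) (s ∷ t ∷ b) = c ≡ b × s ℕ.+ t ≡ p ℕ.+ q × (p ≤ s ⊎ p ≤ t) × (q ≤ s ⊎ q ≤ t)
Dominates (suc j) (p ∷ c) (s ∷ b) = p ≡ s × Dominates j c b
Dominates _ c b = c ≡ b

dominates-deg : ∀ {n} j (c b : Mono n) → Dominates j c b → deg b ≡ deg c
dominates-deg zero [] b ≡.refl = ≡.refl
dominates-deg zero (p ∷ []) b ≡.refl = ≡.refl
dominates-deg (suc j) [] b ≡.refl = ≡.refl
dominates-deg zero (p ∷ q ∷ c) (s ∷ t ∷ b) (≡.refl , e , _) =
  ≡.trans (≡.sym (ℕ.+-assoc s t (deg b))) (≡.trans (cong (ℕ._+ deg b) e) (ℕ.+-assoc p q (deg b)))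
dominates-deg (suc j) (p ∷ c) (s ∷ b) (≡.refl , d) = cong (p ℕ.+_) (dominates-deg j c b d)

private
  low-or-≡ : ∀ {q S t K s} → S ≤ K → t ≤ s → s ≤ K → q ≤ S ⊎ q ≤ t → q < K ⊎ q ≡ K
  low-or-≡ a b c (inj₁ d) = ℕ.m≤n⇒m<n∨m≡n (ℕ.≤-trans d a)
  low-or-≡ a b c (inj₂ d) = ℕ.m≤n⇒m<n∨m≡n (ℕ.≤-trans d (ℕ.≤-trans b c))

dominates-swap : ∀ {n} j K (a c : Mono n) → suc j < n → exponent a j ≡ K → exponent a (suc j) ≤ K →
  Dominates j c a → c ≺ swapAt j a ⊎ c ≡ swapAt j a
dominates-swap zero K (x ∷ []) c (s≤s ()) e le d
dominates-swap zero K (.K ∷ s ∷ a) (p ∷ q ∷ c) r ≡.refl le (≡.refl , e , _ , f)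
  with low-or-≡ ℕ.≤-refl ℕ.≤-refl le f
... | inj₁ q<K = inj₁ (inj₁ (inj₂ (≡.refl , q<K)))
... | inj₂ ≡.refl = inj₂ (cong (_∷ q ∷ c) (ℕ.+-cancelʳ-≡ q p s (≡.trans (≡.sym e) (ℕ.+-comm K s))))
dominates-swap (suc j) K (x ∷ a) (p ∷ c) (s≤s r) e le (≡.refl , d) with dominates-swap j K a c r e le d
... | inj₁ h = inj₁ (inj₁ h)
... | inj₂ h = inj₂ (cong (p ∷_) h)

-- If the later exponents of a and b agree, then that of x_(j+1) in c is at most K, the value it has
-- in the swapped a. In case of equality the exponents of x_j are compared through the sums over the
-- two positions. The bound on b_j is essential: a larger b_j could reappear as the exponent of
-- x_(j+1).
dominates-≺ : ∀ {n} j K (a b c : Mono n) → suc j < n → exponent a j ≡ K → exponent a (suc j) ≤ K →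
  exponent b j ≤ K → b ≺ a → Dominates j c b → c ≺ swapAt j a
dominates-≺ zero K (x ∷ []) b c (s≤s ()) e le le' lt d
dominates-≺ zero K (.K ∷ s ∷ a) (S ∷ t ∷ b) (p ∷ q ∷ c) r ≡.refl le S≤K lt (≡.refl , e , _ , f) = cases lt
  where
  finish : t ≤ s → S ℕ.+ t < K ℕ.+ s → (p ∷ q ∷ b) ≺ (s ∷ K ∷ b)
  finish t≤s sum with low-or-≡ S≤K t≤s le f
  ... | inj₁ q<K = inj₁ (inj₂ (≡.refl , q<K))
  ... | inj₂ ≡.refl = inj₂ (≡.refl , ℕ.+-cancelʳ-< q p s (subst₂ _<_ e (ℕ.+-comm K s) sum))
  cases : (S ∷ t ∷ b) ≺ (K ∷ s ∷ a) → (p ∷ q ∷ b) ≺ (s ∷ K ∷ a)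
  cases (inj₁ (inj₁ h)) = inj₁ (inj₁ h)
  cases (inj₁ (inj₂ (≡.refl , t<s))) = finish (ℕ.<⇒≤ t<s) (ℕ.+-mono-≤-< S≤K t<s)
  cases (inj₂ (≡.refl , S<K)) = finish ℕ.≤-refl (ℕ.+-monoˡ-< s S<K)
dominates-≺ (suc j) K (x ∷ a) (y ∷ b) (p ∷ c) (s≤s r) e le le' (inj₁ h) (≡.refl , d) =
  inj₁ (dominates-≺ j K a b c r e le le' h d)
dominates-≺ (suc j) K (x ∷ a) (y ∷ .a) (p ∷ c) (s≤s r) e le le' (inj₂ (≡.refl , lt)) (≡.refl , d)
  with dominates-swap j K a c r e le d
... | inj₁ h = inj₁ h
... | inj₂ h = inj₂ (h , lt)

split-exponent : ∀ n j d (b : Mono n) → j < n → d ≤ exponent b j → ∃ λ b' → single n j d ⊕ b' ≡ b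
split-exponent (suc n) zero d (x ∷ b) p q = (x ℕ.∸ d) ∷ b , cong₂ _∷_ (ℕ.m+[n∸m]≡n q) (⊕-identityˡ b)
split-exponent (suc n) (suc j) d (x ∷ b) (s≤s p) q with split-exponent n j d b p q
... | b' , e = x ∷ b' , cong (x ∷_) e

-- Demazure operators on coefficient functions

module Demazure {c ℓ : Level} (F : Field c ℓ) where
  open Field F hiding (zero)
  open PolynomialRing F
  open Generators F
  open Symmetry F

  -- Coefficients of (x f - y (s f)) / (x - y) for a series f in x and y, along each antidiagonal.
  sweep : (ℕ → ℕ → Carrier) → ℕ → ℕ → Carrier
  sweep f p zero = f p 0
  sweep f p (suc q) = sweep f (suc p) q + (f p (suc q) - f q (suc p))

  -- Induction on q - p in steps of two: unfolding at both ends of the antidiagonal adds two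
  -- corrections that are negatives of each other.
  sweep-symmetric-≤ : ∀ f p q → p ≤ q → sweep f p q ≈ sweep f q p
  sweep-symmetric-≤ f p q p≤q = subst (λ z → sweep f p z ≈ sweep f z p) (ℕ.m∸n+n≡m p≤q) (go (q ℕ.∸ p) p)
    where
    go : ∀ r p → sweep f p (r ℕ.+ p) ≈ sweep f (r ℕ.+ p) p
    go zero p = refl
    go (suc zero) p = solve 2 (λ a b → a :+ (b :- b) := a) refl _ _
    go (suc (suc r)) p = trans (+-congʳ (subst (λ z → sweep f (suc p) z ≈ sweep f z (suc p)) (ℕ.+-suc r p) (go r (suc p))))
      (solve 3 (λ a b d → (a :+ (b :- d)) :+ (d :- b) := a) refl _ _ _)

  sweep-symmetric : ∀ f p q → sweep f p q ≈ sweep f q p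
  sweep-symmetric f p q with ℕ.≤-total p q
  ... | inj₁ p≤q = sweep-symmetric-≤ f p q p≤q
  ... | inj₂ q≤p = sym (sweep-symmetric-≤ f q p q≤p)

  sweep-vanish-≥ : ∀ f p q → (∀ s t → s ℕ.+ t ≡ p ℕ.+ q → p ≤ s ⊎ p ≤ t → f s t ≈ 0#) → sweep f p q ≈ 0#
  sweep-vanish-≥ f p zero h = h p 0 ≡.refl (inj₁ ℕ.≤-refl)
  sweep-vanish-≥ f p (suc q) h = +-zero
    (sweep-vanish-≥ f (suc p) q λ s t e → λ
      { (inj₁ r) → h s t (≡.trans e (≡.sym (ℕ.+-suc p q))) (inj₁ (ℕ.<⇒≤ r))
      ; (inj₂ r) → h s t (≡.trans e (≡.sym (ℕ.+-suc p q))) (inj₂ (ℕ.<⇒≤ r)) })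
    (+-zero (h p (suc q) ≡.refl (inj₁ ℕ.≤-refl))
      (neg-zero (h q (suc p) (≡.trans (ℕ.+-comm q (suc p)) (≡.sym (ℕ.+-suc p q))) (inj₂ (ℕ.n≤1+n p)))))

  sweep-vanish : ∀ f p q →
    (∀ s t → s ℕ.+ t ≡ p ℕ.+ q → p ≤ s ⊎ p ≤ t → q ≤ s ⊎ q ≤ t → f s t ≈ 0#) → sweep f p q ≈ 0#
  sweep-vanish f p q h with ℕ.≤-total p q
  ... | inj₁ p≤q = trans (sweep-symmetric f p q) (sweep-vanish-≥ f q p λ s t e r →
          h s t (≡.trans e (ℕ.+-comm q p)) (weaken p≤q r) r)
    where
    weaken : ∀ {p q s t} → p ≤ q → q ≤ s ⊎ q ≤ t → p ≤ s ⊎ p ≤ t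
    weaken le (inj₁ r) = inj₁ (ℕ.≤-trans le r)
    weaken le (inj₂ r) = inj₂ (ℕ.≤-trans le r)
  ... | inj₂ q≤p = sweep-vanish-≥ f p q λ s t e r → h s t e r (weaken q≤p r)
    where
    weaken : ∀ {p q s t} → p ≤ q → q ≤ s ⊎ q ≤ t → p ≤ s ⊎ p ≤ t
    weaken le (inj₁ r) = inj₁ (ℕ.≤-trans le r)
    weaken le (inj₂ r) = inj₂ (ℕ.≤-trans le r)

  sweep-extreme : ∀ f p q → (∀ s t → s ℕ.+ t ≡ p ℕ.+ q → p < s ⊎ p < t → f s t ≈ 0#) → sweep f p q ≈ f p q
  sweep-extreme f p zero h = refl
  sweep-extreme f p (suc q) h = trans
    (+-cong (sweep-vanish-≥ f (suc p) q (λ s t e r → h s t (≡.trans e (≡.sym (ℕ.+-suc p q))) r))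
            (trans (+-congˡ (neg-zero (h q (suc p) (≡.trans (ℕ.+-comm q (suc p)) (≡.sym (ℕ.+-suc p q))) (inj₂ ℕ.≤-refl)))) (+-identityʳ _)))
    (+-identityˡ _)

  sweep-cong : ∀ {f g} → (∀ p q → f p q ≈ g p q) → ∀ p q → sweep f p q ≈ sweep g p q
  sweep-cong h p zero = h p 0
  sweep-cong h p (suc q) = +-cong (sweep-cong h (suc p) q) (+-cong (h p (suc q)) (-‿cong (h q (suc p))))

  sweep-+ : ∀ f g p q → sweep (λ p q → f p q + g p q) p q ≈ sweep f p q + sweep g p q
  sweep-+ f g p zero = refl
  sweep-+ f g p (suc q) = trans (+-congʳ (sweep-+ f g (suc p) q))
    (solve 6 (λ a b u v w z → (a :+ b) :+ ((u :+ v) :- (w :+ z)) := (a :+ (u :- w)) :+ (b :+ (v :- z))) refl _ _ _ _ _ _)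

  sweep-scale : ∀ r f p q → sweep (λ p q → r * f p q) p q ≈ r * sweep f p q
  sweep-scale r f p zero = refl
  sweep-scale r f p (suc q) = trans (+-congʳ (sweep-scale r f (suc p) q))
    (solve 4 (λ r a b d → r :* a :+ (r :* b :- r :* d) := r :* (a :+ (b :- d))) refl r _ _ _)

  π : ∀ n → ℕ → Poly F n → Poly F n
  π zero j f m = f m
  π (suc n) (suc j) f (x ∷ m) = π n j (slice f x) m
  π (suc zero) zero f m = f m
  π (suc (suc n)) zero f (p ∷ q ∷ m) = sweep (λ p q → f (p ∷ q ∷ m)) p q

  π-cong : ∀ n j {f g} → f ≈ₚ g → π n j f ≈ₚ π n j g
  π-cong zero j h m = h m
  π-cong (suc zero) zero h m = h m
  π-cong (suc (suc n)) zero h (p ∷ q ∷ m) = sweep-cong (λ p q → h (p ∷ q ∷ m)) p q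
  π-cong (suc n) (suc j) h (x ∷ m) = π-cong n j (λ m → h (x ∷ m)) m

  π-+ : ∀ n j f g → π n j (λ m → f m + g m) ≈ₚ (λ m → π n j f m + π n j g m)
  π-+ zero j f g m = refl
  π-+ (suc zero) zero f g m = refl
  π-+ (suc (suc n)) zero f g (p ∷ q ∷ m) = sweep-+ _ _ p q
  π-+ (suc n) (suc j) f g (x ∷ m) = π-+ n j _ _ m

  π-scale : ∀ n j r f → π n j (λ m → r * f m) ≈ₚ (λ m → r * π n j f m)
  π-scale zero j r f m = refl
  π-scale (suc zero) zero r f m = refl
  π-scale (suc (suc n)) zero r f (p ∷ q ∷ m) = sweep-scale r _ p q
  π-scale (suc n) (suc j) r f (x ∷ m) = π-scale n j r _ m

  π-vanish : ∀ n j f c → (∀ b → Dominates j c b → f b ≈ 0#) → π n j f c ≈ 0#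
  π-vanish zero zero f [] h = h [] ≡.refl
  π-vanish zero (suc j) f [] h = h [] ≡.refl
  π-vanish (suc zero) zero f (p ∷ []) h = h (p ∷ []) ≡.refl
  π-vanish (suc (suc n)) zero f (p ∷ q ∷ m) h = sweep-vanish _ p q λ s t e u v → h (s ∷ t ∷ m) (≡.refl , e , u , v)
  π-vanish (suc n) (suc j) f (x ∷ m) h = π-vanish n j (slice f x) m λ b d → h (x ∷ b) (≡.refl , d)

  π-finSupp : ∀ n j {f} → FinSupp F n f → FinSupp F n (π n j f)
  π-finSupp n j {f} (D , h) = D , λ m p → π-vanish n j f m λ b d →
    h b (subst (D <_) (≡.sym (dominates-deg j m b d)) p)

  π-monomial : ∀ n j K (a : Mono n) → suc j < n → exponent a j ≡ K → exponent a (suc j) ≤ K →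
    π n j (monomial F n a) (swapAt j a) ≈ 1#
  π-monomial n j K a r e le = go n j (monomial F n a) a r e le (monomial-≡ {a = a} ≡.refl) (λ b → monomial-≢ {a = a} {b})
    where
    go : ∀ n j (f : Poly F n) a → suc j < n → exponent a j ≡ K → exponent a (suc j) ≤ K →
      f a ≈ 1# → (∀ b → a ≢ b → f b ≈ 0#) → π n j f (swapAt j a) ≈ 1#
    go (suc zero) zero f a (s≤s ()) e le h h'
    go (suc (suc n)) zero f (.K ∷ s ∷ a) r ≡.refl le h h' = trans (sweep-symmetric _ s K)
      (trans (sweep-extreme _ K s λ s' t e' → λ
        { (inj₁ u) → h' _ λ { ≡.refl → ℕ.<-irrefl ≡.refl u }
        ; (inj₂ u) → h' _ λ { ≡.refl → ℕ.<⇒≱ u le } }) h)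
    go (suc n) (suc j) f (x ∷ a) (s≤s r) e le h h' =
      go n j (slice f x) a r e le h (λ b p → h' (x ∷ b) (λ q → p (cong Vec.tail q)))

  π-shift : ∀ n j f → suc j < n → (λ m → shift n j (π n j f) m - shift n (suc j) (π n j f) m) ≈ₚ
    (λ m → shift n j f m - shift n (suc j) (swap j f) m)
  π-shift (suc zero) zero f (s≤s ()) m
  π-shift (suc (suc n)) zero f r (zero ∷ zero ∷ m) = refl
  π-shift (suc (suc n)) zero f r (zero ∷ suc q ∷ m) =
    +-congˡ (-‿cong (sweep-symmetric (λ p q → f (p ∷ q ∷ m)) 0 q))
  π-shift (suc (suc n)) zero f r (suc p ∷ zero ∷ m) = refl
  π-shift (suc (suc n)) zero f r (suc p ∷ suc q ∷ m) = solve 3 (λ a b d → (a :+ (b :- d)) :- a := b :- d) refl _ _ _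
  π-shift (suc n) (suc j) f (s≤s r) (x ∷ m) = π-shift n j (slice f x) r m

  module _ (n j : ℕ) (j<n : suc j < n) where
    private
      module P = CommutativeRing (polyRing n)
      module T = RingTools (polyRing n)
      X Y : Poly F n
      X = variable′ n j
      Y = variable′ n (suc j)

    π-gap : ∀ f → (X P.- Y) P.* π n j f ≈ₚ X P.* f P.- Y P.* swap j f
    π-gap f m = trans (T.solve 3 (λ x y g → (x T.:- y) T.:* g T.:= x T.:* g T.:- y T.:* g) P.refl X Y (π n j f) m)
      (trans (+-cong (mul-variable n j (π n j f) m) (-‿cong (mul-variable n (suc j) (π n j f) m)))
        (trans (π-shift n j f j<n m)
          (sym (+-cong (mul-variable n j f m) (-‿cong (mul-variable n (suc j) (swap j f) m))))))

    π-mul-symmetric : ∀ f g → swap j g ≈ₚ g → π n j (f P.* g) ≈ₚ π n j f P.* g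
    π-mul-symmetric f g h = gap-cancel n j (π n j (f P.* g)) (π n j f P.* g) j<n λ m →
      trans (π-gap (f P.* g) m) (trans (+-congˡ (-‿cong (P.*-congˡ {Y} {swap j (f P.* g)} {swap j f P.* g}
        (λ m → trans (sym (mul-swap n j f g m)) (P.*-congˡ {swap j f} {swap j g} {g} h m)) m)))
      (trans (T.solve 5 (λ x y f s g → x T.:* (f T.:* g) T.:- y T.:* (s T.:* g) T.:= (x T.:* f T.:- y T.:* s) T.:* g) P.refl X Y f (swap j f) g m)
      (trans (P.*-congʳ {g} {X P.* f P.- Y P.* swap j f} {(X P.- Y) P.* π n j f} (λ m → sym (π-gap f m)) m)
        (P.*-assoc (X P.- Y) (π n j f) g m))))

    -- The twisted Leibniz rule π(fg) = s(f) π(g) + (π(f) - s(f)) g. The polynomial π(g) enters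
    -- through its defining relation, so that a known polynomial can be inserted for it. An ideal
    -- containing both g and π(g) then contains π(fg).
    π-mul : ∀ f g g⁺ → (X P.- Y) P.* g⁺ ≈ₚ X P.* g P.- Y P.* swap j g →
      π n j (f P.* g) ≈ₚ swap j f P.* g⁺ P.+ (π n j f P.- swap j f) P.* g
    π-mul f g g⁺ h = gap-cancel n j (π n j (f P.* g)) (swap j f P.* g⁺ P.+ (π n j f P.- swap j f) P.* g) j<n λ m →
      trans (π-gap (f P.* g) m) (trans (+-congˡ (-‿cong (P.*-congˡ {Y} {swap j (f P.* g)} {swap j f P.* swap j g}
        (λ m → sym (mul-swap n j f g m)) m)))
      (trans (T.solve 6 (λ x y f s g t → x T.:* (f T.:* g) T.:- y T.:* (s T.:* t) T.:=
                s T.:* (x T.:* g T.:- y T.:* t) T.:+ ((x T.:* f T.:- y T.:* s) T.:- (x T.:- y) T.:* s) T.:* g) P.refl X Y f (swap j f) g (swap j g) m)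
      (trans (+-cong (P.*-congˡ {swap j f} {X P.* g P.- Y P.* swap j g} {(X P.- Y) P.* g⁺} (λ m → sym (h m)) m)
                     (P.*-congʳ {g} {(X P.* f P.- Y P.* swap j f) P.- (X P.- Y) P.* swap j f} {(X P.- Y) P.* π n j f P.- (X P.- Y) P.* swap j f}
                       (λ m → +-congʳ (sym (π-gap f m))) m))
        (T.solve 6 (λ x y p s g t → s T.:* ((x T.:- y) T.:* t) T.:+ ((x T.:- y) T.:* p T.:- (x T.:- y) T.:* s) T.:* g T.:=
                (x T.:- y) T.:* (s T.:* t T.:+ (p T.:- s) T.:* g)) P.refl X Y (π n j f) (swap j f) g g⁺ m))))

-- Linear functionals on finitely supported polynomials

module LinearFunctionals {c ℓ : Level} (F : Field c ℓ) where
  open Field F hiding (zero)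
  open PolynomialRing F

  -- Additivity of `φ` only handles finitely many terms, so finite support enters here: f is split
  -- by the powers of the first variable up to the degree bound. The hypothesis multiplies
  -- coefficient and value, so that a different factor may vanish at each monomial.
  functional-vanish : ∀ n (φ : Poly F n → Carrier) → (∀ {f g} → f ≈ₚ g → φ f ≈ φ g) →
    (∀ f g → φ (λ m → f m + g m) ≈ φ f + φ g) → (∀ r f → φ (λ m → r * f m) ≈ r * φ f) →
    ∀ {f} → FinSupp F n f → (∀ b → f b * φ (monomial F n b) ≈ 0#) → φ f ≈ 0#
  functional-vanish zero φ φ-cong φ-+ φ-scale {f} s h = trans
    (φ-cong {f} {λ m → f [] * monomial F 0 [] m} λ { [] → sym (*-identityʳ _) })
    (trans (φ-scale (f []) (monomial F 0 [])) (h []))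
  functional-vanish (suc n) φ φ-cong φ-+ φ-scale {f} (D , s) h =
    go φ φ-cong φ-+ φ-scale (suc D) f (λ i m p → s (i ∷ m) (ℕ.<-≤-trans p (ℕ.m≤m+n i (deg m)))) s h
    where
    constant : Poly F n → Poly F (suc n)
    constant g (zero ∷ m) = g m
    constant g (suc _ ∷ m) = 0#
    tail : Poly F (suc n) → Poly F (suc n)
    tail f (x ∷ m) = f (suc x ∷ m)
    split : ∀ f → f ≈ₚ (λ m → constant (slice f 0) m + shift (suc n) 0 (tail f) m)
    split f (zero ∷ m) = sym (+-identityʳ _)
    split f (suc x ∷ m) = sym (+-identityˡ _)
    monomial-∷ : ∀ x y (b m : Mono n) → monomial F (suc n) (suc x ∷ b) (suc y ∷ m) ≈ monomial F (suc n) (x ∷ b) (y ∷ m)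
    monomial-∷ x y b m = decide (≡-dec ℕ._≟_ (x ∷ b) (y ∷ m))
      where
      decide : Dec (x ∷ b ≡ y ∷ m) → _ ≈ _
      decide (yes ≡.refl) = trans (monomial-≡ {a = suc x ∷ b} ≡.refl) (sym (monomial-≡ {a = x ∷ b} ≡.refl))
      decide (no p) = trans (monomial-≢ {a = suc x ∷ b} {suc y ∷ m} λ { ≡.refl → p ≡.refl }) (sym (monomial-≢ p))
    constant-monomial : ∀ b → constant (monomial F n b) ≈ₚ monomial F (suc n) (0 ∷ b)
    constant-monomial b (zero ∷ m) = decide (≡-dec ℕ._≟_ b m)
      where
      decide : Dec (b ≡ m) → _ ≈ _
      decide (yes ≡.refl) = trans (monomial-≡ {a = b} ≡.refl) (sym (monomial-≡ {a = 0 ∷ b} ≡.refl))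
      decide (no p) = trans (monomial-≢ p) (sym (monomial-≢ {a = 0 ∷ b} {0 ∷ m} λ { ≡.refl → p ≡.refl }))
    constant-monomial b (suc x ∷ m) = sym (monomial-≢ {a = 0 ∷ b} {suc x ∷ m} λ ())
    shift-monomial : ∀ b → shift (suc n) 0 (monomial F (suc n) b) ≈ₚ monomial F (suc n) (suc (Vec.head b) ∷ Vec.tail b)
    shift-monomial (x ∷ b) (zero ∷ m) = sym (monomial-≢ {a = suc x ∷ b} {0 ∷ m} λ ())
    shift-monomial (x ∷ b) (suc y ∷ m) = sym (monomial-∷ x y b m)
    go : ∀ (φ : Poly F (suc n) → Carrier) → (∀ {f g} → f ≈ₚ g → φ f ≈ φ g) →
      (∀ f g → φ (λ m → f m + g m) ≈ φ f + φ g) → (∀ r f → φ (λ m → r * f m) ≈ r * φ f) →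
      ∀ E f → (∀ i m → E ≤ i → f (i ∷ m) ≈ 0#) → (∀ m → D < deg m → f m ≈ 0#) →
      (∀ b → f b * φ (monomial F (suc n) b) ≈ 0#) → φ f ≈ 0#
    go φ φ-cong φ-+ φ-scale zero f t s h = trans
      (φ-cong {f} {λ m → 0# * f m} λ { (i ∷ m) → trans (t i m z≤n) (sym (zeroˡ _)) })
      (trans (φ-scale 0# f) (zeroˡ _))
    go φ φ-cong φ-+ φ-scale (suc E) f t s h = trans (φ-cong (split f)) (trans (φ-+ _ _) (+-zero
      (functional-vanish n (λ g → φ (constant g))
        (λ p → φ-cong λ { (zero ∷ m) → p m ; (suc _ ∷ m) → refl })
        (λ f g → trans (φ-cong λ { (zero ∷ m) → refl ; (suc _ ∷ m) → sym (+-identityʳ _) }) (φ-+ (constant f) (constant g)))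
        (λ r f → trans (φ-cong λ { (zero ∷ m) → refl ; (suc _ ∷ m) → sym (zeroʳ _) }) (φ-scale r (constant f)))
        {slice f 0} (D , λ m → s (0 ∷ m)) (λ b → trans (*-congˡ (φ-cong (constant-monomial b))) (h (0 ∷ b))))
      (go (λ g → φ (shift (suc n) 0 g))
        (λ p → φ-cong (shift-cong (suc n) 0 p))
        (λ f g → trans (φ-cong (shift-+ (suc n) 0 f g)) (φ-+ _ _))
        (λ r f → trans (φ-cong λ { (zero ∷ m) → sym (zeroʳ _) ; (suc _ ∷ m) → refl }) (φ-scale r (shift (suc n) 0 f)))
        E (tail f) (λ i m p → t (suc i) m (s≤s p)) (λ { (x ∷ m) p → s (suc x ∷ m) (ℕ.m≤n⇒m≤1+n p) })
        (λ { (x ∷ b) → trans (*-congˡ (φ-cong (shift-monomial (x ∷ b)))) (h (suc x ∷ b)) }))))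

  functional-agree : ∀ n (φ : Poly F n → Carrier) → (∀ {f g} → f ≈ₚ g → φ f ≈ φ g) →
    (∀ f g → φ (λ m → f m + g m) ≈ φ f + φ g) → (∀ r f → φ (λ m → r * f m) ≈ r * φ f) →
    ∀ {f g} → FinSupp F n f → FinSupp F n g → (∀ b → (f b - g b) * φ (monomial F n b) ≈ 0#) → φ f ≈ φ g
  functional-agree n φ φ-cong φ-+ φ-scale {f} {g} s t h = trans
    (φ-cong {f} {λ m → (f m - g m) + g m} (λ m → solve 2 (λ a b → a := (a :- b) :+ b) refl _ _))
    (trans (φ-+ _ g) (trans (+-congʳ (functional-vanish n φ φ-cong φ-+ φ-scale
      (proj₂ (CommutativeRing._-_ (Polynomials.finiteRing F n) (f , s) (g , t))) h)) (+-identityˡ _)))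

-- The Gröbner basis

reverse-swap : ∀ {a} {A : Set a} (u : List A) x y v →
  List.reverse (u ++ x ∷ y ∷ v) ≡ List.reverse v ++ y ∷ x ∷ List.reverse u
reverse-swap u x y v = begin
  List.reverse (u ++ x ∷ y ∷ v)
    ≡⟨ List.reverse-++ u (x ∷ y ∷ v) ⟩
  List.reverse (x ∷ y ∷ v) ++ List.reverse u
    ≡⟨ cong (List._++ List.reverse u) (≡.trans (List.unfold-reverse x (y ∷ v)) (cong (List._++ x ∷ []) (List.unfold-reverse y v))) ⟩
  ((List.reverse v ++ y ∷ []) ++ x ∷ []) ++ List.reverse u
    ≡⟨ List.++-assoc (List.reverse v ++ y ∷ []) (x ∷ []) _ ⟩
  (List.reverse v ++ y ∷ []) ++ x ∷ List.reverse u
    ≡⟨ List.++-assoc (List.reverse v) (y ∷ []) _ ⟩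
  List.reverse v ++ y ∷ x ∷ List.reverse u ∎
  where open ≡.≡-Reasoning

swapAt-toList : ∀ {n} w x y z (a : Mono n) → Vec.toList a ≡ w ++ x ∷ y ∷ z →
  Vec.toList (swapAt (length w) a) ≡ w ++ y ∷ x ∷ z × suc (length w) < n ×
  exponent a (length w) ≡ x × exponent a (suc (length w)) ≡ y
swapAt-toList [] x y z (.x ∷ .y ∷ a) ≡.refl = ≡.refl , s≤s (s≤s z≤n) , ≡.refl , ≡.refl
swapAt-toList (t ∷ w) x y z (t' ∷ a) e with List.∷-injective e
... | ≡.refl , e' with swapAt-toList w x y z a e'
...   | p , q , r , s = cong (t ∷_) p , s≤s q , r , s

upFrom-snoc : ∀ ρ c → upFrom ρ (suc c) ≡ upFrom ρ c ++ (ρ ℕ.+ c) ∷ []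
upFrom-snoc ρ zero = cong (_∷ []) (≡.sym (ℕ.+-identityʳ ρ))
upFrom-snoc ρ (suc c) = cong (ρ ∷_) (≡.trans (upFrom-snoc (suc ρ) c)
  (cong (λ z → upFrom (suc ρ) c ++ z ∷ []) (≡.sym (ℕ.+-suc ρ c))))

reverse-upFrom : ∀ c → List.reverse (upFrom 0 c) ≡ List.downFrom c
reverse-upFrom zero = ≡.refl
reverse-upFrom (suc c) = ≡.trans (cong List.reverse (upFrom-snoc 0 c))
  (≡.trans (List.reverse-++ (upFrom 0 c) (c ∷ [])) (cong (c ∷_) (reverse-upFrom c)))

reverse-replicate : ∀ j (t : ℕ) → List.reverse (List.replicate j t) ≡ List.replicate j t
reverse-replicate zero t = ≡.refl
reverse-replicate (suc j) t = ≡.trans (List.unfold-reverse t (List.replicate j t))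
  (≡.trans (cong (List._++ t ∷ []) (reverse-replicate j t)) (snoc j))
  where
  snoc : ∀ j → List.replicate j t ++ t ∷ [] ≡ t ∷ List.replicate j t
  snoc zero = ≡.refl
  snoc (suc j) = cong (t ∷_) (snoc j)

module _ (K : ℕ) where
  descending-bound : ∀ {n} c B (a : Mono n) → c ≤ suc K → Vec.toList a ≡ List.downFrom c ++ List.replicate B K →
    ∀ j → exponent a j ≤ K
  descending-bound c B [] p e j = z≤n
  descending-bound zero (suc B) (x ∷ a) p e zero = ℕ.≤-reflexive (proj₁ (List.∷-injective e))
  descending-bound (suc c) B (x ∷ a) p e zero = ℕ.≤-trans (ℕ.≤-reflexive (proj₁ (List.∷-injective e))) (ℕ.≤-pred p)
  descending-bound zero (suc B) (x ∷ a) p e (suc j) = descending-bound zero B a p (proj₂ (List.∷-injective e)) j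
  descending-bound (suc c) B (x ∷ a) p e (suc j) = descending-bound c B a (ℕ.<⇒≤ p) (proj₂ (List.∷-injective e)) j

  descending-zero : ∀ {n} c B (a : Mono n) → Vec.toList a ≡ List.downFrom (suc c) ++ List.replicate B K →
    exponent a c ≡ 0
  descending-zero zero B (x ∷ a) e = proj₁ (List.∷-injective e)
  descending-zero (suc c) B (x ∷ a) e = descending-zero c B a (proj₂ (List.∷-injective e))

  descending-descent : ∀ {n} c B (a : Mono n) → Vec.toList a ≡ List.downFrom c ++ List.replicate B K →
    ∀ j → suc j < n → exponent a j ≤ suc (exponent a (suc j))
  descending-descent c B (x ∷ []) e zero (s≤s ())
  descending-descent zero (suc B) (x ∷ y ∷ a) e zero p with List.∷-injective e
  descending-descent zero (suc (suc B)) (x ∷ y ∷ a) e zero p | e₁ , e₂ =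
    ℕ.m≤n⇒m≤1+n (ℕ.≤-reflexive (≡.trans e₁ (≡.sym (proj₁ (List.∷-injective e₂)))))
  descending-descent (suc zero) B (x ∷ y ∷ a) e zero p =
    ℕ.≤-trans (ℕ.≤-reflexive (proj₁ (List.∷-injective e))) z≤n
  descending-descent (suc (suc c)) B (x ∷ y ∷ a) e zero p with List.∷-injective e
  ... | e₁ , e₂ = ℕ.≤-reflexive (≡.trans e₁ (cong suc (≡.sym (proj₁ (List.∷-injective e₂)))))
  descending-descent zero (suc B) (x ∷ a) e (suc j) (s≤s p) = descending-descent zero B a (proj₂ (List.∷-injective e)) j p
  descending-descent (suc c) B (x ∷ a) e (suc j) (s≤s p) = descending-descent c B a (proj₂ (List.∷-injective e)) j p

∣ₘ-quotient : ∀ {n} (a b : Mono n) → a ∣ₘ b → ∃ λ u → u ⊕ a ≡ b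
∣ₘ-quotient [] [] h = [] , ≡.refl
∣ₘ-quotient (x ∷ a) (y ∷ b) h with ∣ₘ-quotient a b (λ i → h (suc i))
... | u , e = (y ℕ.∸ x) ∷ u , cong₂ _∷_ (ℕ.m∸n+n≡m (h zero)) e

module Groebner {c ℓ : Level} (F : Field c ℓ) (n K : ℕ) (K<n : suc K ≤ n) where
  open Field F hiding (zero)
  open SwapAction F n
  open LeadingMonomials F n
  open Functionals F n
  open Demazure F
  open LinearFunctionals F
  open KeyPolynomials F n using (key; kappa-unique; kappa-exists)
  open KeyMembership F n
  private
    module P = CommutativeRing (polyRing n)
    module Q = CommutativeRing finiteRing

  k : ℕ
  k = suc K

  J′ : Poly F n → Set (c ⊔ ℓ)
  J′ = J F n k

  generators : Poly F n → Set ℓ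
  generators = Jgens F n k

  J-* : ∀ (a : Finite) {g} → J′ g → J′ (mul n (proj₁ a) g)
  J-* a = inIdeal-* generators (proj₂ a)

  -- The e_d and all h_k(x_0, ..., x_i) with i different from j are symmetric in x_j and x_(j+1),
  -- and π_j is linear over them. The remaining generator goes to h_k(x_0, ..., x_(j+1)), which is
  -- again a generator.
  π-J : ∀ j → suc j < n → ∀ {f} → J′ f → J′ (π n j f)
  π-J j p = inIdeal-elim generators (λ f → J′ (π n j f))
    (λ e → inIdeal-cong generators (π-cong n j e))
    (inIdeal-cong generators (λ m → sym (π-vanish n j (λ _ → 0#) m (λ _ _ → refl))) (IsIdeal.I-zero (J-isIdeal k)))
    (λ {f} {g} u v → inIdeal-cong generators (λ m → sym (π-+ n j f g m)) (inIdeal-+ generators u v))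
    generator
    where
    symmetric : ∀ (a g : Finite) → swapFinite j g .proj₁ ≈ₚ proj₁ g → J′ (proj₁ g) → J′ (π n j (mul n (proj₁ a) (proj₁ g)))
    symmetric (a , s) (g , _) e h = inIdeal-cong generators (λ m → sym (π-mul-symmetric n j p a g e m))
      (J-* (π n j a , π-finSupp n j s) h)
    -- The only generator that is not symmetric in x j and x (j + 1).
    critical : ∀ (a : Finite) → J′ (π n j (mul n (proj₁ a) (proj₁ (H k (suc j)))))
    critical (a , s) = inIdeal-cong generators
      (λ m → sym (π-mul n j p a (proj₁ (H k (suc j))) (proj₁ (H k (suc (suc j)))) gap-identity m))
      (inIdeal-+ generators (J-* (swapFinite j (a , s)) (H∈J k (suc j) p))
        (J-* ((π n j a , π-finSupp n j s) Q.- swapFinite j (a , s)) (H∈J k j (ℕ.<⇒≤ p))))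
      where
      open import Algebra.Properties.Ring (CommutativeRing.ring (polyRing n)) using (-‿distribˡ-*)
      gap-identity : (variable′ n j P.- variable′ n (suc j)) P.* proj₁ (H k (suc (suc j))) ≈ₚ
        variable′ n j P.* proj₁ (H k (suc j)) P.- variable′ n (suc j) P.* swap j (proj₁ (H k (suc j)))
      gap-identity m = trans (H-gap j k p m) (+-congˡ (sym (-‿distribˡ-* (variable′ n (suc j)) (swap j (proj₁ (H k (suc j)))) m)))
    replace : ∀ a {g g'} → g ≈ₚ g' → J′ (π n j (mul n a g')) → J′ (π n j (mul n a g))
    replace a {g} {g'} e = inIdeal-cong generators (π-cong n j (P.*-congˡ {a} {g'} {g} (λ m → sym (e m))))
    generator : ∀ a g → FinSupp F n a → generators g → J′ (π n j (mul n a g))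
    generator a g s (inj₁ (suc j' , _ , q , e)) with j' ℕ.≟ j
    ... | yes ≡.refl = replace a (λ m → trans (e m) (h≈H k (suc j') q m)) (critical (a , s))
    ... | no r = replace a (λ m → trans (e m) (h≈H k (suc j') q m))
      (symmetric (a , s) (H k (suc j')) (H-symmetric j k (suc j') q (λ z → r (ℕ.suc-injective z))) (H∈J k j' q))
    generator a g s (inj₂ (d , q , r , e)) = replace a (λ m → trans (e m) (e≈E d m))
      (symmetric (a , s) (E d n) (E-symmetric j d)
        (inIdeal-generator generators (inj₂ (d , q , r , λ m → sym (e≈E d m)))))

  J-finSupp : ∀ {f} → J′ f → FinSupp F n f
  J-finSupp = inIdeal-elim generators (FinSupp F n) finSupp-cong (0 , λ _ _ → refl) finSupp-+
    λ { a g s (inj₁ (j , _ , p , e)) → finSupp-mul s (finSupp-cong (λ m → sym (trans (e m) (h≈H k j p m))) (proj₂ (H k j)))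
      ; a g s (inj₂ (d , _ , _ , e)) → finSupp-mul s (finSupp-cong (λ m → sym (trans (e m) (e≈E d m))) (proj₂ (E d n))) }

  -- π_j carries x^a to the swapped monomial with coefficient 1 plus smaller terms, and each x^b
  -- below x^a with b_j ≤ K to terms below the swapped monomial. For b_j > K this can fail, and the
  -- vanishing on J is used instead.
  moveLeft : ∀ j a → suc j < n → exponent a j ≡ K → exponent a (suc j) ≤ K → Functional k (swapAt j a) → Functional k a
  moveLeft j a p e le Φ = record
    { φ = ψ
    ; φ-cong = ψ-cong
    ; φ-+ = ψ-+
    ; φ-scale = λ r f → trans (φ-cong (π-scale n j r f)) (φ-scale r _)
    ; φ-J = ψ-J
    ; φ-low = λ b → low b (≺-wellFounded b)
    ; φ-top = trans (functional-agree n φ φ-cong φ-+ φ-scale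
        (π-finSupp n j (finSupp-monomial a)) (finSupp-monomial (swapAt j a)) top-terms) φ-top }
    where
    open Functional Φ
    ψ : Poly F n → Carrier
    ψ f = φ (π n j f)
    ψ-cong : ∀ {f g} → f ≈ₚ g → ψ f ≈ ψ g
    ψ-cong h = φ-cong (π-cong n j h)
    ψ-+ : ∀ f g → ψ (λ m → f m + g m) ≈ ψ f + ψ g
    ψ-+ f g = trans (φ-cong (π-+ n j f g)) (φ-+ _ _)
    ψ-scale : ∀ r f → ψ (λ m → r * f m) ≈ r * ψ f
    ψ-scale r f = trans (φ-cong (π-scale n j r f)) (φ-scale r _)
    ψ-J : ∀ {f} → J′ f → ψ f ≈ 0#
    ψ-J h = φ-J (π-J j p h)
    low : ∀ b → Acc _≺_ b → b ≺ a → ψ (monomial F n b) ≈ 0#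
    low b (acc rec) lt with exponent b j ℕ.≤? K
    ... | yes b≤K = functional-vanish n φ φ-cong φ-+ φ-scale (π-finSupp n j (finSupp-monomial b)) terms
      where
      terms : ∀ d → π n j (monomial F n b) d * φ (monomial F n d) ≈ 0#
      terms d with ≺-compare d (swapAt j a)
      ... | inj₁ d≺ = *-zeroR _ (φ-low d d≺)
      ... | inj₂ d≽ = *-zeroL _ (π-vanish n j (monomial F n b) d λ b' dom → monomial-≢ {a = b} {b'} λ { ≡.refl →
              ⊁ d≽ (dominates-≺ j K a b d p e le b≤K lt dom) })
        where
        ⊁ : ∀ {d a} → d ≡ a ⊎ a ≺ d → ¬ (d ≺ a)
        ⊁ (inj₁ ≡.refl) r = ≺-irrefl _ r
        ⊁ (inj₂ s) r = ≺-irrefl _ (≺-trans s r)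
    -- Subtracting a multiple of h_k(x 0, …, x j) ∈ J trades x^b for smaller monomials.
    ... | no b≰K with split-exponent n j k b (ℕ.<⇒≤ p) (ℕ.≰⇒> b≰K)
    ...   | b' , eq = trans (functional-agree n ψ ψ-cong ψ-+ ψ-scale (finSupp-monomial b) (proj₂ G) terms)
                        (ψ-J (J-* (monomial F n b' , finSupp-monomial b') (H∈J k j (ℕ.<⇒≤ p))))
      where
      G : Finite
      G = (monomial F n b' , finSupp-monomial b') Q.* H k (suc j)
      eq' : b' ⊕ single n j k ≡ b
      eq' = ≡.trans (⊕-comm b' _) eq
      G-TopLe : TopLe (proj₁ G) b
      G-TopLe = subst (TopLe (proj₁ G)) eq' (mul-TopLe (monomial-TopLe b') (H-TopLe k j (ℕ.<⇒≤ p)))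
      G-top : proj₁ G b ≈ 1#
      G-top = subst (λ z → proj₁ G z ≈ 1#) eq' (trans (mul-top (monomial-TopLe b') (H-TopLe k j (ℕ.<⇒≤ p)))
        (trans (*-cong (monomial-≡ {a = b'} ≡.refl) (H-top k j (ℕ.<⇒≤ p))) (*-identityˡ 1#)))
      terms : ∀ d → (monomial F n b d - proj₁ G d) * ψ (monomial F n d) ≈ 0#
      terms d with ≺-compare d b
      ... | inj₁ d≺b = *-zeroR _ (low d (rec d≺b) (≺-trans d≺b lt))
      ... | inj₂ (inj₁ ≡.refl) = *-zeroL _ (zero-sub (trans (monomial-≡ {a = b} ≡.refl) (sym G-top)))
      ... | inj₂ (inj₂ b≺d) = *-zeroL _ (zero-sub (trans (monomial-TopLe b d b≺d) (sym (G-TopLe d b≺d))))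
    top-terms : ∀ b → (π n j (monomial F n a) b - monomial F n (swapAt j a) b) * φ (monomial F n b) ≈ 0#
    top-terms b with ≺-compare b (swapAt j a)
    ... | inj₁ b≺ = *-zeroR _ (φ-low b b≺)
    ... | inj₂ (inj₁ ≡.refl) = *-zeroL _ (zero-sub (trans (π-monomial n j K a p e le) (sym (monomial-≡ {a = swapAt j a} ≡.refl))))
    ... | inj₂ (inj₂ ≺b) = *-zeroL _ (zero-sub (trans
        (π-vanish n j (monomial F n a) b λ b' dom → monomial-≢ {a = a} {b'} λ { ≡.refl → absurd (dominates-swap j K a b p e le dom) })
        (sym (monomial-TopLe (swapAt j a) b ≺b))))
      where
      absurd : ¬ (b ≺ swapAt j a ⊎ b ≡ swapAt j a)
      absurd (inj₁ r) = ≺-irrefl _ (≺-trans r ≺b)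
      absurd (inj₂ ≡.refl) = ≺-irrefl _ ≺b

  -- Words are read from the last variable, the order in which they are produced by scanning a
  -- reversed monomial. A letter moving right in the word thus moves left among the variables.
  Realized : List ℕ → Set (c ⊔ ℓ)
  Realized l = ∀ (a : Mono n) → Vec.toList a ≡ List.reverse l → Functional k a

  reach-realized : ∀ {l l'} → Realized l → Reach K l l' → Realized l'
  reach-realized Φ done = Φ
  reach-realized Φ (step {s} u v s≤K r) a e with swapAt-toList (List.reverse v) K s (List.reverse u) a (≡.trans e (reverse-swap u s K v))
  ... | e' , p , q , t = moveLeft (length (List.reverse v)) a p q (subst (_≤ K) (≡.sym t) s≤K)
    (reach-realized Φ r (swapAt (length (List.reverse v)) a) (≡.trans e' (≡.sym (reverse-swap u K s v))))

  base-realized : ∀ B → Realized (List.replicate B K ++ upFrom 0 k)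
  base-realized B a e = baseFunctional a (descending-descent K k B a e') K K<n
    (λ j _ → descending-bound K k B a ℕ.≤-refl e' j) (descending-zero K K B a e')
    where
    e' : Vec.toList a ≡ List.downFrom k ++ List.replicate B K
    e' = ≡.trans e (≡.trans (List.reverse-++ (List.replicate B K) (upFrom 0 k))
      (cong₂ List._++_ (reverse-upFrom k) (reverse-replicate B K)))

  shuffle-functional : ∀ {B} (w : Mono n) → Shuffle K (upFrom 0 k) B (Vec.toList w) → Functional k (Vec.reverse w)
  shuffle-functional {B} w s = reach-realized (base-realized B) (shuffle-reach s (upFrom-≤ K 0 k ≡.refl)) (Vec.reverse w) (Vec.toList-reverse w)

  IsLM⇒TopLe : ∀ {f m} → IsLM F n f m → TopLe f m
  IsLM⇒TopLe (_ , h) b p = h b (≺⇒neglex p)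

  TopLe⇒IsLM : ∀ {f m} → TopLe f m → f m ≈ 1# → IsLM F n f m
  TopLe⇒IsLM h p = (λ q → 1≉0 (trans (sym p) q)) , λ b r → h b (neglex⇒≺ r)

  -- A monomial multiple of f has leading monomial x^a and stays in J. The functional returns its
  -- leading coefficient, which is that of f and would have to be 0.
  functional-excludes : ∀ {a f m} → Functional k a → J′ f → IsLM F n f m → m ∣ₘ a → ⊥
  functional-excludes {a} {f} {m} Φ f∈J lm m∣a with ∣ₘ-quotient m a m∣a
  ... | u , ≡.refl = proj₁ lm (trans (sym top) (trans (sym (trans (φ-scale (g a) (monomial F n a)) (trans (*-congˡ φ-top) (*-identityʳ _))))
          (trans (sym (functional-agree n φ φ-cong φ-+ φ-scale (J-finSupp g∈J) scaled-finSupp terms)) (φ-J g∈J))))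
    where
    open Functional Φ
    g : Poly F n
    g = mul n (monomial F n u) f
    g∈J : J′ g
    g∈J = J-* (monomial F n u , finSupp-monomial u) f∈J
    g-TopLe : TopLe g a
    g-TopLe = mul-TopLe (monomial-TopLe u) (IsLM⇒TopLe lm)
    top : g a ≈ f m
    top = trans (mul-top (monomial-TopLe u) (IsLM⇒TopLe lm)) (trans (*-congʳ (monomial-≡ {a = u} ≡.refl)) (*-identityˡ _))
    scaled-finSupp : FinSupp F n (λ m → g a * monomial F n a m)
    scaled-finSupp = proj₁ (finSupp-monomial a) , λ m p → *-zeroR _ (proj₂ (finSupp-monomial a) m p)
    terms : ∀ b → (g b - g a * monomial F n a b) * φ (monomial F n b) ≈ 0#
    terms b with ≺-compare b a
    ... | inj₁ b≺a = *-zeroR _ (φ-low b b≺a)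
    ... | inj₂ (inj₁ ≡.refl) = *-zeroL _ (zero-sub (sym (trans (*-congˡ (monomial-≡ {a = a} ≡.refl)) (*-identityʳ _))))
    ... | inj₂ (inj₂ a≺b) = *-zeroL _ (zero-sub (trans (g-TopLe b a≺b) (sym (*-zeroR _ (monomial-TopLe a b a≺b)))))

  G′ : Poly F n → Set (c ⊔ ℓ)
  G′ = Gset F n k

  h∈G : ∀ j → j < n → G′ (h F n k (suc j))
  h∈G j p = inj₁ (suc j , s≤s z≤n , p , λ m → refl)

  h-IsLM : ∀ j → j < n → IsLM F n (h F n k (suc j)) (single n j k)
  h-IsLM j p = TopLe⇒IsLM (λ b r → h-vanish k (suc j) b (single-≺ n j k b p r)) (h-top k j p)

  leading-divisor : ∀ f m → J′ f → IsLM F n f m → ∃ λ g → ∃ λ m₀ → G′ g × IsLM F n g m₀ × m₀ ∣ₘ m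
  leading-divisor f m f∈J lm with Fin.any? (λ i → k ℕ.≤? lookup m i)
  ... | yes (i , p) = h F n k (suc (toℕ i)) , single n (toℕ i) k , h∈G (toℕ i) (Fin.toℕ<n i) ,
          h-IsLM (toℕ i) (Fin.toℕ<n i) , single-∣ₘ n (toℕ i) k m i ≡.refl p
  -- All exponents are now at most K. The scan starts with the k letters 0, ..., K and n - k spare
  -- copies of K, and runs over the reversed exponents because γ(S)* is the reversal of γ(S).
  ... | no none with subset-or-shuffle K k (n ℕ.∸ k) 0 (Vec.reverse m) (≡.sym (ℕ.m+[n∸m]≡n K<n)) ≡.refl bounded
    where
    bounded : ∀ i → lookup (Vec.reverse m) i ≤ K
    bounded i = subst (λ i → lookup (Vec.reverse m) i ≤ K) (Fin.opposite-involutive i)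
      (subst (_≤ K) (≡.sym (lookup-reverse m (Fin.opposite i))) (ℕ.≮⇒≥ λ q → none (Fin.opposite i , q)))
  ...   | inj₁ (S , e , last , d) = key (γ* S) , γ* S ,
            inj₂ (S , last , ≡.trans e (ℕ.+-comm 1 _) , kappa-exists (γ* S) (key-increasing S)) ,
            TopLe⇒IsLM (proj₁ (key-top (γ* S))) (proj₂ (key-top (γ* S))) ,
            subst₂ _∣ₘ_ (cong Vec.reverse (≡.sym (γ≡composition S))) (Vec.reverse-involutive m) (reverse-∣ₘ (composition 1 S) (Vec.reverse m) d)
  ...   | inj₂ (w , d , s) = ⊥-elim (functional-excludes (shuffle-functional w s) f∈J lm
            (subst (_∣ₘ Vec.reverse w) (Vec.reverse-involutive m) (reverse-∣ₘ (Vec.reverse m) w d)))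

  G⊆J : ∀ g → G′ g → J′ g
  G⊆J g (inj₁ p) = inIdeal-generator generators (inj₁ p)
  G⊆J g (inj₂ (S , _ , e , κ)) = inIdeal-cong generators (λ m → sym (kappa-unique κ (key-increasing S) m)) (key∈J k K<n S e)

  groebner : IsGroebnerBasis F n G′ J′
  groebner = G⊆J , λ f → mk⇔ forward backward
    where
    I-I = InitSet F n J′
    I-G = InitSet F n G′
    forward : ∀ {f} → InIdeal F n I-I f → InIdeal F n I-G f
    forward = inIdeal-elim I-I (InIdeal F n I-G) (inIdeal-cong I-G) (IsIdeal.I-zero (inIdeal-isIdeal I-G)) (inIdeal-+ I-G) generator
      where
      generator : ∀ a q → FinSupp F n a → I-I q → InIdeal F n I-G (mul n a q)
      generator a q s (f , m , f∈J , lm , e) with leading-divisor f m f∈J lm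
      ... | g , m₀ , g∈G , lm₀ , d with ∣ₘ-quotient m₀ m d
      ...   | u , ≡.refl = inIdeal-cong I-G
                (λ b → trans (P.*-assoc a (monomial F n u) (monomial F n m₀) b)
                  (P.*-congˡ {a} {mul n (monomial F n u) (monomial F n m₀)} {q} (λ b → trans (monomial-⊕ u m₀ b) (sym (e b))) b))
                (inIdeal-* I-G (finSupp-mul s (finSupp-monomial u))
                  (inIdeal-generator I-G (g , m₀ , g∈G , lm₀ , λ b → refl)))
    backward : ∀ {f} → InIdeal F n I-G f → InIdeal F n I-I f
    backward = inIdeal-elim I-G (InIdeal F n I-I) (inIdeal-cong I-I) (IsIdeal.I-zero (inIdeal-isIdeal I-I)) (inIdeal-+ I-I)
      λ { a q s (g , m , g∈G , lm , e) → inIdeal-* I-I s (inIdeal-generator I-I (g , m , G⊆J g g∈G , lm , e)) }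

  data Leading (g : Poly F n) : Mono n → Set (c ⊔ ℓ) where
    complete : ∀ j → j < n → g ≈ₚ h F n k (suc j) → Leading g (single n j k)
    demazure : ∀ S → LastOutside S → ∣ S ∣ ≡ n ℕ.∸ k ℕ.+ 1 → g ≈ₚ key (γ* S) → Leading g (Vec.reverse (composition 1 S))

  IsLM-unique : ∀ {f m m₀} → IsLM F n f m → TopLe f m₀ → f m₀ ≈ 1# → m ≡ m₀
  IsLM-unique {f} {m} {m₀} lm h p with ≺-compare m m₀
  ... | inj₁ r = ⊥-elim (1≉0 (trans (sym p) (IsLM⇒TopLe lm m₀ r)))
  ... | inj₂ (inj₁ e) = e
  ... | inj₂ (inj₂ r) = ⊥-elim (proj₁ lm (h m r))

  leading : ∀ g m → G′ g → IsLM F n g m → Leading g m × g m ≈ 1#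
  leading g m (inj₁ (suc j , _ , p , e)) lm
    with IsLM-unique lm (λ b r → trans (e b) (h-vanish k (suc j) b (single-≺ n j k b p r))) (trans (e _) (h-top k j p))
  ... | ≡.refl = complete j p e , trans (e _) (h-top k j p)
  leading g m (inj₂ (S , last , size , κ)) lm
    with IsLM-unique lm (λ b r → trans (g≈key b) (proj₁ (key-top (γ* S)) b r)) (trans (g≈key _) (proj₂ (key-top (γ* S))))
    where
    g≈key : g ≈ₚ key (γ* S)
    g≈key = kappa-unique κ (key-increasing S)
  ... | ≡.refl = subst (Leading g) (cong Vec.reverse (≡.sym (γ≡composition S))) (demazure S last size g≈key) , trans (g≈key _) (proj₂ (key-top (γ* S)))
    where
    g≈key : g ≈ₚ key (γ* S)
    g≈key = kappa-unique κ (key-increasing S)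

  minimal : k < n → IsMinimal F n G′
  minimal k<n = (λ g m p lm → proj₂ (leading g m p lm)) ,
    λ g g' m m' p p' g≉g' lm lm' → compare (proj₁ (leading g m p lm)) (proj₁ (leading g' m' p' lm')) g≉g'
    where
    at-least-two : 2 ≤ n ℕ.∸ k ℕ.+ 1
    at-least-two = ℕ.+-monoˡ-≤ 1 (ℕ.m<n⇒0<n∸m k<n)
    size-equation : ∀ (S : Subset n) → ∣ S ∣ ≡ n ℕ.∸ k ℕ.+ 1 → suc n ≡ k ℕ.+ ∣ S ∣
    size-equation S e = ≡.sym (≡.trans (cong (k ℕ.+_) e) (≡.trans (≡.sym (ℕ.+-assoc k (n ℕ.∸ k) 1))
      (≡.trans (ℕ.+-comm _ 1) (cong suc (ℕ.m+[n∸m]≡n K<n)))))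
    compare : ∀ {g g' m m'} → Leading g m → Leading g' m' → ¬ (g ≈ₚ g') → ¬ (m ∣ₘ m')
    compare (complete j p e) (complete j' p' e') g≉g' d with j ℕ.≟ j'
    ... | yes ≡.refl = g≉g' (λ b → trans (e b) (sym (e' b)))
    ... | no j≢j' = ℕ.<⇒≱ (s≤s z≤n) (subst₂ _≤_
            (lookup-single n j k (Fin.fromℕ< p) (Fin.toℕ-fromℕ< p))
            (lookup-single-≢ n j' k (Fin.fromℕ< p) (λ q → j≢j' (≡.trans (≡.sym (Fin.toℕ-fromℕ< p)) q))) (d (Fin.fromℕ< p)))
    compare (complete j p e) (demazure S last size e') _ d = ℕ.<⇒≱ ℕ.≤-refl (ℕ.≤-trans
      (subst (_≤ lookup (Vec.reverse (composition 1 S)) i) (lookup-single n j k i (Fin.toℕ-fromℕ< p)) (d i))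
      (subst (λ i → lookup (Vec.reverse (composition 1 S)) i ≤ K) (Fin.opposite-involutive i)
        (subst (_≤ K) (≡.sym (lookup-reverse (composition 1 S) (Fin.opposite i)))
          (composition-bound k 1 S last (size-equation S size) (Fin.opposite i)))))
      where
      i : Fin n
      i = Fin.fromℕ< p
    -- Since k < n, the set S has at least two elements, so its leading monomial involves two
    -- variables and cannot divide a pure power.
    compare (demazure S last size e) (complete j p e') _ d
      with two-elements S (subst (2 ≤_) (≡.sym size) at-least-two)
    ... | i , i' , i≢i' , i∈S , i'∈S = i≢i' (≡.trans (≡.sym (Fin.opposite-involutive i))
            (≡.trans (cong Fin.opposite (Fin.toℕ-injective (≡.trans (position i i∈S) (≡.sym (position i' i'∈S)))))
              (Fin.opposite-involutive i')))
      where
      position : ∀ i → i ∈ S → toℕ (Fin.opposite i) ≡ j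
      position i i∈S with toℕ (Fin.opposite i) ℕ.≟ j
      ... | yes q = q
      ... | no q = ⊥-elim (ℕ.<⇒≱ (composition-positive 0 S i i∈S)
              (subst₂ _≤_ (lookup-reverse (composition 1 S) i) (lookup-single-≢ n j k (Fin.opposite i) q) (d (Fin.opposite i))))
    compare (demazure S last size e) (demazure S' last' size' e') g≉g' d
      with composition-∣ₘ 0 1 S S' (subst₂ _∣ₘ_ (Vec.reverse-involutive (composition 1 S)) (Vec.reverse-involutive (composition 1 S')) (reverse-∣ₘ (Vec.reverse (composition 1 S)) (Vec.reverse (composition 1 S')) d))
             (≡.trans size (≡.sym size'))
    ... | ≡.refl = g≉g' (λ b → trans (e b) (sym (e' b)))

theorem3p7 : ∀ {c ℓ} (F : Field c ℓ) (n k : ℕ) → 1 ≤ k → k ≤ n →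
    IsGroebnerBasis F n (Gset F n k) (J F n k)
    × (k < n → IsMinimal F n (Gset F n k))
theorem3p7 F n (suc K) _ K<n = Groebner.groebner F n K K<n , Groebner.minimal F n K K<n
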